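{- Fix an integer $p\geq 2$. Let $\mathcal{H}$ be an instance of $r$-Hypergraph Label Cover ($r\geq 2$), let $\mathcal{S}$ be an $(r,|C|,p)$-vector system, let $G$ be the graph obtained by the basic reduction, and let $k\geq 1$. (a) If some assignment satisfies all hyperedges of $\mathcal{H}$, then $G^{\otimes k}$ contains an $s$-$t$ path $P$ with $\|\mathrm{cost}(P)\|_p^p=1$. (b) If every assignment weakly satisfies at most an $\varepsilon$-fraction of the hyperedges, then every $s$-$t$ path $P$ in $G^{\otimes k}$ satisfies $\|\mathrm{cost}(P)\|_p^p\geq\alpha_k\,\mathrm{b}_k(p)$, where $\alpha_k=(1-p/r)^{pk}(1-p^2\varepsilon)^k$. Moreover, $|E(G^{\otimes k})|\leq|\mathcal{H}|^{2k}$, where $|\mathcal{H}|$ is the maximum of $|V|$, $|L|$, $|C|$ and $|\mathcal{E}|$.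
   Context: $r$-Hypergraph Label Cover: an $r$-partite hypergraph $\mathcal{H}=(V,\mathcal{E})$, $V=V_1\cup\dots\cup V_r$, each hyperedge containing exactly one vertex of each $V_j$; label set $L$; color set $C$; maps $\pi_h^u:L\to C$ for $h\in\mathcal{E}$, $u\in h$. For an assignment $\sigma:V\to L$, the color of $u$ in $h$ is $\pi_h^u(\sigma(u))$; $\sigma$ satisfies $h$ if all vertices of $h$ have the same color in $h$, and weakly satisfies $h$ if two distinct vertices of $h$ have the same color in $h$. Multilinear product: $\langle u_1,\dots,u_p\rangle=\sum_j\prod_i u_i(j)$. An $(r,q,p)$-vector system is a collection $\{v_j^c: j\in[r], c\in[q]\}$ of $rq$ distinct vectors in $\mathbb{R}^{d_0}$ (color of $v_j^c$ is $c$) such that for any $u_1,\dots,u_p$ from it (repetitions allowed), $\langle u_1,\dots,u_p\rangle=0$ if two distinct vectors in the list share a color, and otherwise $\langle u_1,\dots,u_p\rangle=r^{ -t}$ with $t$ the number of distinct vectors in the list. Colors are identified with $C$. Basic reduction: let $m=|\mathcal{E}|$ and $\mathcal{S}=\{v_j^c\}$ an $(r,|C|,p)$-vector system in $\mathbb{R}^{d_0}$. For each $u\in V$ create a block of $|L|$ parallel edges $e(u,l)$, $l\in L$, and compose all blocks in series between $s$ and $t$. Costs in $\mathbb{R}^{d_0m}=\bigoplus_{h\in\mathcal{E}}\mathbb{R}^{d_0}$: $c(e(u,l))=\bigoplus_h c^h(e(u,l))$ with $c^h(e(u,l))=v_j^{\pi_h^u(l)}$ if $u\in h\cap V_j$,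 and $0$ if $u\notin h$. Tensoring: $G_1\otimes G_2$ replaces every edge $e_1$ of $G_1$ by a copy of $G_2$; the edge $e_2$ of that copy is denoted $(e_1,e_2)$ and has cost $c_1(e_1)\otimes c_2(e_2)$. $G^{\otimes 0}$ is a single edge $(s,t)$ of cost $1\in\mathbb{R}^1$, $G^{\otimes k}=G\otimes G^{\otimes(k-1)}$. $\mathrm{cost}(P)=\sum_{e\in P}c(e)$. Scaled norm on the cost space of $G^{\otimes k}$: $\|x\|_p^p=m^{ -k}\sum_i|x_i|^p$. $\mathrm{b}_k(p)$ is the number of $k$-level partitions $(T_1,\dots,T_k)$ of $[p]$ ($T_1$ a partition of $[p]$ into nonempty parts, $T_i$ a refinement of $T_{i-1}$).
   Formalization: Part (a) additionally assumes that p is even or that all coordinates of the vector system are nonnegative; part (b) additionally assumes p ≤ r and p²ε ≤ 1; the hypergraph is assumed to have at least one hyperedge. Without the first three, the statement as worded has counterexamples. -}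

module Defs where

open import Algebra.Bundles.Raw using (RawRing)
open import Data.Bool.Base using (true; false)
import Data.Bool.Properties as Bool
open import Data.Empty using (⊥)
open import Data.Fin.Base using (Fin; zero; suc; inject₁)
import Data.Fin.Properties as Fin
open import Data.Fin.Relation.Unary.Top using (view; ‵fromℕ; ‵inject₁)
open import Data.Fin.Subset using (Subset; _∈_; _⊆_)
open import Data.Fin.Subset.Properties using (_∈?_; _⊆?_)
open import Data.Integer.Base using (+_)
open import Data.List.Base using (List; []; _∷_; [_]; length; filter; allFin; cartesianProductWith; deduplicate; tabulate)
open import Data.List.Relation.Unary.Unique.Propositional using (Unique)
open import Data.Nat.Base as ℕ using (ℕ; zero; suc; NonZero; _∸_)
import Data.Nat.Properties as ℕ
open import Data.Product.Base using (Σ; ∃; _×_; _,_; proj₁; proj₂)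
open import Data.Product.Properties using () renaming (≡-dec to ×-≡-dec)
open import Data.Rational.Base as ℚ using (ℚ; 0ℚ; 1ℚ; ½)
import Data.Rational.Properties as ℚ
open import Data.Rational.Solver using (module +-*-Solver)
open import Data.Sum.Base using (_⊎_; inj₁; inj₂)
open import Data.Unit.Base using (⊤)
open import Data.Vec.Base using (Vec; []; _∷_; lookup)
import Data.Vec.Properties as Vec
open import Data.Vec.Functional as Vector using (Vector)
open import Data.Vec.Relation.Unary.Linked using (Linked; linked?)
open import Relation.Binary.Construct.Closure.ReflexiveTransitive using (Star; ε; _◅_)
open import Relation.Binary.PropositionalEquality using (_≡_; _≢_; refl; sym; trans; cong; cong₂)
open import Relation.Nullary using (¬_; Dec; yes; no)
open import Relation.Nullary.Decidable using (¬?; _×-dec_; _→-dec_)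

------------------------------------------------------------------------

-- Real numbers are Cauchy sequences of rationals, compared by _≈_; all
-- operations are pointwise.
record ℝ : Set where
  constructor mkℝ
  field
    seq    : ℕ → ℚ
    cauchy : ∀ δ → 0ℚ ℚ.< δ →
             ∃ λ N → ∀ i j → N ℕ.≤ i → N ℕ.≤ j → ℚ.∣ seq i ℚ.- seq j ∣ ℚ.≤ δ

open ℝ public

infix 4 _≈_ _≤_

_≈_ : ℝ → ℝ → Set
x ≈ y = ∀ δ → 0ℚ ℚ.< δ → ∃ λ N → ∀ i → N ℕ.≤ i → ℚ.∣ seq x i ℚ.- seq y i ∣ ℚ.≤ δ

_≤_ : ℝ → ℝ → Set
x ≤ y = ∀ δ → 0ℚ ℚ.< δ → ∃ λ N → ∀ i → N ℕ.≤ i → seq x i ℚ.≤ seq y i ℚ.+ δ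

private
  module Identities where
    open +-*-Solver

    neg-sub : ∀ a b → ℚ.- (a ℚ.- b) ≡ b ℚ.- a
    neg-sub = solve 2 (λ a b → :- (a :- b) := b :- a) refl

    add-sub : ∀ a b → b ℚ.+ (a ℚ.- b) ≡ a
    add-sub = solve 2 (λ a b → b :+ (a :- b) := a) refl

    sub-cancel : ∀ a b → (a ℚ.+ b) ℚ.- a ≡ b
    sub-cancel = solve 2 (λ a b → (a :+ b) :- a := b) refl

    sub-neg : ∀ a b → (ℚ.- a) ℚ.- (ℚ.- b) ≡ b ℚ.- a
    sub-neg = solve 2 (λ a b → (:- a) :- (:- b) := b :- a) refl

    sum-sub : ∀ a b c d → (a ℚ.+ b) ℚ.- (c ℚ.+ d) ≡ (a ℚ.- c) ℚ.+ (b ℚ.- d)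
    sum-sub = solve 4 (λ a b c d → (a :+ b) :- (c :+ d) := (a :- c) :+ (b :- d)) refl

    prod-sub : ∀ a b c d → a ℚ.* b ℚ.- c ℚ.* d ≡ a ℚ.* (b ℚ.- d) ℚ.+ d ℚ.* (a ℚ.- c)
    prod-sub = solve 4 (λ a b c d → a :* b :- c :* d := a :* (b :- d) :+ d :* (a :- c)) refl

  open Identities

  half-pos : ∀ {δ} → 0ℚ ℚ.< δ → 0ℚ ℚ.< ½ ℚ.* δ
  half-pos {δ} 0<δ = ℚ.≤-<-trans (ℚ.≤-reflexive (sym (ℚ.*-zeroʳ ½))) (ℚ.*-monoʳ-<-pos ½ 0<δ)

  halves : ∀ δ → ½ ℚ.* δ ℚ.+ ½ ℚ.* δ ≡ δ
  halves δ = trans (sym (ℚ.*-distribʳ-+ δ ½ ½)) (ℚ.*-identityˡ δ)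

  abs-≤ : ∀ a c → a ℚ.≤ c → ℚ.- a ℚ.≤ c → ℚ.∣ a ∣ ℚ.≤ c
  abs-≤ a c a≤c -a≤c with ℚ.∣p∣≡p∨∣p∣≡-p a
  ... | inj₁ eq = ℚ.≤-trans (ℚ.≤-reflexive eq) a≤c
  ... | inj₂ eq = ℚ.≤-trans (ℚ.≤-reflexive eq) -a≤c

  abs-sub-comm : ∀ a b → ℚ.∣ a ℚ.- b ∣ ≡ ℚ.∣ b ℚ.- a ∣
  abs-sub-comm a b = trans (sym (ℚ.∣-p∣≡∣p∣ (a ℚ.- b))) (cong ℚ.∣_∣ (neg-sub a b))

  abs-triangle : ∀ a b → ℚ.∣ a ∣ ℚ.≤ ℚ.∣ b ∣ ℚ.+ ℚ.∣ a ℚ.- b ∣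
  abs-triangle a b = begin
    ℚ.∣ a ∣                       ≡⟨ cong ℚ.∣_∣ (add-sub a b) ⟨
    ℚ.∣ b ℚ.+ (a ℚ.- b) ∣         ≤⟨ ℚ.∣p+q∣≤∣p∣+∣q∣ b (a ℚ.- b) ⟩
    ℚ.∣ b ∣ ℚ.+ ℚ.∣ a ℚ.- b ∣     ∎
    where open ℚ.≤-Reasoning

  sub-≤ : ∀ a b c → a ℚ.≤ b ℚ.+ c → a ℚ.- b ℚ.≤ c
  sub-≤ a b c a≤b+c = begin
    a ℚ.- b            ≤⟨ ℚ.+-monoˡ-≤ (ℚ.- b) a≤b+c ⟩
    (b ℚ.+ c) ℚ.- b    ≡⟨ sub-cancel b c ⟩
    c                  ∎
    where open ℚ.≤-Reasoning

  abs-abs-sub : ∀ a b → ℚ.∣ ℚ.∣ a ∣ ℚ.- ℚ.∣ b ∣ ∣ ℚ.≤ ℚ.∣ a ℚ.- b ∣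
  abs-abs-sub a b = abs-≤ (ℚ.∣ a ∣ ℚ.- ℚ.∣ b ∣) ℚ.∣ a ℚ.- b ∣
    (sub-≤ ℚ.∣ a ∣ ℚ.∣ b ∣ ℚ.∣ a ℚ.- b ∣ (abs-triangle a b))
    (begin
      ℚ.- (ℚ.∣ a ∣ ℚ.- ℚ.∣ b ∣)   ≡⟨ neg-sub ℚ.∣ a ∣ ℚ.∣ b ∣ ⟩
      ℚ.∣ b ∣ ℚ.- ℚ.∣ a ∣         ≤⟨ sub-≤ ℚ.∣ b ∣ ℚ.∣ a ∣ ℚ.∣ b ℚ.- a ∣ (abs-triangle b a) ⟩
      ℚ.∣ b ℚ.- a ∣               ≡⟨ abs-sub-comm b a ⟩
      ℚ.∣ a ℚ.- b ∣               ∎)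
    where open ℚ.≤-Reasoning

  mul-≤ : ∀ a b c d → 0ℚ ℚ.≤ b → 0ℚ ℚ.≤ c → a ℚ.≤ c → b ℚ.≤ d → a ℚ.* b ℚ.≤ c ℚ.* d
  mul-≤ a b c d 0≤b 0≤c a≤c b≤d = begin
    a ℚ.* b   ≤⟨ ℚ.*-monoʳ-≤-nonNeg b {{ℚ.nonNegative 0≤b}} a≤c ⟩
    c ℚ.* b   ≤⟨ ℚ.*-monoˡ-≤-nonNeg c {{ℚ.nonNegative 0≤c}} b≤d ⟩
    c ℚ.* d   ∎
    where open ℚ.≤-Reasoning

  bounded : ∀ x → ∃ λ B → 0ℚ ℚ.< B × ∃ λ N → ∀ i → N ℕ.≤ i → ℚ.∣ seq x i ∣ ℚ.≤ B
  bounded x with cauchy x 1ℚ (ℚ.positive⁻¹ 1ℚ)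
  ... | N , close = ℚ.∣ seq x N ∣ ℚ.+ 1ℚ
    , ℚ.+-mono-≤-< {0ℚ} {ℚ.∣ seq x N ∣} {0ℚ} {1ℚ} (ℚ.0≤∣p∣ (seq x N)) (ℚ.positive⁻¹ 1ℚ)
    , N , λ i N≤i → ℚ.≤-trans (abs-triangle (seq x i) (seq x N))
        (ℚ.+-monoʳ-≤ ℚ.∣ seq x N ∣ (close i N N≤i ℕ.≤-refl))

  sum-bound : ∀ {δ} a b c d → ℚ.∣ a ℚ.- c ∣ ℚ.≤ ½ ℚ.* δ → ℚ.∣ b ℚ.- d ∣ ℚ.≤ ½ ℚ.* δ →
              ℚ.∣ (a ℚ.+ b) ℚ.- (c ℚ.+ d) ∣ ℚ.≤ δ
  sum-bound {δ} a b c d a~c b~d = begin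
    ℚ.∣ (a ℚ.+ b) ℚ.- (c ℚ.+ d) ∣       ≡⟨ cong ℚ.∣_∣ (sum-sub a b c d) ⟩
    ℚ.∣ (a ℚ.- c) ℚ.+ (b ℚ.- d) ∣       ≤⟨ ℚ.∣p+q∣≤∣p∣+∣q∣ (a ℚ.- c) (b ℚ.- d) ⟩
    ℚ.∣ a ℚ.- c ∣ ℚ.+ ℚ.∣ b ℚ.- d ∣     ≤⟨ ℚ.+-mono-≤ a~c b~d ⟩
    ½ ℚ.* δ ℚ.+ ½ ℚ.* δ                 ≡⟨ halves δ ⟩
    δ                                   ∎
    where open ℚ.≤-Reasoning

  prod-bound : ∀ {A B η} a b c d → 0ℚ ℚ.≤ A → 0ℚ ℚ.≤ B → ℚ.∣ a ∣ ℚ.≤ A → ℚ.∣ d ∣ ℚ.≤ B →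
               ℚ.∣ a ℚ.- c ∣ ℚ.≤ η → ℚ.∣ b ℚ.- d ∣ ℚ.≤ η →
               ℚ.∣ a ℚ.* b ℚ.- c ℚ.* d ∣ ℚ.≤ (A ℚ.+ B) ℚ.* η
  prod-bound {A} {B} {η} a b c d 0≤A 0≤B a≤A d≤B a~c b~d = begin
    ℚ.∣ a ℚ.* b ℚ.- c ℚ.* d ∣
      ≡⟨ cong ℚ.∣_∣ (prod-sub a b c d) ⟩
    ℚ.∣ a ℚ.* (b ℚ.- d) ℚ.+ d ℚ.* (a ℚ.- c) ∣
      ≤⟨ ℚ.∣p+q∣≤∣p∣+∣q∣ (a ℚ.* (b ℚ.- d)) (d ℚ.* (a ℚ.- c)) ⟩
    ℚ.∣ a ℚ.* (b ℚ.- d) ∣ ℚ.+ ℚ.∣ d ℚ.* (a ℚ.- c) ∣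
      ≡⟨ cong₂ ℚ._+_ (ℚ.∣p*q∣≡∣p∣*∣q∣ a (b ℚ.- d)) (ℚ.∣p*q∣≡∣p∣*∣q∣ d (a ℚ.- c)) ⟩
    ℚ.∣ a ∣ ℚ.* ℚ.∣ b ℚ.- d ∣ ℚ.+ ℚ.∣ d ∣ ℚ.* ℚ.∣ a ℚ.- c ∣
      ≤⟨ ℚ.+-mono-≤ (mul-≤ ℚ.∣ a ∣ ℚ.∣ b ℚ.- d ∣ A η (ℚ.0≤∣p∣ (b ℚ.- d)) 0≤A a≤A b~d)
                    (mul-≤ ℚ.∣ d ∣ ℚ.∣ a ℚ.- c ∣ B η (ℚ.0≤∣p∣ (a ℚ.- c)) 0≤B d≤B a~c) ⟩
    A ℚ.* η ℚ.+ B ℚ.* η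
      ≡⟨ ℚ.*-distribʳ-+ η A B ⟨
    (A ℚ.+ B) ℚ.* η ∎
    where open ℚ.≤-Reasoning

  divide : ∀ {A δ} → 0ℚ ℚ.< A → 0ℚ ℚ.< δ → ∃ λ η → 0ℚ ℚ.< η × A ℚ.* η ≡ δ
  divide {A} {δ} 0<A 0<δ = A⁻¹ ℚ.* δ
    , ℚ.≤-<-trans (ℚ.≤-reflexive (sym (ℚ.*-zeroʳ A⁻¹))) (ℚ.*-monoʳ-<-pos A⁻¹ 0<δ)
    , trans (sym (ℚ.*-assoc A A⁻¹ δ)) (trans (cong (ℚ._* δ) (ℚ.*-inverseʳ A)) (ℚ.*-identityˡ δ))
    where
    instance
      A-positive : ℚ.Positive A
      A-positive = ℚ.positive 0<A
      A-nonZero : ℚ.NonZero A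
      A-nonZero = ℚ.pos⇒nonZero A
    A⁻¹ : ℚ
    A⁻¹ = ℚ.1/ A
    instance
      A⁻¹-positive : ℚ.Positive A⁻¹
      A⁻¹-positive = ℚ.1/pos⇒pos A

  prod-cauchy : ∀ x y δ → 0ℚ ℚ.< δ → ∃ λ N → ∀ i j → N ℕ.≤ i → N ℕ.≤ j →
                ℚ.∣ seq x i ℚ.* seq y i ℚ.- seq x j ℚ.* seq y j ∣ ℚ.≤ δ
  prod-cauchy x y δ 0<δ =
    let A , 0<A , K , hA = bounded x
        B , 0<B , L , hB = bounded y
        η , 0<η , eq     = divide {A ℚ.+ B} {δ} (ℚ.+-mono-< {0ℚ} {A} {0ℚ} {B} 0<A 0<B) 0<δ
        M , hx           = cauchy x η 0<η
        N , hy           = cauchy y η 0<η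
    in (K ℕ.⊔ L) ℕ.⊔ (M ℕ.⊔ N) , λ i j i≥ j≥ →
      let i≥KL = ℕ.m⊔n≤o⇒m≤o (K ℕ.⊔ L) (M ℕ.⊔ N) i≥
          j≥KL = ℕ.m⊔n≤o⇒m≤o (K ℕ.⊔ L) (M ℕ.⊔ N) j≥
          i≥MN = ℕ.m⊔n≤o⇒n≤o (K ℕ.⊔ L) (M ℕ.⊔ N) i≥
          j≥MN = ℕ.m⊔n≤o⇒n≤o (K ℕ.⊔ L) (M ℕ.⊔ N) j≥
      in ℚ.≤-trans
        (prod-bound {A} {B} {η} (seq x i) (seq y i) (seq x j) (seq y j)
          (ℚ.<⇒≤ 0<A) (ℚ.<⇒≤ 0<B)
          (hA i (ℕ.m⊔n≤o⇒m≤o K L i≥KL)) (hB j (ℕ.m⊔n≤o⇒n≤o K L j≥KL))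
          (hx i j (ℕ.m⊔n≤o⇒m≤o M N i≥MN) (ℕ.m⊔n≤o⇒m≤o M N j≥MN))
          (hy i j (ℕ.m⊔n≤o⇒n≤o M N i≥MN) (ℕ.m⊔n≤o⇒n≤o M N j≥MN)))
        (ℚ.≤-reflexive eq)

infix  8 -_
infixl 7 _*_
infixl 6 _+_ _-_

fromℚ : ℚ → ℝ
fromℚ a .seq _ = a
fromℚ a .cauchy δ 0<δ = 0 , λ _ _ _ _ →
  ℚ.≤-trans (ℚ.≤-reflexive (cong ℚ.∣_∣ (ℚ.+-inverseʳ a))) (ℚ.<⇒≤ 0<δ)

fromℕ : ℕ → ℝ
fromℕ n = fromℚ (+ n ℚ./ 1)

0ℝ 1ℝ : ℝ
0ℝ = fromℚ 0ℚ
1ℝ = fromℚ 1ℚ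

_+_ : ℝ → ℝ → ℝ
(x + y) .seq i = seq x i ℚ.+ seq y i
(x + y) .cauchy δ 0<δ
  with cauchy x (½ ℚ.* δ) (half-pos 0<δ) | cauchy y (½ ℚ.* δ) (half-pos 0<δ)
... | M , hx | N , hy = M ℕ.⊔ N , λ i j i≥ j≥ →
  sum-bound {δ} (seq x i) (seq y i) (seq x j) (seq y j)
    (hx i j (ℕ.m⊔n≤o⇒m≤o M N i≥) (ℕ.m⊔n≤o⇒m≤o M N j≥))
    (hy i j (ℕ.m⊔n≤o⇒n≤o M N i≥) (ℕ.m⊔n≤o⇒n≤o M N j≥))

-_ : ℝ → ℝ
(- x) .seq i = ℚ.- seq x i
(- x) .cauchy δ 0<δ with cauchy x δ 0<δ
... | N , hx = N , λ i j i≥ j≥ → ℚ.≤-trans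
  (ℚ.≤-reflexive (cong ℚ.∣_∣ (sub-neg (seq x i) (seq x j)))) (hx j i j≥ i≥)

_-_ : ℝ → ℝ → ℝ
x - y = x + (- y)

∣_∣ : ℝ → ℝ
∣ x ∣ .seq i = ℚ.∣ seq x i ∣
∣ x ∣ .cauchy δ 0<δ with cauchy x δ 0<δ
... | N , hx = N , λ i j i≥ j≥ →
  ℚ.≤-trans (abs-abs-sub (seq x i) (seq x j)) (hx i j i≥ j≥)

_*_ : ℝ → ℝ → ℝ
(x * y) .seq i = seq x i ℚ.* seq y i
(x * y) .cauchy = prod-cauchy x y

ℝ-rawRing : RawRing _ _
ℝ-rawRing = record
  { Carrier = ℝ ; _≈_ = _≈_ ; _+_ = _+_ ; _*_ = _*_ ; -_ = -_ ; 0# = 0ℝ ; 1# = 1ℝ }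

open import Algebra.Definitions.RawSemiring (RawRing.rawSemiring ℝ-rawRing) public
  using (_^_; sum; product)

------------------------------------------------------------------------

infixl 6 _+ᵛ_
infixl 7 _⊗ᵛ_

0ᵛ : ∀ {d} → Vector ℝ d
0ᵛ _ = 0ℝ

_+ᵛ_ : ∀ {d} → Vector ℝ d → Vector ℝ d → Vector ℝ d
_+ᵛ_ = Vector.zipWith _+_

_⊗ᵛ_ : ∀ {c d} → Vector ℝ c → Vector ℝ d → Vector ℝ (c ℕ.* d)
x ⊗ᵛ y = Vector.concat (λ i j → x i * y j)

multilinear : ∀ {p d} → Vector (Vector ℝ d) p → ℝ
multilinear u = sum (λ j → product (λ i → u i j))

-- The p-th power of the scaled norm on the cost space of the k-th tensor
-- power: m⁻ᵏ Σᵢ |xᵢ|ᵖ.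
∥_∥^ : ∀ {d} → Vector ℝ d → (p m k : ℕ) .{{_ : NonZero m}} → ℝ
∥ x ∥^ p m k = fromℚ (+ 1 ℚ./ m) ^ k * sum (λ i → ∣ x i ∣ ^ p)

-- A list u₁,…,u_p of vectors of the system is given by the list of their
-- indices (j , c); as the vectors are distinct, counting distinct indices is
-- counting distinct vectors.
record VectorSystem (r q p d₀ : ℕ) .{{_ : NonZero r}} : Set where
  field
    vec : Fin r × Fin q → Vector ℝ d₀

  color : Fin r × Fin q → Fin q
  color = proj₂

  SharesColor : Vector (Fin r × Fin q) p → Set
  SharesColor u = ∃ λ a → ∃ λ b → u a ≢ u b × color (u a) ≡ color (u b)

  #distinct : Vector (Fin r × Fin q) p → ℕ
  #distinct u = length (deduplicate (×-≡-dec Fin._≟_ Fin._≟_) (tabulate u))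

  field
    distinct    : ∀ a b → (∀ i → vec a i ≈ vec b i) → a ≡ b
    shared      : ∀ u → SharesColor u → multilinear (λ a → vec (u a)) ≈ 0ℝ
    otherwise   : ∀ u → ¬ SharesColor u →
                  multilinear (λ a → vec (u a)) ≈ fromℚ (+ 1 ℚ./ r) ^ #distinct u

------------------------------------------------------------------------

-- A hyperedge h has exactly one vertex in each part Vⱼ, namely vertex h j;
-- accordingly the map π_h^u for u = vertex h j is π h j.
record LabelCover (r : ℕ) : Set where
  field
    ∣V∣ ∣L∣ ∣C∣ ∣E∣ : ℕ
    part        : Fin ∣V∣ → Fin r
    vertex      : Fin ∣E∣ → Fin r → Fin ∣V∣
    vertex-part : ∀ h j → part (vertex h j) ≡ j
    π           : Fin ∣E∣ → Fin r → Fin ∣L∣ → Fin ∣C∣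

  Assignment : Set
  Assignment = Fin ∣V∣ → Fin ∣L∣

  colorIn : Assignment → Fin ∣E∣ → Fin r → Fin ∣C∣
  colorIn σ h j = π h j (σ (vertex h j))

  Satisfies : Assignment → Fin ∣E∣ → Set
  Satisfies σ h = ∀ i j → colorIn σ h i ≡ colorIn σ h j

  WeaklySatisfies : Assignment → Fin ∣E∣ → Set
  WeaklySatisfies σ h =
    ∃ λ i → ∃ λ j → vertex h i ≢ vertex h j × colorIn σ h i ≡ colorIn σ h j

  weaklySatisfies? : ∀ σ h → Dec (WeaklySatisfies σ h)
  weaklySatisfies? σ h = Fin.any? λ i → Fin.any? λ j →
    ¬? (vertex h i Fin.≟ vertex h j) ×-dec (colorIn σ h i Fin.≟ colorIn σ h j)

  #weaklySatisfied : Assignment → ℕ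
  #weaklySatisfied σ = length (filter (weaklySatisfies? σ) (allFin ∣E∣))

  size : ℕ
  size = ∣V∣ ℕ.⊔ ∣L∣ ℕ.⊔ ∣C∣ ℕ.⊔ ∣E∣

------------------------------------------------------------------------

data Node (I : Set) : Set where
  s t   : Node I
  inner : I → Node I

-- Edges are oriented; the orientation determines how a copy of the second graph
-- is glued in when tensoring, and paths follow it.  In the series-parallel
-- graphs below, every simple s-t path of the underlying undirected graph does.
record Graph (d : ℕ) : Set₁ where
  field
    Inner Edge : Set
    tail head  : Edge → Node Inner
    cost       : Edge → Vector ℝ d

  Arc : Node Inner → Node Inner → Set
  Arc x y = Σ Edge λ e → tail e ≡ x × head e ≡ y

  Walk : Node Inner → Node Inner → Set
  Walk = Star Arc

  visited : ∀ {x y} → Walk x y → List (Node Inner)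
  visited {x} ε       = [ x ]
  visited {x} (_ ◅ w) = x ∷ visited w

  walkCost : ∀ {x y} → Walk x y → Vector ℝ d
  walkCost ε             = 0ᵛ
  walkCost ((e , _) ◅ w) = cost e +ᵛ walkCost w

  STPath : Set
  STPath = Σ (Walk s t) λ w → Unique (visited w)

  pathCost : STPath → Vector ℝ d
  pathCost (w , _) = walkCost w

-- The copy of G₂ replacing the edge e₁ has its s and t identified with the
-- endpoints of e₁; only its inner nodes are new.
_⊗_ : ∀ {c d} → Graph c → Graph d → Graph (c ℕ.* d)
G₁ ⊗ G₂ = record
  { Inner = I
  ; Edge  = G₁.Edge × G₂.Edge
  ; tail  = λ (e₁ , e₂) → glue e₁ (G₂.tail e₂)
  ; head  = λ (e₁ , e₂) → glue e₁ (G₂.head e₂)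
  ; cost  = λ (e₁ , e₂) → G₁.cost e₁ ⊗ᵛ G₂.cost e₂
  }
  where
  module G₁ = Graph G₁
  module G₂ = Graph G₂

  I : Set
  I = G₁.Inner ⊎ (G₁.Edge × G₂.Inner)

  old : Node G₁.Inner → Node I
  old s         = s
  old t         = t
  old (inner x) = inner (inj₁ x)

  glue : G₁.Edge → Node G₂.Inner → Node I
  glue e₁ s         = old (G₁.tail e₁)
  glue e₁ t         = old (G₁.head e₁)
  glue e₁ (inner x) = inner (inj₂ (e₁ , x))

singleEdge : Graph 1
singleEdge = record
  { Inner = ⊥ ; Edge = ⊤ ; tail = λ _ → s ; head = λ _ → t ; cost = λ _ _ → 1ℝ }

infixl 8 _^⊗_

_^⊗_ : ∀ {d} → Graph d → (k : ℕ) → Graph (d ℕ.^ k)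
G ^⊗ zero  = singleEdge
G ^⊗ suc k = G ⊗ (G ^⊗ k)

------------------------------------------------------------------------

-- The nodes 0,…,n separating n blocks composed in series: node 0 is s, node n
-- is t, the others are inner.  (For n = 0 there are no blocks and no edges.)
junction : ∀ n → Fin (suc n) → Node (Fin (n ∸ 1))
junction _       zero = s
junction (suc n) (suc i) with view i
... | ‵fromℕ     = t
... | ‵inject₁ j = inner j

module _ {r p d₀ : ℕ} .{{_ : NonZero r}} (H : LabelCover r) where
  open LabelCover H

  module _ (S : VectorSystem r ∣C∣ p d₀) where
    open VectorSystem S

    -- u ∈ h holds exactly when u is the vertex of h in the part of u.
    edgeCost : Fin ∣E∣ → Fin ∣V∣ × Fin ∣L∣ → Vector ℝ d₀
    edgeCost h (u , l) with vertex h (part u) Fin.≟ u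
    ... | yes _ = vec (part u , π h (part u) l)
    ... | no  _ = 0ᵛ

    basicReduction : Graph (∣E∣ ℕ.* d₀)
    basicReduction = record
      { Inner = Fin (∣V∣ ∸ 1)
      ; Edge  = Fin ∣V∣ × Fin ∣L∣
      ; tail  = λ (u , _) → junction ∣V∣ (inject₁ u)
      ; head  = λ (u , _) → junction ∣V∣ (suc u)
      ; cost  = λ e → Vector.concat (λ h → edgeCost h e)
      }

------------------------------------------------------------------------

-- A partition of Fin p is encoded by the vector whose i-th entry is the part
-- containing i, so each partition is encoded by exactly one vector.
IsPartition : ∀ {p} → Vec (Subset p) p → Set
IsPartition T = (∀ i → i ∈ lookup T i)
              × (∀ i j → j ∈ lookup T i → lookup T j ≡ lookup T i)

RefinedBy : ∀ {p} → Vec (Subset p) p → Vec (Subset p) p → Set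
RefinedBy T T′ = ∀ i → lookup T′ i ⊆ lookup T i

isPartition? : ∀ {p} (T : Vec (Subset p) p) → Dec (IsPartition T)
isPartition? T = Fin.all? (λ i → i ∈? lookup T i)
  ×-dec Fin.all? (λ i → Fin.all? λ j →
    (j ∈? lookup T i) →-dec Vec.≡-dec Bool._≟_ (lookup T j) (lookup T i))

refinedBy? : ∀ {p} (T T′ : Vec (Subset p) p) → Dec (RefinedBy T T′)
refinedBy? T T′ = Fin.all? λ i → lookup T′ i ⊆? lookup T i

allVecs : ∀ {A : Set} → List A → (n : ℕ) → List (Vec A n)
allVecs xs zero    = [ [] ]
allVecs xs (suc n) = cartesianProductWith _∷_ xs (allVecs xs n)

allPartitions : (p : ℕ) → List (Vec (Subset p) p)
allPartitions p = filter isPartition? (allVecs (allVecs (true ∷ false ∷ []) p) p)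

b : (k p : ℕ) → ℕ
b k p = length (filter (linked? refinedBy?) (allVecs (allPartitions p) k))

------------------------------------------------------------------------

α : (k p r : ℕ) .{{_ : NonZero r}} → ℝ → ℝ
α k p r ϵ = (1ℝ - fromℚ (+ p ℚ./ r)) ^ (p ℕ.* k) * (1ℝ - fromℕ (p ℕ.^ 2) * ϵ) ^ k

{-# OPTIONS --safe #-}
module Submission where

-- An s-t path of the k-th tensor power is a tree: a label at every vertex u and,
-- inside the chosen edge of block u, a path of the (k-1)-st power.  Expanding the
-- multilinear product M_k of the costs of p such trees τ₁,…,τ_p gives
--
--   M_k(τ) = Σ_h Σ_{f : [p] → [r]} ⟨v₁,…,v_p⟩ · M_{k-1}(τ′),
--
-- where vᵢ is the vector of part f i whose color is that of τᵢ in h, and τ′ᵢ is the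
-- subtree of τᵢ at the vertex of h in part f i.
--
-- If all trees carry one satisfying assignment, only the constant f contribute,
-- each 1/r, so M_k = m^k.
--
-- For the lower bound all terms are nonnegative, and the f are grouped by their
-- kernel, a partition T of [p].  Suppose the trees are constant on the parts of a
-- partition refined by T.  Then the labels met by f come from a single assignment,
-- so for all but an ε-fraction of the h no color is shared and the product of the
-- vectors is at least r^{-|T|}; there are enough f with kernel T for these terms to
-- sum to (1-p/r)^p; and the subtrees are constant on the parts of T, so induction
-- on k counts the chains of refinements.  Since 0 ≤ ε, the factor 1-ε obtained in
-- this way is at least 1-p²ε.

open import Algebra.Bundles using (CommutativeRing; Monoid; RawMonoid; RawRing; Semiring)
open import Data.Bool.Base using (true; false)
open import Data.Fin.Base as Fin using (Fin; zero; suc; inject₁; toℕ; quotRem; _↑ˡ_; _↑ʳ_)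
import Data.Fin.Properties as Fin
open import Data.Fin.Relation.Unary.Top using (view; ‵fromℕ; ‵inject₁; view-fromℕ)
open import Data.Fin.Subset using (Subset; _∈_; _⊆_; ⊤)
open import Data.Fin.Subset.Properties using (_∈?_; ∈⊤; ⊆-antisym)
open import Data.Integer.Base using (+_)
import Data.Integer.Solver as ℤ
open import Data.List.Base as List using (List; []; _∷_; length; filter; cartesianProductWith; deduplicate)
import Data.List.Membership.Propositional as List using (_∈_)
import Data.List.Membership.Propositional.Properties as List
import Data.List.Properties as List
open import Data.List.Relation.Unary.All as All using (All; []; _∷_)
import Data.List.Relation.Unary.All.Properties as All
open import Data.List.Relation.Unary.AllPairs using ([]; _∷_)
open import Data.List.Relation.Unary.Any as Any using ()
open import Data.List.Relation.Unary.Unique.Propositional using (Unique)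
import Data.List.Relation.Unary.Unique.Propositional.Properties as Unique
open import Data.Nat.Base as ℕ using (ℕ; zero; suc; NonZero; z≤n; s≤s)
open import Data.Nat.Divisibility using (_∣_; divides)
import Data.Nat.Properties as ℕ
open import Data.Product.Base as Product using (Σ; ∃; _×_; _,_; proj₁; proj₂)
open import Data.Product.Function.NonDependent.Propositional using (_×-↔_)
open import Data.Product.Properties using () renaming (≡-dec to ×-≡-dec)
open import Data.Rational.Base as ℚ using (ℚ; 0ℚ; 1ℚ; ½)
import Data.Rational.Properties as ℚ
open import Data.Rational.Solver using (module +-*-Solver)
import Data.Rational.Unnormalised.Base as ℚᵘ
import Data.Rational.Unnormalised.Properties as ℚᵘ
open import Data.Sum.Base using (_⊎_; inj₁; inj₂)
open import Data.Unit.Base as Unit using (tt)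
open import Data.Vec.Base as Vec using (Vec; []; _∷_; lookup)
open import Data.Vec.Functional as Vector using (Vector)
import Data.Vec.Properties as Vec
open import Data.Vec.Relation.Unary.Linked as Linked using (Linked; linked?; []; [-]; _∷_)
open import Defs hiding (_+_; _*_; -_; _-_; _≤_; _≈_; _^_; sum; product; ∣_∣)
open import Function.Base using (_∘_)
open import Function.Bundles using (_↔_)
open import Function.Construct.Composition using (_↔-∘_)
open import Level using (Level; 0ℓ; _⊔_)
open import Relation.Binary.Bundles using (Preorder)
open import Relation.Binary.Construct.Closure.ReflexiveTransitive using (Star; ε; _◅_; _◅◅_)
open import Relation.Binary.Core using (Rel)
open import Relation.Binary.Definitions using (Decidable; DecidableEquality)
open import Relation.Binary.PropositionalEquality as ≡ using (_≡_; _≢_)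
open import Relation.Binary.Structures using (IsPreorder; IsDecEquivalence)
open import Relation.Nullary using (¬_; Dec; yes; no; contradiction)
open import Relation.Nullary.Decidable using (¬?; _×-dec_; _→-dec_)

-- The norm contains |x|^p, whereas M_k is the signed sum of the x^p, and the vectors may have
-- negative entries. For (b) the passage is free, since x^p is at most |x|^p for every real x. For
-- (a) the two sums have to agree, hence the alternative that p is even or the vectors are
-- nonnegative. M_k itself is nonnegative whatever the signs, because a vector system admits only 0
-- and powers of 1/r as multilinear products; this is what allows terms to be discarded.
--
-- The induction speaks of p trees rather than one because after a single expansion the p factors
-- sit at different vertices and carry unrelated subtrees. Being constant on the parts of T is what
-- survives of their equality.
--
-- The constant (1-p/r)^p arises from choosing the values f i one at a time with weight 1/r: a
-- position opening a new part has to avoid fewer than p used values, and a position in a part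
-- already met has its value determined. The conditions p ≤ r and p²ε ≤ 1 make both factors of α_k
-- nonnegative, so that inequalities may be multiplied by them.

private variable
  a : Level
  P Q : Set a
  m n : ℕ

-- The order on Cauchy reals is not decidably total, so no estimate below splits on the sign of a
-- ring element. A preorder compatible with sums, together with nonnegativity of products, carries
-- all of them.
record IsOrderedRing {c ℓ₁ ℓ₂} (R : CommutativeRing c ℓ₁)
                     (_≤_ : Rel (CommutativeRing.Carrier R) ℓ₂) : Set (c ⊔ ℓ₁ ⊔ ℓ₂) where
  open CommutativeRing R
  field
    isPreorder : IsPreorder _≈_ _≤_
    +-mono-≤   : ∀ {w x y z} → w ≤ x → y ≤ z → (w + y) ≤ (x + z)
    *-nonNeg   : ∀ {x y} → 0# ≤ x → 0# ≤ y → 0# ≤ (x * y)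
    0≤1        : 0# ≤ 1#

Kernel : ∀ {r} → Rel (Fin m) a → Vector (Fin r) m → Set a
Kernel E f = ∀ i j → (E i j → f i ≡ f j) × (f i ≡ f j → E i j)

kernel? : ∀ {r} {E : Rel (Fin m) a} → Decidable E → (f : Vector (Fin r) m) → Dec (Kernel E f)
kernel? E? f = Fin.all? λ i → Fin.all? λ j →
  (E? i j →-dec (f i Fin.≟ f j)) ×-dec ((f i Fin.≟ f j) →-dec E? i j)

-- The number of classes of an equivalence relation: an element counts unless
-- it is related to a later one.
#classes : {E : Rel (Fin m) a} → Decidable E → ℕ
#classes {m = zero}  E? = 0
#classes {m = suc m} E? with Fin.any? (λ j → E? zero (suc j))
... | yes _ = #classes (λ i j → E? (suc i) (suc j))
... | no  _ = suc (#classes (λ i j → E? (suc i) (suc j)))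

-- Finite sums in an ordered commutative ring

module OrderedSums {c ℓ₁ ℓ₂} (R : CommutativeRing c ℓ₁)
                   {_≤_ : Rel (CommutativeRing.Carrier R) ℓ₂} (isOrderedRing : IsOrderedRing R _≤_) where

  open CommutativeRing R renaming (Carrier to A; zero to *-zero)
  open IsOrderedRing isOrderedRing
  open import Algebra.Properties.Semiring.Sum semiring
  open import Algebra.Definitions.RawSemiring (Semiring.rawSemiring semiring) using (_^_; product) renaming (_×_ to _·_)
  open import Algebra.Properties.CommutativeMonoid.Sum *-commutativeMonoid
    using () renaming (sum-cong-≋ to product-cong; ∑-distrib-+ to product-distrib-*; sum-replicate to product-replicate) public

  preorder : Preorder c ℓ₁ ℓ₂
  preorder = record { isPreorder = isPreorder }

  open IsPreorder isPreorder public
    using () renaming (refl to ≤-refl; trans to ≤-trans; reflexive to ≤-reflexive)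
  open import Relation.Binary.Reasoning.Preorder preorder

  +-monoˡ-≤ : ∀ {x y} z → x ≤ y → (x + z) ≤ (y + z)
  +-monoˡ-≤ z x≤y = +-mono-≤ x≤y ≤-refl

  +-monoʳ-≤ : ∀ z {x y} → x ≤ y → (z + x) ≤ (z + y)
  +-monoʳ-≤ z x≤y = +-mono-≤ ≤-refl x≤y

  +-nonNeg : ∀ {x y} → 0# ≤ x → 0# ≤ y → 0# ≤ (x + y)
  +-nonNeg {x} {y} 0≤x 0≤y = begin
    0#        ≈⟨ +-identityˡ 0# ⟨
    0# + 0#   ≲⟨ +-mono-≤ 0≤x 0≤y ⟩
    x + y     ∎

  x≤x+y : ∀ {x y} → 0# ≤ y → x ≤ (x + y)
  x≤x+y {x} {y} 0≤y = begin
    x        ≈⟨ +-identityʳ x ⟨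
    x + 0#   ≲⟨ +-monoʳ-≤ x 0≤y ⟩
    x + y    ∎

  x-y+y≈x : ∀ x y → (x - y) + y ≈ x
  x-y+y≈x x y = trans (+-assoc x (- y) y) (trans (+-congˡ (-‿inverseˡ y)) (+-identityʳ x))

  x+y-y≈x : ∀ x y → (x + y) - y ≈ x
  x+y-y≈x x y = trans (+-assoc x y (- y)) (trans (+-congˡ (-‿inverseʳ y)) (+-identityʳ x))

  x≤y⇒0≤y-x : ∀ {x y} → x ≤ y → 0# ≤ (y - x)
  x≤y⇒0≤y-x {x} {y} x≤y = begin
    0#      ≈⟨ -‿inverseʳ x ⟨
    x - x   ≲⟨ +-monoˡ-≤ (- x) x≤y ⟩
    y - x   ∎

  0≤y-x⇒x≤y : ∀ {x y} → 0# ≤ (y - x) → x ≤ y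
  0≤y-x⇒x≤y {x} {y} 0≤y-x = begin
    x             ≈⟨ +-identityˡ x ⟨
    0# + x        ≲⟨ +-monoˡ-≤ x 0≤y-x ⟩
    (y - x) + x   ≈⟨ x-y+y≈x y x ⟩
    y             ∎

  x≤y+z⇒x-z≤y : ∀ {x y z} → x ≤ (y + z) → (x - z) ≤ y
  x≤y+z⇒x-z≤y {x} {y} {z} x≤y+z = begin
    x - z         ≲⟨ +-monoˡ-≤ (- z) x≤y+z ⟩
    (y + z) - z   ≈⟨ x+y-y≈x y z ⟩
    y             ∎

  *-monoʳ-≤ : ∀ {z x y} → 0# ≤ z → x ≤ y → (z * x) ≤ (z * y)
  *-monoʳ-≤ {z} {x} {y} 0≤z x≤y = 0≤y-x⇒x≤y (begin
    0#                  ≲⟨ *-nonNeg 0≤z (x≤y⇒0≤y-x x≤y) ⟩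
    z * (y - x)         ≈⟨ distribˡ z y (- x) ⟩
    z * y + z * (- x)   ≈⟨ +-congˡ (-‿distribʳ-* z x) ⟨
    z * y - z * x       ∎)
    where open import Algebra.Properties.Ring ring using (-‿distribʳ-*)

  *-monoˡ-≤ : ∀ {z x y} → 0# ≤ z → x ≤ y → (x * z) ≤ (y * z)
  *-monoˡ-≤ {z} {x} {y} 0≤z x≤y = begin
    x * z   ≈⟨ *-comm x z ⟩
    z * x   ≲⟨ *-monoʳ-≤ 0≤z x≤y ⟩
    z * y   ≈⟨ *-comm z y ⟩
    y * z   ∎

  *-mono-≤ : ∀ {w x y z} → 0# ≤ w → 0# ≤ z → w ≤ x → y ≤ z → (w * y) ≤ (x * z)
  *-mono-≤ 0≤w 0≤z w≤x y≤z = ≤-trans (*-monoʳ-≤ 0≤w y≤z) (*-monoˡ-≤ 0≤z w≤x)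

  ^-nonNeg : ∀ {x} n → 0# ≤ x → 0# ≤ (x ^ n)
  ^-nonNeg zero    0≤x = 0≤1
  ^-nonNeg (suc n) 0≤x = *-nonNeg 0≤x (^-nonNeg n 0≤x)

  ^-anti-≤ : ∀ {x m n} → 0# ≤ x → x ≤ 1# → m ℕ.≤ n → (x ^ n) ≤ (x ^ m)
  ^-anti-≤ {n = zero}  0≤x x≤1 z≤n = ≤-refl
  ^-anti-≤ {x} {n = suc n} 0≤x x≤1 z≤n = begin
    x * x ^ n   ≲⟨ *-mono-≤ 0≤x 0≤1 x≤1 (^-anti-≤ {n = n} 0≤x x≤1 z≤n) ⟩
    1# * 1#     ≈⟨ *-identityˡ 1# ⟩
    1#          ∎
  ^-anti-≤ 0≤x x≤1 (s≤s m≤n) = *-monoʳ-≤ 0≤x (^-anti-≤ 0≤x x≤1 m≤n)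

  ×-nonNeg : ∀ n {x} → 0# ≤ x → 0# ≤ (n · x)
  ×-nonNeg zero    0≤x = ≤-refl
  ×-nonNeg (suc n) 0≤x = +-nonNeg 0≤x (×-nonNeg n 0≤x)

  ×-mono-≤ : ∀ {m n x} → 0# ≤ x → m ℕ.≤ n → (m · x) ≤ (n · x)
  ×-mono-≤ {n = n} 0≤x z≤n       = ×-nonNeg n 0≤x
  ×-mono-≤         0≤x (s≤s m≤n) = +-monoʳ-≤ _ (×-mono-≤ 0≤x m≤n)

  sum-mono : {f g : Vector A n} → (∀ i → f i ≤ g i) → sum f ≤ sum g
  sum-mono {n = zero}  f≤g = ≤-refl
  sum-mono {n = suc n} f≤g = +-mono-≤ (f≤g zero) (sum-mono (f≤g ∘ suc))

  sum-nonNeg : {f : Vector A n} → (∀ i → 0# ≤ f i) → 0# ≤ sum f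
  sum-nonNeg {n = n} {f} 0≤f = begin
    0#                           ≈⟨ sum-replicate-zero n ⟨
    sum (Vector.replicate n 0#)  ≲⟨ sum-mono 0≤f ⟩
    sum f                        ∎

  sum-zero : {f : Vector A n} → (∀ i → f i ≈ 0#) → sum f ≈ 0#
  sum-zero {n = n} f≈0 = trans (sum-cong-≋ f≈0) (sum-replicate-zero n)

  sum-single : ∀ {f : Vector A n} i → (∀ j → j ≢ i → f j ≈ 0#) → sum f ≈ f i
  sum-single {f = f} zero    f≈0 =
    trans (+-congˡ (sum-zero (λ j → f≈0 (suc j) λ ()))) (+-identityʳ (f zero))
  sum-single {f = f} (suc i) f≈0 = trans (+-cong (f≈0 zero λ ()) (sum-single i (λ j j≢i → f≈0 (suc j) (j≢i ∘ Fin.suc-injective))))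
    (+-identityˡ (f (suc i)))

  -- An Iverson bracket: sums over subsets become sums over all indices, so that exchanging two
  -- summations needs no reindexing.
  when : Dec P → A → A
  when (yes _) x = x
  when (no  _) _ = 0#

  when-yes : (P? : Dec P) → P → ∀ {x} → when P? x ≈ x
  when-yes (yes _) _ = refl
  when-yes (no ¬p) p = contradiction p ¬p

  when-no : (P? : Dec P) → ¬ P → ∀ {x} → when P? x ≈ 0#
  when-no (yes p) ¬p = contradiction p ¬p
  when-no (no _)  _  = refl

  when-cong : (P? : Dec P) → ∀ {x y} → (P → x ≈ y) → when P? x ≈ when P? y
  when-cong (yes p) x≈y = x≈y p
  when-cong (no _)  x≈y = refl

  when-nonNeg : (P? : Dec P) → ∀ {x} → 0# ≤ x → 0# ≤ when P? x
  when-nonNeg (yes _) 0≤x = 0≤x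
  when-nonNeg (no _)  0≤x = ≤-refl

  when-*ʳ : (P? : Dec P) → ∀ x y → when P? (x * y) ≈ when P? x * y
  when-*ʳ (yes _) x y = refl
  when-*ʳ (no _)  x y = sym (zeroˡ y)

  when-⇔ : (P? : Dec P) (Q? : Dec Q) → (P → Q) → (Q → P) → ∀ {x} → when P? x ≈ when Q? x
  when-⇔ (yes p) Q? P⇒Q Q⇒P = sym (when-yes Q? (P⇒Q p))
  when-⇔ (no ¬p) Q? P⇒Q Q⇒P = sym (when-no Q? (¬p ∘ Q⇒P))

  sum-δ : ∀ (f : Vector A n) i → sum (λ j → when (j Fin.≟ i) (f j)) ≈ f i
  sum-δ f i = trans (sum-single i (λ j j≢i → when-no (j Fin.≟ i) j≢i)) (when-yes (i Fin.≟ i) ≡.refl)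

  -- Makes grouping safe: a map f has at most one partition as its kernel, so summing over kernels
  -- never counts the term of f twice.
  sum-atMostOne : {P : Fin n → Set a} (P? : ∀ i → Dec (P i)) → (∀ {i j} → P i → P j → i ≡ j) →
                  ∀ {x} → 0# ≤ x → sum (λ i → when (P? i) x) ≤ x
  sum-atMostOne P? P! {x} 0≤x with Fin.any? P?
  ... | yes (i , pi) = ≤-reflexive (trans (sum-single i (λ j j≢i → when-no (P? j) λ pj → j≢i (P! pj pi))) (when-yes (P? i) pi))
  ... | no  ∄i       = ≤-trans (≤-reflexive (sum-zero (λ i → when-no (P? i) λ pi → ∄i (i , pi)))) 0≤x

  sum-++ : ∀ m (f : Vector A (m ℕ.+ n)) → sum f ≈ sum (λ i → f (i ↑ˡ n)) + sum (λ j → f (m ↑ʳ j))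
  sum-++ zero    f = sym (+-identityˡ (sum f))
  sum-++ (suc m) f = trans (+-congˡ (sum-++ m (f ∘ suc))) (sym (+-assoc (f zero) _ _))

  sum-concat : ∀ m {n} (f : Vector (Vector A n) m) → sum (Vector.concat f) ≈ sum (λ i → sum (f i))
  sum-concat zero    f = refl
  sum-concat (suc m) {n} f = trans (sum-++ n (Vector.concat f))
    (+-cong (sum-cong-≋ λ j → reflexive (≡.cong (eval f) (concatˡ j)))
            (trans (sum-cong-≋ λ j → reflexive (≡.cong (eval f) (concatʳ j))) (sum-concat m (f ∘ suc))))
    where
    open import Data.Fin.Base using (quotRem)
    eval : ∀ {m} → Vector (Vector A n) m → Fin n × Fin m → A
    eval f (j , i) = f i j
    concatˡ : ∀ j → quotRem {suc m} n (j ↑ˡ (m ℕ.* n)) ≡ (j , zero)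
    concatˡ j rewrite Fin.splitAt-↑ˡ n j (m ℕ.* n) = ≡.refl
    concatʳ : ∀ j → quotRem {suc m} n (n ↑ʳ j) ≡ Product.map₂ suc (quotRem {m} n j)
    concatʳ j rewrite Fin.splitAt-↑ʳ n (m ℕ.* n) j = ≡.refl

  -- The first coordinate is summed innermost. This suits the kernel count below, where a map on the
  -- later positions is given and a value at position zero is added to it.
  sumᶠ : ∀ p → (Vector (Fin n) p → A) → A
  sumᶠ zero    F = F Vector.[]
  sumᶠ (suc p) F = sumᶠ p λ f → sum λ x → F (x Vector.∷ f)

  sumᶠ-cong : ∀ p {F G : Vector (Fin n) p → A} → (∀ f → F f ≈ G f) → sumᶠ p F ≈ sumᶠ p G
  sumᶠ-cong zero    F≈G = F≈G _
  sumᶠ-cong (suc p) F≈G = sumᶠ-cong p λ f → sum-cong-≋ λ x → F≈G (x Vector.∷ f)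

  sumᶠ-mono : ∀ p {F G : Vector (Fin n) p → A} → (∀ f → F f ≤ G f) → sumᶠ p F ≤ sumᶠ p G
  sumᶠ-mono zero    F≤G = F≤G _
  sumᶠ-mono (suc p) F≤G = sumᶠ-mono p λ f → sum-mono λ x → F≤G (x Vector.∷ f)

  sumᶠ-nonNeg : ∀ p {F : Vector (Fin n) p → A} → (∀ f → 0# ≤ F f) → 0# ≤ sumᶠ p F
  sumᶠ-nonNeg zero    0≤F = 0≤F _
  sumᶠ-nonNeg (suc p) 0≤F = sumᶠ-nonNeg p λ f → sum-nonNeg λ x → 0≤F (x Vector.∷ f)

  *-distribˡ-sumᶠ : ∀ p x (F : Vector (Fin n) p → A) → x * sumᶠ p F ≈ sumᶠ p (λ f → x * F f)
  *-distribˡ-sumᶠ zero    x F = refl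
  *-distribˡ-sumᶠ (suc p) x F = trans (*-distribˡ-sumᶠ p x _) (sumᶠ-cong p λ f → *-distribˡ-sum x λ y → F (y Vector.∷ f))

  sum-sumᶠ-comm : ∀ p (F : Fin m → Vector (Fin n) p → A) →
                  sum (λ i → sumᶠ p (F i)) ≈ sumᶠ p (λ f → sum (λ i → F i f))
  sum-sumᶠ-comm zero    F = refl
  sum-sumᶠ-comm (suc p) F = trans
    (sum-sumᶠ-comm p λ i f → sum λ x → F i (x Vector.∷ f))
    (sumᶠ-cong p λ f → ∑-comm λ i x → F i (x Vector.∷ f))

  product-sum : ∀ p (g : Fin p → Fin n → A) →
                product (λ i → sum (g i)) ≈ sumᶠ p (λ f → product (λ i → g i (f i)))
  product-sum zero    g = refl
  product-sum (suc p) g = begin-equality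
    sum (g zero) * product (λ i → sum (g (suc i)))
      ≈⟨ *-congˡ (product-sum p (g ∘ suc)) ⟩
    sum (g zero) * sumᶠ p (λ f → product (λ i → g (suc i) (f i)))
      ≈⟨ *-distribˡ-sumᶠ p _ _ ⟩
    sumᶠ p (λ f → sum (g zero) * product (λ i → g (suc i) (f i)))
      ≈⟨ sumᶠ-cong p (λ f → *-distribʳ-sum (product (λ i → g (suc i) (f i))) (g zero)) ⟩
    sumᶠ p (λ f → sum (λ x → g zero x * product (λ i → g (suc i) (f i)))) ∎

  sumᶠ-const : ∀ p (x : Fin n) {F : Vector (Fin n) p → A} {y} →
               (∀ f → (∀ i → f i ≡ x) → F f ≈ y) → (∀ f → (∃ λ i → f i ≢ x) → F f ≈ 0#) → sumᶠ p F ≈ y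
  sumᶠ-const zero    x const nonconst = const _ λ ()
  sumᶠ-const (suc p) x {F} {y} const nonconst = trans
    (sumᶠ-cong p λ f → sum-single x λ z z≢x → nonconst (z Vector.∷ f) (zero , z≢x))
    (sumᶠ-const p x
      (λ f f≡x → const _ λ { zero → ≡.refl ; (suc i) → f≡x i })
      (λ f (i , fi≢x) → nonconst _ (suc i , fi≢x)))

  -- Once the sum over the value `x` at position zero has been moved outside, the constant map with
  -- value `x` is the only survivor for each `x`.
  sumᶠ-constant : ∀ p {F : Vector (Fin n) (suc p) → A} {y} →
                  (∀ f → (∀ i → f i ≡ f zero) → F f ≈ y) → (∀ f → (∃ λ i → f i ≢ f zero) → F f ≈ 0#) →
                  sumᶠ (suc p) F ≈ n · y
  sumᶠ-constant {n = n} p {F} {y} const nonconst = begin-equality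
    sumᶠ p (λ f → sum (λ x → F (x Vector.∷ f)))
      ≈⟨ sum-sumᶠ-comm p (λ x f → F (x Vector.∷ f)) ⟨
    sum (λ x → sumᶠ p (λ f → F (x Vector.∷ f)))
      ≈⟨ sum-cong-≋ (λ x → sumᶠ-const p x
           (λ f f≡x → const _ λ { zero → ≡.refl ; (suc i) → f≡x i })
           (λ f (i , fi≢x) → nonconst _ (suc i , fi≢x))) ⟩
    sum (Vector.replicate n y)
      ≈⟨ sum-replicate n ⟩
    n · y ∎

  -- Counting maps with a prescribed kernel

  module _ {r q : ℕ} {ρ η : A} (r·ρ≈1 : r · ρ ≈ 1#) (q·ρ≈η : q · ρ ≈ η) (0≤ρ : 0# ≤ ρ) (η≤1 : η ≤ 1#) where

    private
      0≤η : 0# ≤ η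
      0≤η = ≤-trans (×-nonNeg q 0≤ρ) (≤-reflexive q·ρ≈η)

      0≤1-η : 0# ≤ (1# - η)
      0≤1-η = x≤y⇒0≤y-x η≤1

      1-η≤1 : (1# - η) ≤ 1#
      1-η≤1 = x≤y+z⇒x-z≤y (x≤x+y 0≤η)

    image? : ∀ {p} (f : Vector (Fin r) p) x → Dec (∃ λ j → x ≡ f j)
    image? f x = Fin.any? λ j → x Fin.≟ f j

    -- A union bound: with weight 1/r on each of the r values, the at most q values in the image of
    -- `f` weigh no more than q/r.
    sum-∉image : ∀ {p} → p ℕ.≤ q → (f : Vector (Fin r) p) → (1# - η) ≤ sum (λ x → when (¬? (image? f x)) ρ)
    sum-∉image {p} p≤q f = x≤y+z⇒x-z≤y (begin
      1#
        ≈⟨ r·ρ≈1 ⟨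
      r · ρ
        ≈⟨ sum-replicate r ⟨
      sum (Vector.replicate r ρ)
        ≲⟨ sum-mono split ⟩
      sum (λ x → when (¬? (image? f x)) ρ + sum (λ j → when (x Fin.≟ f j) ρ))
        ≈⟨ ∑-distrib-+ (λ x → when (¬? (image? f x)) ρ) _ ⟩
      ∉image + sum (λ x → sum (λ j → when (x Fin.≟ f j) ρ))
        ≈⟨ +-congˡ (∑-comm (λ x j → when (x Fin.≟ f j) ρ)) ⟩
      ∉image + sum (λ j → sum (λ x → when (x Fin.≟ f j) ρ))
        ≈⟨ +-congˡ (sum-cong-≋ (λ j → sum-δ (λ _ → ρ) (f j))) ⟩
      ∉image + sum (Vector.replicate p ρ)
        ≈⟨ +-congˡ (sum-replicate p) ⟩
      ∉image + p · ρ
        ≲⟨ +-monoʳ-≤ _ (×-mono-≤ 0≤ρ p≤q) ⟩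
      ∉image + q · ρ
        ≈⟨ +-congˡ q·ρ≈η ⟩
      ∉image + η ∎)
      where
      ∉image : A
      ∉image = sum (λ x → when (¬? (image? f x)) ρ)
      split : ∀ x → ρ ≤ (when (¬? (image? f x)) ρ + sum (λ j → when (x Fin.≟ f j) ρ))
      split x with image? f x
      ... | no  _         = x≤x+y (sum-nonNeg λ j → when-nonNeg (x Fin.≟ f j) 0≤ρ)
      ... | yes (j , x≡fj) = begin
        ρ                                           ≈⟨ sum-δ (λ _ → ρ) j ⟨
        sum (λ i → when (i Fin.≟ j) ρ)              ≲⟨ sum-mono (λ i → at i) ⟩
        sum (λ i → when (x Fin.≟ f i) ρ)            ≈⟨ +-identityˡ _ ⟨
        0# + sum (λ i → when (x Fin.≟ f i) ρ)       ∎
        where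
        at : ∀ i → when (i Fin.≟ j) ρ ≤ when (x Fin.≟ f i) ρ
        at i with i Fin.≟ j
        ... | yes ≡.refl = ≤-reflexive (sym (when-yes (x Fin.≟ f i) x≡fj))
        ... | no  _      = when-nonNeg (x Fin.≟ f i) 0≤ρ

    -- Values are chosen from the last position to the first. If position zero is related to a later
    -- one, its value is forced and no class is added; the factor 1-η ≤ 1 is given away. Otherwise
    -- it opens a class, which accounts for one more ρ, and its value must avoid those already used.
    -- `q` stays fixed while `p` decreases, so one η serves every step.
    sum-kernel : ∀ p {E : Rel (Fin p) a} → (E-isDecEq : IsDecEquivalence E) →
                 let open IsDecEquivalence E-isDecEq using () renaming (_≟_ to E?) in
                 p ℕ.≤ q → ((1# - η) ^ p) ≤ sumᶠ {r} p (λ f → when (kernel? E? f) (ρ ^ #classes E?))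
    sum-kernel zero E-isDecEq _ = ≤-refl
    sum-kernel (suc p) {E} E-isDecEq p<q = begin
      (1# - η) * (1# - η) ^ p
        ≲⟨ *-monoʳ-≤ 0≤1-η (sum-kernel p E′-isDecEq (ℕ.<⇒≤ p<q)) ⟩
      (1# - η) * sumᶠ {r} p (λ f → when (kernel? E′? f) (ρ ^ #classes E′?))
        ≈⟨ *-distribˡ-sumᶠ {r} p _ _ ⟩
      sumᶠ {r} p (λ f → (1# - η) * when (kernel? E′? f) (ρ ^ #classes E′?))
        ≲⟨ sumᶠ-mono p extend ⟩
      sumᶠ p (λ f → sum (λ x → when (kernel? E? (x Vector.∷ f)) (ρ ^ #classes E?))) ∎
      where
      open IsDecEquivalence E-isDecEq using () renaming (_≟_ to E?; refl to E-refl; sym to E-sym; trans to E-trans)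
      E′-isDecEq : IsDecEquivalence (λ i j → E (suc i) (suc j))
      E′-isDecEq = record
        { isEquivalence = record { refl = E-refl ; sym = E-sym ; trans = E-trans }
        ; _≟_ = λ i j → E? (suc i) (suc j) }
      E′? : Decidable (λ i j → E (suc i) (suc j))
      E′? i j = E? (suc i) (suc j)

      kernel-∷ : ∀ {x : Fin r} {f} → Kernel (λ i j → E (suc i) (suc j)) f →
                 (∀ j → (E zero (suc j) → x ≡ f j) × (x ≡ f j → E zero (suc j))) → Kernel E (x Vector.∷ f)
      kernel-∷ ker x~ zero    zero    = (λ _ → ≡.refl) , (λ _ → E-refl)
      kernel-∷ ker x~ zero    (suc j) = x~ j
      kernel-∷ ker x~ (suc i) zero    = (λ e → ≡.sym (proj₁ (x~ i) (E-sym e))) , (λ eq → E-sym (proj₂ (x~ i) (≡.sym eq)))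
      kernel-∷ ker x~ (suc i) (suc j) = ker i j

      extend : ∀ f → ((1# - η) * when (kernel? E′? f) (ρ ^ #classes E′?)) ≤
                     sum (λ x → when (kernel? E? (x Vector.∷ f)) (ρ ^ #classes E?))
      extend f with kernel? E′? f
      ... | no _ = ≤-trans (≤-reflexive (zeroʳ _))
                     (sum-nonNeg λ x → when-nonNeg (kernel? E? (x Vector.∷ f)) (^-nonNeg (#classes E?) 0≤ρ))
      -- The same test is performed by `#classes`, so this split also makes `#classes E?` compute in
      -- both branches.
      ... | yes ker with Fin.any? (λ j → E? zero (suc j))
      ...   | yes (j , e) = begin
        (1# - η) * ρ ^ #classes E′?
          ≲⟨ *-monoˡ-≤ (^-nonNeg (#classes E′?) 0≤ρ) 1-η≤1 ⟩
        1# * ρ ^ #classes E′?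
          ≈⟨ *-identityˡ _ ⟩
        ρ ^ #classes E′?
          ≈⟨ sum-δ (λ _ → ρ ^ #classes E′?) (f j) ⟨
        sum (λ x → when (x Fin.≟ f j) (ρ ^ #classes E′?))
          ≲⟨ sum-mono at ⟩
        sum (λ x → when (kernel? E? (x Vector.∷ f)) (ρ ^ #classes E′?)) ∎
        where
        at : ∀ x → when (x Fin.≟ f j) (ρ ^ #classes E′?) ≤ when (kernel? E? (x Vector.∷ f)) (ρ ^ #classes E′?)
        at x with x Fin.≟ f j
        ... | yes ≡.refl = ≤-reflexive (sym (when-yes (kernel? E? (x Vector.∷ f)) (kernel-∷ ker λ i →
                (λ e′ → proj₁ (ker j i) (E-trans (E-sym e) e′)) , (λ eq → E-trans e (proj₂ (ker j i) eq)))))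
        ... | no  _      = when-nonNeg (kernel? E? (x Vector.∷ f)) (^-nonNeg (#classes E′?) 0≤ρ)
      ...   | no ∄j = begin
        (1# - η) * ρ ^ #classes E′?
          ≲⟨ *-monoˡ-≤ (^-nonNeg (#classes E′?) 0≤ρ) (sum-∉image (ℕ.<⇒≤ p<q) f) ⟩
        sum (λ x → when (¬? (image? f x)) ρ) * ρ ^ #classes E′?
          ≈⟨ *-distribʳ-sum (ρ ^ #classes E′?) (λ x → when (¬? (image? f x)) ρ) ⟩
        sum (λ x → when (¬? (image? f x)) ρ * ρ ^ #classes E′?)
          ≲⟨ sum-mono at ⟩
        sum (λ x → when (kernel? E? (x Vector.∷ f)) (ρ ^ suc (#classes E′?))) ∎
        where
        at : ∀ x → (when (¬? (image? f x)) ρ * ρ ^ #classes E′?) ≤ when (kernel? E? (x Vector.∷ f)) (ρ ^ suc (#classes E′?))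
        at x with image? f x
        ... | yes _  = ≤-trans (≤-reflexive (zeroˡ _)) (when-nonNeg (kernel? E? (x Vector.∷ f)) (^-nonNeg (suc (#classes E′?)) 0≤ρ))
        ... | no  x∉ = ≤-reflexive (sym (when-yes (kernel? E? (x Vector.∷ f)) (kernel-∷ ker λ i →
                (λ e → contradiction (i , e) ∄j) , (λ eq → contradiction (i , eq) x∉))))

-- The Cauchy reals as an ordered commutative ring

module Reals where
  open Defs using (_+_; _*_; -_; _-_; _≤_; _≈_; _^_; sum; ∣_∣)

  infix 4 _≋_ _≼_

  -- _≈_ and _≤_ unfold to function types, from which Agda cannot recover the
  -- numbers being compared; the wrappers keep them visible to unification.
  record _≋_ (x y : ℝ) : Set where
    constructor wrap
    field unwrap : x ≈ y
  open _≋_ public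

  record _≼_ (x y : ℝ) : Set where
    constructor wrap
    field unwrap : x ≤ y
  open _≼_ public using () renaming (unwrap to unwrap≼)

  private
    Eventually : (ℕ → Set) → Set
    Eventually P = ∃ λ N → ∀ i → N ℕ.≤ i → P i

    zipEventually : ∀ {P Q R : ℕ → Set} → (∀ {i} → P i → Q i → R i) → Eventually P → Eventually Q → Eventually R
    zipEventually f (M , p) (N , q) = M ℕ.⊔ N , λ i i≥ →
      f (p i (ℕ.m⊔n≤o⇒m≤o M N i≥)) (q i (ℕ.m⊔n≤o⇒n≤o M N i≥))

    mapEventually : ∀ {P Q : ℕ → Set} → (∀ {i} → P i → Q i) → Eventually P → Eventually Q
    mapEventually f (N , p) = N , λ i i≥ → f (p i i≥)

    half-pos : ∀ {δ} → 0ℚ ℚ.< δ → 0ℚ ℚ.< ½ ℚ.* δ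
    half-pos {δ} 0<δ = ℚ.≤-<-trans (ℚ.≤-reflexive (≡.sym (ℚ.*-zeroʳ ½))) (ℚ.*-monoʳ-<-pos ½ 0<δ)

    halves : ∀ δ → ½ ℚ.* δ ℚ.+ ½ ℚ.* δ ≡ δ
    halves δ = ≡.trans (≡.sym (ℚ.*-distribʳ-+ δ ½ ½)) (ℚ.*-identityˡ δ)

    add-sub : ∀ a b → a ≡ b ℚ.+ (a ℚ.- b)
    add-sub = solve 2 (λ a b → a := b :+ (a :- b)) ≡.refl
      where open +-*-Solver

    bounded : ∀ x → ∃ λ B → 0ℚ ℚ.< B × Eventually (λ i → ℚ.∣ seq x i ∣ ℚ.≤ B)
    bounded x = let N , close = cauchy x 1ℚ (ℚ.positive⁻¹ 1ℚ) in
        ℚ.∣ seq x N ∣ ℚ.+ 1ℚ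
      , ℚ.+-mono-≤-< {0ℚ} {ℚ.∣ seq x N ∣} {0ℚ} {1ℚ} (ℚ.0≤∣p∣ (seq x N)) (ℚ.positive⁻¹ 1ℚ)
      , N , λ i N≤i → begin
          ℚ.∣ seq x i ∣
            ≡⟨ ≡.cong ℚ.∣_∣ (add-sub (seq x i) (seq x N)) ⟩
          ℚ.∣ seq x N ℚ.+ (seq x i ℚ.- seq x N) ∣
            ≤⟨ ℚ.∣p+q∣≤∣p∣+∣q∣ (seq x N) _ ⟩
          ℚ.∣ seq x N ∣ ℚ.+ ℚ.∣ seq x i ℚ.- seq x N ∣
            ≤⟨ ℚ.+-monoʳ-≤ ℚ.∣ seq x N ∣ (close i N N≤i ℕ.≤-refl) ⟩
          ℚ.∣ seq x N ∣ ℚ.+ 1ℚ ∎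
      where open ℚ.≤-Reasoning

    divide : ∀ {B δ} → 0ℚ ℚ.< B → 0ℚ ℚ.< δ → ∃ λ η → 0ℚ ℚ.< η × B ℚ.* η ≡ δ
    divide {B} {δ} 0<B 0<δ = B⁻¹ ℚ.* δ
      , ℚ.≤-<-trans (ℚ.≤-reflexive (≡.sym (ℚ.*-zeroʳ B⁻¹))) (ℚ.*-monoʳ-<-pos B⁻¹ {{ℚ.1/pos⇒pos B}} 0<δ)
      , ≡.trans (≡.sym (ℚ.*-assoc B B⁻¹ δ)) (≡.trans (≡.cong (ℚ._* δ) (ℚ.*-inverseʳ B)) (ℚ.*-identityˡ δ))
      where
      instance
        B-positive : ℚ.Positive B
        B-positive = ℚ.positive 0<B
        B-nonZero : ℚ.NonZero B
        B-nonZero = ℚ.pos⇒nonZero B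
      B⁻¹ : ℚ
      B⁻¹ = ℚ.1/ B

  private
    p≤∣p∣ : ∀ p → p ℚ.≤ ℚ.∣ p ∣
    p≤∣p∣ p with ℚ.≤-total 0ℚ p
    ... | inj₁ 0≤p = ℚ.≤-reflexive (≡.sym (ℚ.0≤p⇒∣p∣≡p 0≤p))
    ... | inj₂ p≤0 = ℚ.≤-trans p≤0 (ℚ.0≤∣p∣ p)

  ≋-pointwise : ∀ {x y} → (∀ i → seq x i ≡ seq y i) → x ≋ y
  ≋-pointwise {x} {y} eq .unwrap δ 0<δ = 0 , λ i _ → ℚ.≤-trans
    (ℚ.≤-reflexive (≡.cong ℚ.∣_∣ (≡.trans (≡.cong (ℚ._- seq y i) (eq i)) (ℚ.+-inverseʳ (seq y i)))))
    (ℚ.<⇒≤ 0<δ)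

  ≼-pointwise : ∀ {x y} → (∀ i → seq x i ℚ.≤ seq y i) → x ≼ y
  ≼-pointwise {x} {y} le ._≼_.unwrap δ 0<δ = 0 , λ i _ → begin
    seq x i          ≤⟨ le i ⟩
    seq y i          ≡⟨ ℚ.+-identityʳ (seq y i) ⟨
    seq y i ℚ.+ 0ℚ   ≤⟨ ℚ.+-monoʳ-≤ (seq y i) (ℚ.<⇒≤ 0<δ) ⟩
    seq y i ℚ.+ δ    ∎
    where open ℚ.≤-Reasoning

  ≋-refl : ∀ {x} → x ≋ x
  ≋-refl = ≋-pointwise λ _ → ≡.refl

  ≋-sym : ∀ {x y} → x ≋ y → y ≋ x
  ≋-sym {x} {y} x≋y .unwrap δ 0<δ = mapEventually
    (λ {i} → ℚ.≤-trans (ℚ.≤-reflexive (swap (seq y i) (seq x i)))) (unwrap x≋y δ 0<δ)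
    where
    open +-*-Solver
    swap : ∀ a b → ℚ.∣ a ℚ.- b ∣ ≡ ℚ.∣ b ℚ.- a ∣
    swap a b = ≡.trans (≡.sym (ℚ.∣-p∣≡∣p∣ (a ℚ.- b)))
      (≡.cong ℚ.∣_∣ (solve 2 (λ a b → :- (a :- b) := b :- a) ≡.refl a b))

  private
    ∣+∣-halves : ∀ {δ} a b → ℚ.∣ a ∣ ℚ.≤ ½ ℚ.* δ → ℚ.∣ b ∣ ℚ.≤ ½ ℚ.* δ → ℚ.∣ a ℚ.+ b ∣ ℚ.≤ δ
    ∣+∣-halves {δ} a b ha hb = begin
      ℚ.∣ a ℚ.+ b ∣             ≤⟨ ℚ.∣p+q∣≤∣p∣+∣q∣ a b ⟩
      ℚ.∣ a ∣ ℚ.+ ℚ.∣ b ∣       ≤⟨ ℚ.+-mono-≤ ha hb ⟩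
      ½ ℚ.* δ ℚ.+ ½ ℚ.* δ       ≡⟨ halves δ ⟩
      δ                         ∎
      where open ℚ.≤-Reasoning

  ≋-trans : ∀ {x y z} → x ≋ y → y ≋ z → x ≋ z
  ≋-trans {x} {y} {z} x≋y y≋z .unwrap δ 0<δ = zipEventually
    (λ {i} hx hy → ≡.subst (λ a → ℚ.∣ a ∣ ℚ.≤ δ) (telescope (seq x i) (seq y i) (seq z i))
      (∣+∣-halves (seq x i ℚ.- seq y i) (seq y i ℚ.- seq z i) hx hy))
    (unwrap x≋y (½ ℚ.* δ) (half-pos 0<δ)) (unwrap y≋z (½ ℚ.* δ) (half-pos 0<δ))
    where
    open +-*-Solver
    telescope : ∀ a b c → (a ℚ.- b) ℚ.+ (b ℚ.- c) ≡ a ℚ.- c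
    telescope = solve 3 (λ a b c → (a :- b) :+ (b :- c) := a :- c) ≡.refl

  +-cong-≋ : ∀ {w x y z} → w ≋ x → y ≋ z → w + y ≋ x + z
  +-cong-≋ {w} {x} {y} {z} w≋x y≋z .unwrap δ 0<δ = zipEventually
    (λ {i} hw hy → ≡.subst (λ a → ℚ.∣ a ∣ ℚ.≤ δ) (regroup (seq w i) (seq x i) (seq y i) (seq z i))
      (∣+∣-halves (seq w i ℚ.- seq x i) (seq y i ℚ.- seq z i) hw hy))
    (unwrap w≋x (½ ℚ.* δ) (half-pos 0<δ)) (unwrap y≋z (½ ℚ.* δ) (half-pos 0<δ))
    where
    open +-*-Solver
    regroup : ∀ a b c d → (a ℚ.- b) ℚ.+ (c ℚ.- d) ≡ (a ℚ.+ c) ℚ.- (b ℚ.+ d)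
    regroup = solve 4 (λ a b c d → (a :- b) :+ (c :- d) := (a :+ c) :- (b :+ d)) ≡.refl

  -‿cong-≋ : ∀ {x y} → x ≋ y → - x ≋ - y
  -‿cong-≋ {x} {y} x≋y .unwrap δ 0<δ = mapEventually
    (λ {i} → ≡.subst (ℚ._≤ δ) (≡.trans (≡.sym (ℚ.∣-p∣≡∣p∣ (seq x i ℚ.- seq y i)))
      (≡.cong ℚ.∣_∣ (ℚ.neg-distrib-+ (seq x i) (ℚ.- seq y i))))) (unwrap x≋y δ 0<δ)

  *-congˡ-≋ : ∀ x {y z} → y ≋ z → x * y ≋ x * z
  *-congˡ-≋ x {y} {z} y≋z .unwrap δ 0<δ =
    -- A Cauchy sequence is eventually bounded by some `B`; letting `y` and `z` agree within δ/`B`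
    -- brings the error of the product down to δ.
    let B , 0<B , x≤B = bounded x
        η , 0<η , Bη≡δ = divide 0<B 0<δ
    in zipEventually (λ {i} hx hyz → begin
      ℚ.∣ seq x i ℚ.* seq y i ℚ.- seq x i ℚ.* seq z i ∣
        ≡⟨ ≡.cong ℚ.∣_∣ (factor (seq x i) (seq y i) (seq z i)) ⟩
      ℚ.∣ seq x i ℚ.* (seq y i ℚ.- seq z i) ∣
        ≡⟨ ℚ.∣p*q∣≡∣p∣*∣q∣ (seq x i) (seq y i ℚ.- seq z i) ⟩
      ℚ.∣ seq x i ∣ ℚ.* ℚ.∣ seq y i ℚ.- seq z i ∣
        ≤⟨ ℚ.*-monoʳ-≤-nonNeg ℚ.∣ seq y i ℚ.- seq z i ∣ {{ℚ.∣-∣-nonNeg (seq y i ℚ.- seq z i)}} hx ⟩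
      B ℚ.* ℚ.∣ seq y i ℚ.- seq z i ∣
        ≤⟨ ℚ.*-monoˡ-≤-nonNeg B {{ℚ.nonNegative (ℚ.<⇒≤ 0<B)}} hyz ⟩
      B ℚ.* η
        ≡⟨ Bη≡δ ⟩
      δ ∎) x≤B (unwrap y≋z η 0<η)
    where
    open ℚ.≤-Reasoning
    open +-*-Solver
    factor : ∀ a b c → a ℚ.* b ℚ.- a ℚ.* c ≡ a ℚ.* (b ℚ.- c)
    factor = solve 3 (λ a b c → a :* b :- a :* c := a :* (b :- c)) ≡.refl

  *-comm-≋ : ∀ x y → x * y ≋ y * x
  *-comm-≋ x y = ≋-pointwise λ i → ℚ.*-comm (seq x i) (seq y i)

  *-cong-≋ : ∀ {w x y z} → w ≋ x → y ≋ z → w * y ≋ x * z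
  *-cong-≋ {w} {x} {y} {z} w≋x y≋z =
    ≋-trans {w * y} {w * z} {x * z} (*-congˡ-≋ w {y} {z} y≋z)
      (≋-trans {w * z} {z * w} {x * z} (*-comm-≋ w z)
        (≋-trans {z * w} {z * x} {x * z} (*-congˡ-≋ z {w} {x} w≋x) (*-comm-≋ z x)))

  open import Algebra.Definitions _≋_ using (Congruent₁)
  open import Algebra.Structures _≋_ using (IsMagma; IsMonoid; IsGroup; IsRing)

  private
    +-assoc : ∀ x y z → (x + y) + z ≋ x + (y + z)
    +-assoc x y z = ≋-pointwise λ i → ℚ.+-assoc (seq x i) (seq y i) (seq z i)
    +-identityˡ : ∀ x → 0ℝ + x ≋ x
    +-identityˡ x = ≋-pointwise λ i → ℚ.+-identityˡ (seq x i)
    +-identityʳ : ∀ x → x + 0ℝ ≋ x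
    +-identityʳ x = ≋-pointwise λ i → ℚ.+-identityʳ (seq x i)
    +-inverseˡ : ∀ x → - x + x ≋ 0ℝ
    +-inverseˡ x = ≋-pointwise λ i → ℚ.+-inverseˡ (seq x i)
    +-inverseʳ : ∀ x → x + (- x) ≋ 0ℝ
    +-inverseʳ x = ≋-pointwise λ i → ℚ.+-inverseʳ (seq x i)
    +-comm : ∀ x y → x + y ≋ y + x
    +-comm x y = ≋-pointwise λ i → ℚ.+-comm (seq x i) (seq y i)
    *-assoc : ∀ x y z → (x * y) * z ≋ x * (y * z)
    *-assoc x y z = ≋-pointwise λ i → ℚ.*-assoc (seq x i) (seq y i) (seq z i)
    *-identityˡ : ∀ x → 1ℝ * x ≋ x
    *-identityˡ x = ≋-pointwise λ i → ℚ.*-identityˡ (seq x i)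
    *-identityʳ : ∀ x → x * 1ℝ ≋ x
    *-identityʳ x = ≋-pointwise λ i → ℚ.*-identityʳ (seq x i)
    distribˡ : ∀ x y z → x * (y + z) ≋ x * y + x * z
    distribˡ x y z = ≋-pointwise λ i → ℚ.*-distribˡ-+ (seq x i) (seq y i) (seq z i)
    distribʳ : ∀ x y z → (y + z) * x ≋ y * x + z * x
    distribʳ x y z = ≋-pointwise λ i → ℚ.*-distribʳ-+ (seq x i) (seq y i) (seq z i)

    -- For f = -_ directly, unfolding Congruent₁ makes Agda compare Cauchy proofs.
    congruent₁ : ∀ {f} → (∀ x y → x ≋ y → f x ≋ f y) → Congruent₁ f
    congruent₁ f-cong {x} {y} = f-cong x y

    ≋-+-isMagma : IsMagma _+_
    ≋-+-isMagma = record
      { isEquivalence = record { refl = ≋-refl ; sym = ≋-sym ; trans = ≋-trans }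
      ; ∙-cong = λ {w} {x} {y} {z} → +-cong-≋ {w} {x} {y} {z} }

    ≋-+-isMonoid : IsMonoid _+_ 0ℝ
    ≋-+-isMonoid = record
      { isSemigroup = record { isMagma = ≋-+-isMagma ; assoc = +-assoc }
      ; identity = +-identityˡ , +-identityʳ }

    ≋-+-isGroup : IsGroup _+_ 0ℝ (-_)
    ≋-+-isGroup = record { isMonoid = ≋-+-isMonoid ; inverse = +-inverseˡ , +-inverseʳ ; ⁻¹-cong = congruent₁ λ x y → -‿cong-≋ {x} {y} }

    ≋-isRing : IsRing _+_ _*_ (-_) 0ℝ 1ℝ
    ≋-isRing = record
      { +-isAbelianGroup = record { isGroup = ≋-+-isGroup ; comm = +-comm }
      ; *-cong = λ {w} {x} {y} {z} → *-cong-≋ {w} {x} {y} {z}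
      ; *-assoc = *-assoc
      ; *-identity = *-identityˡ , *-identityʳ
      ; distrib = distribˡ , distribʳ }

  ℝ-commutativeRing : CommutativeRing _ _
  ℝ-commutativeRing = record { isCommutativeRing = record { isRing = ≋-isRing ; *-comm = *-comm-≋ } }

  ≼-reflexive : ∀ {x y} → x ≋ y → x ≼ y
  ≼-reflexive {x} {y} x≋y ._≼_.unwrap δ 0<δ = mapEventually (λ {i} close → begin
    seq x i                            ≡⟨ add-sub (seq x i) (seq y i) ⟩
    seq y i ℚ.+ (seq x i ℚ.- seq y i)  ≤⟨ ℚ.+-monoʳ-≤ (seq y i) (ℚ.≤-trans (p≤∣p∣ _) close) ⟩
    seq y i ℚ.+ δ                      ∎) (unwrap x≋y δ 0<δ)
    where
    open ℚ.≤-Reasoning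

  ≼-trans : ∀ {x y z} → x ≼ y → y ≼ z → x ≼ z
  ≼-trans {x} {y} {z} x≼y y≼z ._≼_.unwrap δ 0<δ = zipEventually (λ {i} hx hy → begin
    seq x i                                      ≤⟨ hx ⟩
    seq y i ℚ.+ ½ ℚ.* δ                          ≤⟨ ℚ.+-monoˡ-≤ (½ ℚ.* δ) hy ⟩
    (seq z i ℚ.+ ½ ℚ.* δ) ℚ.+ ½ ℚ.* δ            ≡⟨ ℚ.+-assoc (seq z i) _ _ ⟩
    seq z i ℚ.+ (½ ℚ.* δ ℚ.+ ½ ℚ.* δ)            ≡⟨ ≡.cong (seq z i ℚ.+_) (halves δ) ⟩
    seq z i ℚ.+ δ                                ∎)
    (unwrap≼ x≼y (½ ℚ.* δ) (half-pos 0<δ)) (unwrap≼ y≼z (½ ℚ.* δ) (half-pos 0<δ))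
    where open ℚ.≤-Reasoning

  +-mono-≼ : ∀ {w x y z} → w ≼ x → y ≼ z → w + y ≼ x + z
  +-mono-≼ {w} {x} {y} {z} w≼x y≼z ._≼_.unwrap δ 0<δ = zipEventually (λ {i} hw hy → begin
    seq w i ℚ.+ seq y i                                    ≤⟨ ℚ.+-mono-≤ hw hy ⟩
    (seq x i ℚ.+ ½ ℚ.* δ) ℚ.+ (seq z i ℚ.+ ½ ℚ.* δ)        ≡⟨ regroup (seq x i) (seq z i) (½ ℚ.* δ) ⟩
    (seq x i ℚ.+ seq z i) ℚ.+ (½ ℚ.* δ ℚ.+ ½ ℚ.* δ)        ≡⟨ ≡.cong (seq x i ℚ.+ seq z i ℚ.+_) (halves δ) ⟩
    (seq x i ℚ.+ seq z i) ℚ.+ δ                            ∎)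
    (unwrap≼ w≼x (½ ℚ.* δ) (half-pos 0<δ)) (unwrap≼ y≼z (½ ℚ.* δ) (half-pos 0<δ))
    where
    open ℚ.≤-Reasoning
    open +-*-Solver
    regroup : ∀ a b c → (a ℚ.+ c) ℚ.+ (b ℚ.+ c) ≡ (a ℚ.+ b) ℚ.+ (c ℚ.+ c)
    regroup = solve 3 (λ a b c → (a :+ c) :+ (b :+ c) := (a :+ b) :+ (c :+ c)) ≡.refl

  0≼∣x∣ : ∀ x → 0ℝ ≼ ∣ x ∣
  0≼∣x∣ x = ≼-pointwise λ i → ℚ.0≤∣p∣ (seq x i)

  x≼∣x∣ : ∀ x → x ≼ ∣ x ∣
  x≼∣x∣ x = ≼-pointwise λ i → p≤∣p∣ (seq x i)

  ∣x*y∣≋∣x∣*∣y∣ : ∀ x y → ∣ x * y ∣ ≋ ∣ x ∣ * ∣ y ∣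
  ∣x*y∣≋∣x∣*∣y∣ x y = ≋-pointwise λ i → ℚ.∣p*q∣≡∣p∣*∣q∣ (seq x i) (seq y i)

  ∣x∣*∣x∣≋x*x : ∀ x → ∣ x ∣ * ∣ x ∣ ≋ x * x
  ∣x∣*∣x∣≋x*x x = ≋-pointwise λ i → sq (seq x i)
    where
    sq : ∀ a → ℚ.∣ a ∣ ℚ.* ℚ.∣ a ∣ ≡ a ℚ.* a
    sq a with ℚ.∣p∣≡p∨∣p∣≡-p a
    ... | inj₁ eq = ≡.cong₂ ℚ._*_ eq eq
    ... | inj₂ eq = ≡.trans (≡.cong₂ ℚ._*_ eq eq) (solve 1 (λ a → (:- a) :* (:- a) := a :* a) ≡.refl a)
      where open +-*-Solver

  -- A nonnegative real may have negative terms, but eventually none below -δ/2, and for such a term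
  -- a the difference |a| - a is at most twice δ/2.
  0≼x⇒∣x∣≋x : ∀ {x} → 0ℝ ≼ x → ∣ x ∣ ≋ x
  0≼x⇒∣x∣≋x {x} 0≼x .unwrap δ 0<δ = mapEventually (λ {i} → close (seq x i))
    (unwrap≼ 0≼x (½ ℚ.* δ) (half-pos 0<δ))
    where
    open ℚ.≤-Reasoning
    open +-*-Solver
    close : ∀ a → 0ℚ ℚ.≤ a ℚ.+ ½ ℚ.* δ → ℚ.∣ ℚ.∣ a ∣ ℚ.- a ∣ ℚ.≤ δ
    close a 0≤a+δ/2 with ℚ.≤-total 0ℚ a
    ... | inj₁ 0≤a = begin
      ℚ.∣ ℚ.∣ a ∣ ℚ.- a ∣   ≡⟨ ≡.cong (λ b → ℚ.∣ b ℚ.- a ∣) (ℚ.0≤p⇒∣p∣≡p 0≤a) ⟩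
      ℚ.∣ a ℚ.- a ∣         ≡⟨ ≡.cong ℚ.∣_∣ (ℚ.+-inverseʳ a) ⟩
      0ℚ                    ≤⟨ ℚ.<⇒≤ 0<δ ⟩
      δ                     ∎
    ... | inj₂ a≤0 = begin
      ℚ.∣ ℚ.∣ a ∣ ℚ.- a ∣
        ≤⟨ ∣+∣-halves {δ} ℚ.∣ a ∣ (ℚ.- a)
             (ℚ.≤-trans (ℚ.≤-reflexive (ℚ.∣∣p∣∣≡∣p∣ a)) small)
             (ℚ.≤-trans (ℚ.≤-reflexive (ℚ.∣-p∣≡∣p∣ a)) small) ⟩
      δ ∎
      where
      0≤-a : 0ℚ ℚ.≤ ℚ.- a
      0≤-a = ℚ.neg-antimono-≤ a≤0
      small : ℚ.∣ a ∣ ℚ.≤ ½ ℚ.* δ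
      small = begin
        ℚ.∣ a ∣                        ≡⟨ ℚ.∣-p∣≡∣p∣ a ⟨
        ℚ.∣ ℚ.- a ∣                    ≡⟨ ℚ.0≤p⇒∣p∣≡p 0≤-a ⟩
        ℚ.- a                          ≡⟨ ℚ.+-identityʳ (ℚ.- a) ⟨
        ℚ.- a ℚ.+ 0ℚ                   ≤⟨ ℚ.+-monoʳ-≤ (ℚ.- a) 0≤a+δ/2 ⟩
        ℚ.- a ℚ.+ (a ℚ.+ ½ ℚ.* δ)      ≡⟨ solve 2 (λ a b → (:- a) :+ (a :+ b) := b) ≡.refl a (½ ℚ.* δ) ⟩
        ½ ℚ.* δ                        ∎

  -- Both factors equal their absolute values, so the product equals |xy|. This avoids estimating
  -- products of slightly negative terms.
  *-nonNeg-≼ : ∀ {x y} → 0ℝ ≼ x → 0ℝ ≼ y → 0ℝ ≼ x * y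
  *-nonNeg-≼ {x} {y} 0≼x 0≼y = ≼-trans {0ℝ} {∣ x * y ∣} {x * y} (0≼∣x∣ (x * y))
    (≼-reflexive {∣ x * y ∣} {x * y}
      (≋-trans {∣ x * y ∣} {∣ x ∣ * ∣ y ∣} {x * y} (∣x*y∣≋∣x∣*∣y∣ x y)
        (*-cong-≋ {∣ x ∣} {x} {∣ y ∣} {y} (0≼x⇒∣x∣≋x 0≼x) (0≼x⇒∣x∣≋x 0≼y))))

  fromℚ-mono : ∀ {a b} → a ℚ.≤ b → fromℚ a ≼ fromℚ b
  fromℚ-mono a≤b = ≼-pointwise λ _ → a≤b

  ℝ-isOrderedRing : IsOrderedRing ℝ-commutativeRing _≼_
  ℝ-isOrderedRing = record
    { isPreorder = record
      { isEquivalence = CommutativeRing.isEquivalence ℝ-commutativeRing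
      ; reflexive = ≼-reflexive ; trans = ≼-trans }
    ; +-mono-≤ = λ {w} {x} {y} {z} → +-mono-≼ {w} {x} {y} {z}
    ; *-nonNeg = λ {x} {y} → *-nonNeg-≼ {x} {y}
    ; 0≤1 = fromℚ-mono (ℚ.<⇒≤ (ℚ.positive⁻¹ 1ℚ))
    }

  ≈-pointwise : (f g : ℕ → ℚ) → (∀ n → f n ≡ g n) →
                ∀ δ → 0ℚ ℚ.< δ → Eventually (λ i → ℚ.∣ f i ℚ.- g i ∣ ℚ.≤ δ)
  ≈-pointwise f g f≡g δ 0<δ = 0 , λ i _ → ℚ.≤-trans
    (ℚ.≤-reflexive (≡.cong ℚ.∣_∣ (≡.trans (≡.cong (ℚ._- g i) (f≡g i)) (ℚ.+-inverseʳ (g i)))))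
    (ℚ.<⇒≤ 0<δ)

  -- Names for the factors of ∥_∥^ and α, at which their unfolding stops.
  pow : ℝ → ℕ → ℝ
  pow x n = x ^ n

  sumOfPowers : ∀ {d} → Vector ℝ d → ℕ → ℝ
  sumOfPowers x p = sum (λ i → ∣ x i ∣ ^ p)

  minus-def : ∀ x y → x - y ≈ x + (- y)
  minus-def x y = ≈-pointwise (seq (x - y)) (seq (x + (- y))) λ _ → ≡.refl

  ⊗ᵛ-lookup : ∀ {m n} (x : Vector ℝ m) (y : Vector ℝ n) i →
              (x ⊗ᵛ y) i ≈ x (proj₂ (quotRem {m} n i)) * y (proj₁ (quotRem {m} n i))
  ⊗ᵛ-lookup {m} {n} x y i = ≈-pointwise
    (seq ((x ⊗ᵛ y) i)) (seq (x (proj₂ (quotRem {m} n i)) * y (proj₁ (quotRem {m} n i)))) λ _ → ≡.refl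

  norm-factor : ∀ {d} (x : Vector ℝ d) p m k .{{_ : NonZero m}} →
                ∥ x ∥^ p m k ≈ pow (fromℚ (+ 1 ℚ./ m)) k * sumOfPowers x p
  norm-factor x p m k = ≈-pointwise
    (seq (∥ x ∥^ p m k)) (seq (pow (fromℚ (+ 1 ℚ./ m)) k * sumOfPowers x p)) λ _ → ≡.refl

  α-factor : ∀ k p r .{{_ : NonZero r}} x →
             α k p r x ≈ pow (1ℝ - fromℚ (+ p ℚ./ r)) (p ℕ.* k) * pow (1ℝ - fromℕ (p ℕ.^ 2) * x) k
  α-factor k p r {{r≢0}} x = ≈-pointwise
    (seq (α k p r {{r≢0}} x)) (seq (pow (1ℝ - fromℚ (ℚ._/_ (+ p) r {{r≢0}})) (p ℕ.* k) * pow (1ℝ - fromℕ (p ℕ.^ 2) * x) k)) λ _ → ≡.refl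

  -- ℝ as an opaque ordered ring: two real expressions that are not literally
  -- the same would otherwise be compared by unfolding their Cauchy proofs.
  record Model : Set₁ where
    infix 4 _≤ₘ_
    field
      𝓡             : CommutativeRing 0ℓ 0ℓ
    open CommutativeRing 𝓡 using () renaming (Carrier to A; _≈_ to _≈ₘ_; _+_ to _+ₘ_; _*_ to _*ₘ_; -_ to -ₘ_; 0# to 0ₘ; 1# to 1ₘ)
    field
      _≤ₘ_          : Rel A 0ℓ
      isOrderedRing : IsOrderedRing 𝓡 _≤ₘ_
      ⟦_⟧           : ℝ → A
      ⟦⟧-cong       : ∀ x y → x ≈ y → ⟦ x ⟧ ≈ₘ ⟦ y ⟧
      ⟦⟧-injective  : ∀ x y → ⟦ x ⟧ ≈ₘ ⟦ y ⟧ → x ≈ y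
      ⟦⟧-mono       : ∀ x y → x ≤ y → ⟦ x ⟧ ≤ₘ ⟦ y ⟧
      ⟦⟧-cancel     : ∀ x y → ⟦ x ⟧ ≤ₘ ⟦ y ⟧ → x ≤ y
      ⟦⟧-+          : ∀ x y → ⟦ x + y ⟧ ≈ₘ (⟦ x ⟧ +ₘ ⟦ y ⟧)
      ⟦⟧-*          : ∀ x y → ⟦ x * y ⟧ ≈ₘ (⟦ x ⟧ *ₘ ⟦ y ⟧)
      ⟦⟧-neg        : ∀ x → ⟦ - x ⟧ ≈ₘ (-ₘ ⟦ x ⟧)
      ⟦⟧-0          : ⟦ 0ℝ ⟧ ≈ₘ 0ₘ
      ⟦⟧-1          : ⟦ 1ℝ ⟧ ≈ₘ 1ₘ
      ⟦⟧-fromℚ-+    : ∀ a b → ⟦ fromℚ (a ℚ.+ b) ⟧ ≈ₘ (⟦ fromℚ a ⟧ +ₘ ⟦ fromℚ b ⟧)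
      ⟦⟧-fromℚ-mono : ∀ a b → a ℚ.≤ b → ⟦ fromℚ a ⟧ ≤ₘ ⟦ fromℚ b ⟧
      ⟦⟧≤⟦∣∣⟧       : ∀ x → ⟦ x ⟧ ≤ₘ ⟦ ∣ x ∣ ⟧
      ⟦∣∣⟧-*        : ∀ x y → ⟦ ∣ x * y ∣ ⟧ ≈ₘ (⟦ ∣ x ∣ ⟧ *ₘ ⟦ ∣ y ∣ ⟧)
      ⟦∣∣⟧-1        : ⟦ ∣ 1ℝ ∣ ⟧ ≈ₘ 1ₘ
      ⟦∣∣⟧-square   : ∀ x → (⟦ ∣ x ∣ ⟧ *ₘ ⟦ ∣ x ∣ ⟧) ≈ₘ (⟦ x ⟧ *ₘ ⟦ x ⟧)
      ⟦∣∣⟧-nonNeg   : ∀ x → 0ₘ ≤ₘ ⟦ x ⟧ → ⟦ ∣ x ∣ ⟧ ≈ₘ ⟦ x ⟧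

  abstract
    model : Model
    model = record
      { 𝓡             = ℝ-commutativeRing
      ; _≤ₘ_          = _≼_
      ; isOrderedRing = ℝ-isOrderedRing
      ; ⟦_⟧           = λ x → x
      ; ⟦⟧-cong       = λ _ _ → wrap
      ; ⟦⟧-injective  = λ _ _ → unwrap
      ; ⟦⟧-mono       = λ _ _ → wrap
      ; ⟦⟧-cancel     = λ _ _ → unwrap≼
      ; ⟦⟧-+          = λ x y → ≋-refl {x + y}
      ; ⟦⟧-*          = λ x y → ≋-refl {x * y}
      ; ⟦⟧-neg        = λ x → ≋-refl { - x}
      ; ⟦⟧-0          = ≋-refl {0ℝ}
      ; ⟦⟧-1          = ≋-refl {1ℝ}
      ; ⟦⟧-fromℚ-+    = λ a b → ≋-pointwise {fromℚ (a ℚ.+ b)} {fromℚ a + fromℚ b} λ _ → ≡.refl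
      ; ⟦⟧-fromℚ-mono = λ a b → fromℚ-mono {a} {b}
      ; ⟦⟧≤⟦∣∣⟧       = x≼∣x∣
      ; ⟦∣∣⟧-*        = ∣x*y∣≋∣x∣*∣y∣
      ; ⟦∣∣⟧-1        = 0≼x⇒∣x∣≋x {1ℝ} (fromℚ-mono (ℚ.<⇒≤ (ℚ.positive⁻¹ 1ℚ)))
      ; ⟦∣∣⟧-square   = ∣x∣*∣x∣≋x*x
      ; ⟦∣∣⟧-nonNeg   = λ x → 0≼x⇒∣x∣≋x {x}
      }

  -- On unnormalised fractions this is a polynomial identity, free of the gcd in `ℚ._/_`. It yields
  -- n/d as an n-fold sum of 1/d by induction.
  /-suc : ∀ n d .{{_ : NonZero d}} → + suc n ℚ./ d ≡ + 1 ℚ./ d ℚ.+ + n ℚ./ d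
  /-suc n (suc d) = ℚ.toℚᵘ-injective (begin
    ℚ.toℚᵘ (+ suc n ℚ./ suc d)
      ≈⟨ ℚ.toℚᵘ-fromℚᵘ (ℚᵘ.mkℚᵘ (+ suc n) d) ⟩
    ℚᵘ.mkℚᵘ (+ suc n) d
      ≈⟨ ℚᵘ.*≡* (solve 2 (λ n d → (con (+ 1) :+ n) :* (d :* d) := (con (+ 1) :* d :+ n :* d) :* d) ≡.refl (+ n) (+ suc d)) ⟩
    ℚᵘ.mkℚᵘ (+ 1) d ℚᵘ.+ ℚᵘ.mkℚᵘ (+ n) d
      ≈⟨ ℚᵘ.+-cong (ℚ.toℚᵘ-fromℚᵘ (ℚᵘ.mkℚᵘ (+ 1) d)) (ℚ.toℚᵘ-fromℚᵘ (ℚᵘ.mkℚᵘ (+ n) d)) ⟨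
    ℚ.toℚᵘ (+ 1 ℚ./ suc d) ℚᵘ.+ ℚ.toℚᵘ (+ n ℚ./ suc d)
      ≈⟨ ℚ.toℚᵘ-homo-+ (+ 1 ℚ./ suc d) (+ n ℚ./ suc d) ⟨
    ℚ.toℚᵘ (+ 1 ℚ./ suc d ℚ.+ + n ℚ./ suc d) ∎)
    where
    open import Relation.Binary.Reasoning.Setoid ℚᵘ.≃-setoid
    open ℤ.+-*-Solver

  0/d≡0 : ∀ d .{{_ : NonZero d}} → + 0 ℚ./ d ≡ 0ℚ
  0/d≡0 (suc d) = ℚ.toℚᵘ-injective (ℚᵘ.≃-trans (ℚ.toℚᵘ-fromℚᵘ (ℚᵘ.mkℚᵘ (+ 0) d)) (ℚᵘ.*≡* ≡.refl))

  d/d≡1 : ∀ d .{{_ : NonZero d}} → + d ℚ./ d ≡ 1ℚ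
  d/d≡1 (suc d) = ℚ.toℚᵘ-injective (ℚᵘ.≃-trans (ℚ.toℚᵘ-fromℚᵘ (ℚᵘ.mkℚᵘ (+ suc d) d))
    (ℚᵘ.*≡* (solve 1 (λ d → d :* con (+ 1) := con (+ 1) :* d) ≡.refl (+ suc d))))
    where open ℤ.+-*-Solver

-- Distinct entries and enumerations of partitions

#deduplicate≤#classes : ∀ {X : Set} (_≟_ : DecidableEquality X) {n} {E : Rel (Fin n) 0ℓ} (E? : Decidable E) (u : Vector X n) →
  (∀ {i j} → E i j → u i ≡ u j) → length (deduplicate _≟_ (List.tabulate u)) ℕ.≤ #classes E?
#deduplicate≤#classes _≟_ {zero}  E? u E⇒≡ = z≤n
#deduplicate≤#classes _≟_ {suc n} E? u E⇒≡ with Fin.any? (λ j → E? zero (suc j))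
-- The value `u zero` occurs again at `suc j`, so removing it from the later entries drops at least
-- one element, which offsets the one placed in front.
... | yes (j , e) = ℕ.≤-trans (List.filter-notAll (λ x → ¬? (u zero ≟ x)) us (Any.map (λ where ≡.refl ¬eq → ¬eq (E⇒≡ e)) uj∈us))
                      (#deduplicate≤#classes _≟_ (λ i j → E? (suc i) (suc j)) (u ∘ suc) E⇒≡)
  where
  us = deduplicate _≟_ (List.tabulate (u ∘ suc))
  uj∈us : u (suc j) List.∈ us
  uj∈us = List.∈-deduplicate⁺ _≟_ (List.∈-tabulate⁺ j)
... | no _ = s≤s (ℕ.≤-trans (List.length-filter (λ x → ¬? (u zero ≟ x)) (deduplicate _≟_ (List.tabulate (u ∘ suc))))
                    (#deduplicate≤#classes _≟_ (λ i j → E? (suc i) (suc j)) (u ∘ suc) E⇒≡))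

deduplicate-replicate : ∀ {X : Set} (_≟_ : DecidableEquality X) {n} (u : Vector X (suc n)) → (∀ i → u i ≡ u zero) →
  length (deduplicate _≟_ (List.tabulate u)) ≡ 1
deduplicate-replicate _≟_ u u≡ = ≡.cong (suc ∘ length) (List.filter-none (λ x → ¬? (u zero ≟ x))
  (All.tabulate λ x∈ u0≢x → u0≢x (≡.sym (All.lookup all≡ (List.∈-deduplicate⁻ _≟_ _ x∈)))))
  where
  all≡ : All (_≡ u zero) (List.tabulate (u ∘ suc))
  all≡ = All.tabulate⁺ (u≡ ∘ suc)

length-filter-map : ∀ {X Y : Set} {P : Y → Set} (P? : ∀ y → Dec (P y)) (f : X → Y) xs →
                    length (filter P? (List.map f xs)) ≡ length (filter (P? ∘ f) xs)
length-filter-map P? f [] = ≡.refl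
length-filter-map P? f (x ∷ xs) with P? (f x)
... | yes _ = ≡.cong suc (length-filter-map P? f xs)
... | no  _ = length-filter-map P? f xs

lookup-injective : ∀ {X : Set} {xs : List X} → Unique xs → ∀ {i j} → List.lookup xs i ≡ List.lookup xs j → i ≡ j
lookup-injective (x∉ ∷ xs!) {zero}  {zero}  eq = ≡.refl
lookup-injective (x∉ ∷ xs!) {zero}  {suc j} eq = contradiction eq (All.lookup x∉ (List.∈-lookup j))
lookup-injective (x∉ ∷ xs!) {suc i} {zero}  eq = contradiction (≡.sym eq) (All.lookup x∉ (List.∈-lookup i))
lookup-injective (x∉ ∷ xs!) {suc i} {suc j} eq = ≡.cong suc (lookup-injective xs! eq)

Unique-allVecs : ∀ {X : Set} {xs : List X} → Unique xs → ∀ n → Unique (allVecs xs n)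
Unique-allVecs xs! zero    = [] ∷ []
Unique-allVecs xs! (suc n) = Unique.cartesianProductWith⁺ _∷_ Vec.∷-injective xs! (Unique-allVecs xs! n)

Unique-allPartitions : ∀ p → Unique (allPartitions p)
Unique-allPartitions p = Unique.filter⁺ isPartition?
  (Unique-allVecs (Unique-allVecs (((λ ()) ∷ []) ∷ [] ∷ []) p) p)

All-allPartitions : ∀ p → All IsPartition (allPartitions p)
All-allPartitions p = All.all-filter isPartition? (allVecs (allVecs (true ∷ false ∷ []) p) p)

-- Partitions as kernels, and chains of refinements

module _ {p : ℕ} where

  SamePart : Vec (Subset p) p → Rel (Fin p) 0ℓ
  SamePart T i j = j ∈ lookup T i

  samePart? : ∀ T → Decidable (SamePart T)
  samePart? T i j = j ∈? lookup T i

  samePart-isDecEquivalence : ∀ {T} → IsPartition T → IsDecEquivalence (SamePart T)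
  samePart-isDecEquivalence {T} (i∈Ti , Tj≡Ti) = record
    { isEquivalence = record
      { refl  = i∈Ti _
      ; sym   = λ {i} {j} j∈Ti → ≡.subst (i ∈_) (≡.sym (Tj≡Ti i j j∈Ti)) (i∈Ti i)
      ; trans = λ {i} {j} {k} j∈Ti k∈Tj → ≡.subst (k ∈_) (Tj≡Ti i j j∈Ti) k∈Tj }
    ; _≟_ = samePart? T }

  -- A partition is encoded by the part of each i, and that part is recovered from `f` as the set of
  -- all j with f i = f j.
  kernel-unique : ∀ {r} {f : Vector (Fin r) p} {T T′} → Kernel (SamePart T) f → Kernel (SamePart T′) f → T ≡ T′
  kernel-unique {f = f} {T} {T′} ker ker′ = ≡.trans (≡.sym (Vec.tabulate∘lookup T))
    (≡.trans (Vec.tabulate-cong (λ i → ⊆-antisym (sub {T} {T′} ker ker′ {i}) (sub {T′} {T} ker′ ker {i}))) (Vec.tabulate∘lookup T′))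
    where
    sub : ∀ {T T′} → Kernel (SamePart T) f → Kernel (SamePart T′) f → ∀ {i} → lookup T i ⊆ lookup T′ i
    sub ker ker′ {i} {j} j∈ = proj₂ (ker′ i j) (proj₁ (ker i j) j∈)

  -- `T` is the partition above the chain and is not one of its k levels. Prescribing it gives the
  -- count a recursion: in the induction it is the partition on whose parts the trees are constant.
  #chains : ℕ → Vec (Subset p) p → ℕ
  #chains k T = length (filter (λ Ts → linked? refinedBy? (T ∷ Ts)) (allVecs (allPartitions p) k))

  trivialPartition : Vec (Subset p) p
  trivialPartition = Vec.replicate p ⊤

  -- Every partition refines the one with a single part, so placing that partition above a chain
  -- imposes no condition.
  b≡#chains : ∀ k → b k p ≡ #chains k trivialPartition
  b≡#chains k = ≡.cong length (List.filter-≐ (linked? refinedBy?) (λ Ts → linked? refinedBy? (trivialPartition ∷ Ts))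
    (cons , Linked.tail) (allVecs (allPartitions p) k))
    where
    refined : (T : Vec (Subset p) p) → RefinedBy trivialPartition T
    refined T i {j} _ = ≡.subst (j ∈_) (≡.sym (Vec.lookup-replicate i ⊤)) ∈⊤
    cons : ∀ {n} {Ts : Vec (Vec (Subset p) p) n} → Linked RefinedBy Ts → Linked RefinedBy (trivialPartition ∷ Ts)
    cons []           = [-]
    cons ([-] {x = T})          = refined T ∷ [-]
    cons (_∷_ {x = T} T⊒ chain) = refined T ∷ T⊒ ∷ chain

module Proof where
  open Reals
  open Model model
  open CommutativeRing 𝓡 renaming (Carrier to A; zero to *-zero)
  open OrderedSums 𝓡 isOrderedRing
  open IsOrderedRing isOrderedRing
  open import Algebra.Definitions.RawSemiring (Semiring.rawSemiring semiring) using (_^_; product)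
  open import Algebra.Properties.CommutativeSemiring.Exp commutativeSemiring using (^-congˡ; ^-distrib-*; ^-assocʳ)
  open import Algebra.Properties.Ring (CommutativeRing.ring 𝓡) using (-‿distribʳ-*)
  open import Algebra.Properties.Semiring.Mult semiring using (×-homo-+; ×-congʳ; ×-assoc-*; ×-comm-*) renaming (_×_ to _·_)
  open import Algebra.Properties.Semiring.Sum semiring using (sum; sum-cong-≋; sum-replicate; *-distribˡ-sum; *-distribʳ-sum; ∑-distrib-+; ∑-comm)
  open import Algebra.Solver.Ring.NaturalCoefficients.Default commutativeSemiring using (solve; _:=_; _:*_)
  open import Relation.Binary.Reasoning.Preorder preorder

  count-cartesianProduct : ∀ {X : Set} {n} {P : Vec X (suc n) → Set} (P? : ∀ v → Dec (P v)) xs ys →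
    length (filter P? (cartesianProductWith _∷_ xs ys)) · 1# ≈
    sum (λ i → length (filter (λ v → P? (List.lookup xs i ∷ v)) ys) · 1#)
  count-cartesianProduct P? []       ys = refl
  count-cartesianProduct P? (x ∷ xs) ys = begin-equality
    length (filter P? (List.map (x ∷_) ys List.++ rest)) · 1#
      ≡⟨ ≡.cong (_· 1#) (≡.trans (≡.cong length (List.filter-++ P? (List.map (x ∷_) ys) rest)) (List.length-++ (filter P? (List.map (x ∷_) ys)))) ⟩
    (length (filter P? (List.map (x ∷_) ys)) ℕ.+ length (filter P? rest)) · 1#
      ≈⟨ ×-homo-+ 1# (length (filter P? (List.map (x ∷_) ys))) _ ⟩
    length (filter P? (List.map (x ∷_) ys)) · 1# + length (filter P? rest) · 1#
      ≈⟨ +-cong (reflexive (≡.cong (_· 1#) (length-filter-map P? (x ∷_) ys))) (count-cartesianProduct P? xs ys) ⟩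
    sum (λ i → length (filter (λ v → P? (List.lookup (x ∷ xs) i ∷ v)) ys) · 1#) ∎
    where rest = cartesianProductWith _∷_ xs ys

  -- Splits off the first level of the chain. Counts are multiples of 1 in the ring, so that the
  -- recursion can be multiplied directly into the estimates.
  #chains-suc : ∀ {p} k T → #chains {p} (suc k) T · 1# ≈
    sum (λ i → let T′ = List.lookup (allPartitions p) i in when (refinedBy? T T′) (#chains k T′ · 1#))
  #chains-suc {p} k T = trans
    (count-cartesianProduct (λ Ts → linked? refinedBy? (T ∷ Ts)) (allPartitions p) (allVecs (allPartitions p) k))
    (sum-cong-≋ λ i → let T′ = List.lookup (allPartitions p) i in first T′ (refinedBy? T T′))
    where
    first : ∀ T′ (T⊒T′? : Dec (RefinedBy T T′)) →
            length (filter (λ Ts → linked? refinedBy? (T ∷ T′ ∷ Ts)) (allVecs (allPartitions p) k)) · 1# ≈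
            when T⊒T′? (#chains k T′ · 1#)
    first T′ (yes T⊒T′) = reflexive (≡.cong (λ Ts → length Ts · 1#)
      (List.filter-≐ (λ Ts → linked? refinedBy? (T ∷ T′ ∷ Ts)) (λ Ts → linked? refinedBy? (T′ ∷ Ts))
        (Linked.tail , (T⊒T′ ∷_)) (allVecs (allPartitions p) k)))
    first T′ (no T⋣T′) = reflexive (≡.cong (λ Ts → length Ts · 1#)
      (List.filter-none (λ Ts → linked? refinedBy? (T ∷ T′ ∷ Ts)) {allVecs (allPartitions p) k}
        (All.universal (λ _ chain → T⋣T′ (Linked.head chain)) _)))

  -- Weighted walks through blocks in series

  module _ {X : Set} {T : Rel X 0ℓ} where

    starSum : (∀ {x y} → T x y → A) → ∀ {x y} → Star T x y → A
    starSum g ε        = 0#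
    starSum g (a ◅ as) = g a + starSum g as

    starSum-◅◅ : ∀ (g : ∀ {x y} → T x y → A) {x y z} (as : Star T x y) (bs : Star T y z) →
                 starSum g (as ◅◅ bs) ≈ starSum g as + starSum g bs
    starSum-◅◅ g ε        bs = sym (+-identityˡ _)
    starSum-◅◅ g (a ◅ as) bs = trans (+-congˡ (starSum-◅◅ g as bs)) (sym (+-assoc _ _ _))

    chain : ∀ n (N : Fin (suc n) → X) → (∀ u → Star T (N (inject₁ u)) (N (suc u))) → Star T (N zero) (N (Fin.fromℕ n))
    chain zero    N as = ε
    chain (suc n) N as = as zero ◅◅ chain n (N ∘ suc) (as ∘ suc)

    starSum-chain : ∀ (g : ∀ {x y} → T x y → A) n N as → starSum g (chain n N as) ≈ sum (λ u → starSum g (as u))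
    starSum-chain g zero    N as = refl
    starSum-chain g (suc n) N as = trans (starSum-◅◅ g (as zero) _) (+-congˡ (starSum-chain g n (N ∘ suc) (as ∘ suc)))

    -- Each junction can be left only towards the next one and the last cannot be left at all, so a
    -- walk from the first to the last uses exactly one arc per block. The equation holds for all
    -- weights `g` at once, because the arcs must not depend on the coordinate of the cost under
    -- consideration.
    unchain : ∀ n (N : Fin (suc n) → X) →
              (∀ u {y} → T (N (inject₁ u)) y → y ≡ N (suc u)) →
              (∀ {y} → ¬ T (N (Fin.fromℕ n)) y) →
              (∀ u → N (inject₁ u) ≢ N (Fin.fromℕ n)) →
              ∀ {x y} → x ≡ N zero → y ≡ N (Fin.fromℕ n) → (as : Star T x y) →
              Σ (∀ u → T (N (inject₁ u)) (N (suc u))) λ arcs →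
              ∀ (g : ∀ {x y} → T x y → A) → starSum g as ≈ sum (λ u → g (arcs u))
    unchain zero    N next final ≢final ≡.refl ≡.refl ε        = (λ ()) , λ g → refl
    unchain zero    N next final ≢final ≡.refl ≡.refl (a ◅ as) = contradiction a final
    unchain (suc n) N next final ≢final ≡.refl eq     ε        = contradiction eq (≢final zero)
    unchain (suc n) N next final ≢final ≡.refl eq     (a ◅ as) with next zero a
    ... | ≡.refl with unchain n (N ∘ suc) (next ∘ suc) final (≢final ∘ suc) ≡.refl eq as
    ...   | arcs , arcs-sum = (λ { zero → a ; (suc u) → arcs u }) , λ g → +-congˡ (arcs-sum g)

  walkSum : ∀ {d} (G : Graph d) → (Graph.Edge G → A) → ∀ {x y} → Graph.Walk G x y → A
  walkSum G w = starSum (λ (e , _) → w e)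

  -- Walks in a tensor product

  module _ {c d} (G₁ : Graph c) (G₂ : Graph d) where
    private
      module G₁ = Graph G₁
      module G₂ = Graph G₂
      module G  = Graph (G₁ ⊗ G₂)

    -- `old` and `glue` repeat the functions local to the definition of `_⊗_`, which have no name
    -- outside it; `tail-⊗` and `head-⊗` identify the two versions by cases.
    old : Node G₁.Inner → Node G.Inner
    old s         = s
    old t         = t
    old (inner x) = inner (inj₁ x)

    glue : G₁.Edge → Node G₂.Inner → Node G.Inner
    glue e s         = old (G₁.tail e)
    glue e t         = old (G₁.head e)
    glue e (inner x) = inner (inj₂ (e , x))

    tail-⊗ : ∀ e₁ e₂ → G.tail (e₁ , e₂) ≡ glue e₁ (G₂.tail e₂)
    tail-⊗ e₁ e₂ with G₂.tail e₂
    tail-⊗ e₁ e₂ | s with G₁.tail e₁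
    ... | s       = ≡.refl
    ... | t       = ≡.refl
    ... | inner _ = ≡.refl
    tail-⊗ e₁ e₂ | t with G₁.head e₁
    ... | s       = ≡.refl
    ... | t       = ≡.refl
    ... | inner _ = ≡.refl
    tail-⊗ e₁ e₂ | inner _ = ≡.refl

    head-⊗ : ∀ e₁ e₂ → G.head (e₁ , e₂) ≡ glue e₁ (G₂.head e₂)
    head-⊗ e₁ e₂ with G₂.head e₂
    head-⊗ e₁ e₂ | s with G₁.tail e₁
    ... | s       = ≡.refl
    ... | t       = ≡.refl
    ... | inner _ = ≡.refl
    head-⊗ e₁ e₂ | t with G₁.head e₁
    ... | s       = ≡.refl
    ... | t       = ≡.refl
    ... | inner _ = ≡.refl
    head-⊗ e₁ e₂ | inner _ = ≡.refl

    old-injective : ∀ {x y} → old x ≡ old y → x ≡ y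
    old-injective {s}       {s}       _      = ≡.refl
    old-injective {t}       {t}       _      = ≡.refl
    old-injective {inner x} {inner y} ≡.refl = ≡.refl

    old≢inner₂ : ∀ {x e z} → old x ≢ inner (inj₂ (e , z))
    old≢inner₂ {s} ()
    old≢inner₂ {t} ()
    old≢inner₂ {inner x} ()

    glue-inner : ∀ {e e′ z x} → glue e z ≡ inner (inj₂ (e′ , x)) → e ≡ e′ × z ≡ inner x
    glue-inner {z = s} eq     = contradiction eq old≢inner₂
    glue-inner {z = t} eq     = contradiction eq old≢inner₂
    glue-inner {z = inner x} ≡.refl = ≡.refl , ≡.refl

    glue-old : ∀ {e z x} → z ≢ t → glue e z ≡ old x → z ≡ s × G₁.tail e ≡ x
    glue-old {z = s} z≢t eq = ≡.refl , old-injective eq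
    glue-old {z = t} z≢t eq = contradiction ≡.refl z≢t
    glue-old {z = inner x} z≢t eq = contradiction (≡.sym eq) old≢inner₂

    glueWalk : ∀ e {x y} → G₂.Walk x y → G.Walk (glue e x) (glue e y)
    glueWalk e ε = ε
    glueWalk e ((e₂ , tail≡ , head≡) ◅ ws) =
      ((e , e₂) , ≡.trans (tail-⊗ e e₂) (≡.cong (glue e) tail≡) , ≡.trans (head-⊗ e e₂) (≡.cong (glue e) head≡)) ◅ glueWalk e ws

    walkSum-glueWalk : ∀ (w₁ : G₁.Edge → A) (w₂ : G₂.Edge → A) e {x y} (ws : G₂.Walk x y) →
      walkSum (G₁ ⊗ G₂) (λ (e₁ , e₂) → w₁ e₁ * w₂ e₂) (glueWalk e ws) ≈ w₁ e * walkSum G₂ w₂ ws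
    walkSum-glueWalk w₁ w₂ e ε = sym (zeroʳ (w₁ e))
    walkSum-glueWalk w₁ w₂ e ((e₂ , _) ◅ ws) =
      trans (+-congˡ (walkSum-glueWalk w₁ w₂ e ws)) (sym (distribˡ (w₁ e) (w₂ e₂) _))

    -- A full passage through one copy of `G₂`, regarded as a single arc of `G₁`.
    SuperArc : Rel (Node G₁.Inner) 0ℓ
    SuperArc x y = G₁.Arc x y × G₂.Walk s t

    superSum : (G₁.Edge → A) → (G₂.Edge → A) → ∀ {x y} → Star SuperArc x y → A
    superSum w₁ w₂ = starSum (λ ((e , _) , ws) → w₁ e * walkSum G₂ w₂ ws)

    module _ (head≢s : ∀ e → G₂.head e ≢ s) (tail≢t : ∀ e → G₂.tail e ≢ t) where

      -- No edge of `G₂` leaves its t, so an edge leaving an old node starts at the s of some copy;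
      -- no edge of `G₂` enters its s, so the copy can be left only through its t. Hence the walk is
      -- a sequence of full passages.
      unglue : ∀ {a z} (ws : G.Walk a z) {x y} → a ≡ old x → z ≡ old y →
        Σ (Star SuperArc x y) λ as → ∀ w₁ w₂ →
        walkSum (G₁ ⊗ G₂) (λ (e₁ , e₂) → w₁ e₁ * w₂ e₂) ws ≈ superSum w₁ w₂ as
      -- The state in the middle of a passage: the walk stands at node `n` of the copy at `e`, and
      -- the rest of that passage is split from what follows the head of `e`.
      unglueCopy : ∀ {a z} (ws : G.Walk a z) e n {y} → n ≢ s → a ≡ glue e n → z ≡ old y →
        Σ (G₂.Walk n t) λ ws₂ → Σ (Star SuperArc (G₁.head e) y) λ as → ∀ w₁ w₂ →
        walkSum (G₁ ⊗ G₂) (λ (e₁ , e₂) → w₁ e₁ * w₂ e₂) ws ≈ w₁ e * walkSum G₂ w₂ ws₂ + superSum w₁ w₂ as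

      unglue ε a≡x z≡y with old-injective (≡.trans (≡.sym a≡x) z≡y)
      ... | ≡.refl = ε , λ w₁ w₂ → refl
      unglue (((e₁ , e₂) , tail≡ , head≡) ◅ ws) a≡x z≡y
        with glue-old {e₁} (tail≢t e₂) (≡.trans (≡.sym (tail-⊗ e₁ e₂)) (≡.trans tail≡ a≡x))
           | unglueCopy ws e₁ (G₂.head e₂) (head≢s e₂) (≡.trans (≡.sym head≡) (head-⊗ e₁ e₂)) z≡y
      ... | tail₂≡s , tail₁≡x | ws₂ , as , eq =
        (((e₁ , tail₁≡x , ≡.refl) , (e₂ , tail₂≡s , ≡.refl) ◅ ws₂) ◅ as) , λ w₁ w₂ → begin-equality
          w₁ e₁ * w₂ e₂ + walkSum (G₁ ⊗ G₂) _ ws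
            ≈⟨ +-congˡ (eq w₁ w₂) ⟩
          w₁ e₁ * w₂ e₂ + (w₁ e₁ * walkSum G₂ w₂ ws₂ + superSum w₁ w₂ as)
            ≈⟨ +-assoc _ _ _ ⟨
          (w₁ e₁ * w₂ e₂ + w₁ e₁ * walkSum G₂ w₂ ws₂) + superSum w₁ w₂ as
            ≈⟨ +-congʳ (distribˡ _ _ _) ⟨
          w₁ e₁ * (w₂ e₂ + walkSum G₂ w₂ ws₂) + superSum w₁ w₂ as ∎

      unglueCopy ws e s n≢s a≡ z≡y = contradiction ≡.refl n≢s
      unglueCopy ws e t n≢s a≡ z≡y with unglue ws a≡ z≡y
      ... | as , eq = ε , as , λ w₁ w₂ → trans (eq w₁ w₂)
        (trans (sym (+-identityˡ _)) (+-congʳ (sym (zeroʳ (w₁ e)))))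
      unglueCopy ε e (inner x) n≢s a≡ z≡y = contradiction (≡.trans (≡.sym z≡y) a≡) old≢inner₂
      unglueCopy (((e₁ , e₂) , tail≡ , head≡) ◅ ws) e (inner x) n≢s a≡ z≡y
        with glue-inner {e₁} {e} {G₂.tail e₂} {x} (≡.trans (≡.sym (tail-⊗ e₁ e₂)) (≡.trans tail≡ a≡))
      ... | ≡.refl , tail₂≡x
        with unglueCopy ws e₁ (G₂.head e₂) (head≢s e₂) (≡.trans (≡.sym head≡) (head-⊗ e₁ e₂)) z≡y
      ...   | ws₂ , as , eq = ((e₂ , tail₂≡x , ≡.refl) ◅ ws₂) , as , λ w₁ w₂ → begin-equality
          w₁ e₁ * w₂ e₂ + walkSum (G₁ ⊗ G₂) _ ws
            ≈⟨ +-congˡ (eq w₁ w₂) ⟩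
          w₁ e₁ * w₂ e₂ + (w₁ e₁ * walkSum G₂ w₂ ws₂ + superSum w₁ w₂ as)
            ≈⟨ +-assoc _ _ _ ⟨
          (w₁ e₁ * w₂ e₂ + w₁ e₁ * walkSum G₂ w₂ ws₂) + superSum w₁ w₂ as
            ≈⟨ +-congʳ (distribˡ _ _ _) ⟨
          w₁ e₁ * (w₂ e₂ + walkSum G₂ w₂ ws₂) + superSum w₁ w₂ as ∎

    head-⊗≢s : (∀ e → G₁.head e ≢ s) → (∀ e → G₂.head e ≢ s) → ∀ e → G.head e ≢ s
    head-⊗≢s h₁ h₂ (e₁ , e₂) eq with G₂.head e₂ | h₂ e₂ | head-⊗ e₁ e₂
    ... | s | z≢s | _ = z≢s ≡.refl
    ... | t | _ | eq′ = h₁ e₁ (old-injective (≡.trans (≡.sym eq′) eq))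
    ... | inner _ | _ | _ with () ← eq

    tail-⊗≢t : (∀ e → G₁.tail e ≢ t) → (∀ e → G₂.tail e ≢ t) → ∀ e → G.tail e ≢ t
    tail-⊗≢t h₁ h₂ (e₁ , e₂) eq with G₂.tail e₂ | h₂ e₂ | tail-⊗ e₁ e₂
    ... | t | z≢t | _ = z≢t ≡.refl
    ... | s | _ | eq′ = h₁ e₁ (old-injective (≡.trans (≡.sym eq′) eq))
    ... | inner _ | _ | _ with () ← eq

  -- Ranks increasing along edges, which make every walk simple

  record Ranking {d} (G : Graph d) : Set where
    open Graph G
    field
      rank            : Node Inner → ℕ
      rank-s          : rank s ≡ 0
      rank-increasing : ∀ e → rank (tail e) ℕ.< rank (head e)

    rank≤visited : ∀ {x y} (w : Walk x y) → All (λ z → rank x ℕ.≤ rank z) (visited w)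
    rank≤visited ε = ℕ.≤-refl ∷ []
    rank≤visited ((e , ≡.refl , ≡.refl) ◅ w) =
      ℕ.≤-refl ∷ All.map (ℕ.≤-trans (ℕ.<⇒≤ (rank-increasing e))) (rank≤visited w)

    visited-unique : ∀ {x y} (w : Walk x y) → Unique (visited w)
    visited-unique ε = [] ∷ []
    visited-unique ((e , ≡.refl , ≡.refl) ◅ w) =
      All.map (λ rank≤ x≡z → ℕ.<⇒≱ (rank-increasing e) (≡.subst (λ z → rank (head e) ℕ.≤ rank z) (≡.sym x≡z) rank≤))
        (rank≤visited w)
      ∷ visited-unique w

  -- Ranks combine like two-digit numbers whose base is the rank of t in `G₂`. Edges of `G₁` must
  -- raise the rank by exactly one, so that t of a copy receives the rank of the old node it is
  -- identified with.
  ⊗-ranking : ∀ {c d} {G₁ : Graph c} {G₂ : Graph d} (r₁ : Ranking G₁) → Ranking G₂ →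
    (∀ e → Ranking.rank r₁ (Graph.head G₁ e) ≡ suc (Ranking.rank r₁ (Graph.tail G₁ e))) → Ranking (G₁ ⊗ G₂)
  ⊗-ranking {G₁ = G₁} {G₂} r₁ r₂ consecutive = record
    { rank = rank
    ; rank-s = ≡.refl
    ; rank-increasing = λ (e₁ , e₂) → ≡.subst₂ ℕ._<_
        (≡.sym (≡.trans (≡.cong rank (tail-⊗ G₁ G₂ e₁ e₂)) (rank-glue e₁ (G₂.tail e₂))))
        (≡.sym (≡.trans (≡.cong rank (head-⊗ G₁ G₂ e₁ e₂)) (rank-glue e₁ (G₂.head e₂))))
        (ℕ.+-monoʳ-< (r₁.rank (G₁.tail e₁) ℕ.* r₂.rank t) (r₂.rank-increasing e₂))
    }
    where
    module G₁ = Graph G₁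
    module G₂ = Graph G₂
    module r₁ = Ranking r₁
    module r₂ = Ranking r₂

    rank : Node (Graph.Inner (G₁ ⊗ G₂)) → ℕ
    rank s                      = 0
    rank t                      = r₁.rank t ℕ.* r₂.rank t
    rank (inner (inj₁ x))       = r₁.rank (inner x) ℕ.* r₂.rank t
    rank (inner (inj₂ (e , x))) = r₁.rank (G₁.tail e) ℕ.* r₂.rank t ℕ.+ r₂.rank (inner x)

    rank-old : ∀ x → rank (old G₁ G₂ x) ≡ r₁.rank x ℕ.* r₂.rank t
    rank-old s         = ≡.cong (ℕ._* r₂.rank t) (≡.sym r₁.rank-s)
    rank-old t         = ≡.refl
    rank-old (inner x) = ≡.refl

    rank-glue : ∀ e z → rank (glue G₁ G₂ e z) ≡ r₁.rank (G₁.tail e) ℕ.* r₂.rank t ℕ.+ r₂.rank z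
    rank-glue e s = ≡.trans (rank-old (G₁.tail e))
      (≡.trans (≡.sym (ℕ.+-identityʳ _)) (≡.cong (r₁.rank (G₁.tail e) ℕ.* r₂.rank t ℕ.+_) (≡.sym r₂.rank-s)))
    rank-glue e t = ≡.trans (rank-old (G₁.head e))
      (≡.trans (≡.cong (ℕ._* r₂.rank t) (consecutive e)) (ℕ.+-comm (r₂.rank t) _))
    rank-glue e (inner x) = ≡.refl

  junctionRank : ∀ n → Node (Fin (n ℕ.∸ 1)) → ℕ
  junctionRank n s         = 0
  junctionRank n t         = n
  junctionRank n (inner j) = suc (toℕ j)

  junctionRank-junction : ∀ n i → junctionRank n (junction n i) ≡ toℕ i
  junctionRank-junction zero    zero = ≡.refl
  junctionRank-junction (suc n) zero = ≡.refl
  junctionRank-junction (suc n) (suc i) with view i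
  ... | ‵fromℕ     = ≡.cong suc (≡.sym (Fin.toℕ-fromℕ n))
  ... | ‵inject₁ j = ≡.cong suc (≡.sym (Fin.toℕ-inject₁ j))

  junction-injective : ∀ n {i j} → junction n i ≡ junction n j → i ≡ j
  junction-injective n {i} {j} eq = Fin.toℕ-injective
    (≡.trans (≡.sym (junctionRank-junction n i)) (≡.trans (≡.cong (junctionRank n) eq) (junctionRank-junction n j)))

  junction-zero : ∀ n → junction n zero ≡ s
  junction-zero zero    = ≡.refl
  junction-zero (suc n) = ≡.refl

  junction-fromℕ : ∀ n .{{_ : NonZero n}} → junction n (Fin.fromℕ n) ≡ t
  junction-fromℕ (suc n) rewrite view-fromℕ n = ≡.refl

  -- Transfer of real expressions to the opaque ring

  module _ (M : RawMonoid 0ℓ 0ℓ) (N : Monoid 0ℓ 0ℓ) where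
    private
      module M = RawMonoid M
      module N = Monoid N
    open import Algebra.Definitions.RawMonoid M using () renaming (sum to sumᴹ; _×_ to _×ᴹ_)
    open import Algebra.Definitions.RawMonoid N.rawMonoid using () renaming (sum to sumᴺ; _×_ to _×ᴺ_)

    module _ (h : M.Carrier → N.Carrier) (h-∙ : ∀ x y → h (x M.∙ y) N.≈ h x N.∙ h y) (h-ε : h M.ε N.≈ N.ε) where

      homo-sum : ∀ {n} (f : Vector M.Carrier n) → h (sumᴹ f) N.≈ sumᴺ (λ i → h (f i))
      homo-sum {zero}  f = h-ε
      homo-sum {suc n} f = N.trans (h-∙ (f zero) (sumᴹ (f ∘ suc))) (N.∙-congˡ (homo-sum (f ∘ suc)))

      homo-× : ∀ n x → h (n ×ᴹ x) N.≈ n ×ᴺ h x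
      homo-× zero    x = h-ε
      homo-× (suc n) x = N.trans (h-∙ x (n ×ᴹ x)) (N.∙-congˡ (homo-× n x))

  ⟦⟧-sum : ∀ {n} (f : Vector ℝ n) → ⟦ Defs.sum f ⟧ ≈ sum (λ i → ⟦ f i ⟧)
  ⟦⟧-sum {n} f = homo-sum (RawRing.+-rawMonoid ℝ-rawRing) +-monoid ⟦_⟧ ⟦⟧-+ ⟦⟧-0 {n} f

  ⟦⟧-product : ∀ {n} (f : Vector ℝ n) → ⟦ Defs.product f ⟧ ≈ product (λ i → ⟦ f i ⟧)
  ⟦⟧-product {n} f = homo-sum (RawRing.*-rawMonoid ℝ-rawRing) *-monoid ⟦_⟧ ⟦⟧-* ⟦⟧-1 {n} f

  homo-^ : (h : ℝ → A) → (∀ x y → h (x Defs.* y) ≈ h x * h y) → h 1ℝ ≈ 1# → ∀ x n → h (x Defs.^ n) ≈ h x ^ n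
  homo-^ h h-* h-1 x n = homo-× (RawRing.*-rawMonoid ℝ-rawRing) *-monoid h h-* h-1 n x

  ⟦⟧-^ : ∀ x n → ⟦ x Defs.^ n ⟧ ≈ ⟦ x ⟧ ^ n
  ⟦⟧-^ = homo-^ ⟦_⟧ ⟦⟧-* ⟦⟧-1

  ⟦⟧-1- : ∀ x → ⟦ 1ℝ Defs.- x ⟧ ≈ 1# - ⟦ x ⟧
  ⟦⟧-1- x = trans (⟦⟧-cong (1ℝ Defs.- x) (1ℝ Defs.+ (Defs.- x)) (minus-def 1ℝ x))
    (trans (⟦⟧-+ 1ℝ (Defs.- x)) (+-cong ⟦⟧-1 (⟦⟧-neg x)))

  ⟦⟧-⊗ᵛ : ∀ {m n} (x : Vector ℝ m) (y : Vector ℝ n) i →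
          ⟦ (x ⊗ᵛ y) i ⟧ ≈ ⟦ x (proj₂ (quotRem {m} n i)) ⟧ * ⟦ y (proj₁ (quotRem {m} n i)) ⟧
  ⟦⟧-⊗ᵛ {m} {n} x y i = trans (⟦⟧-cong ((x ⊗ᵛ y) i) _ (⊗ᵛ-lookup x y i))
    (⟦⟧-* (x (proj₂ (quotRem {m} n i))) (y (proj₁ (quotRem {m} n i))))

  -- The hypothesis is applied to the power of `x` rather than to `x`: monotonicity of powers would
  -- ask for 0 ≤ x, which fails for the negative entries met here.
  ^-mono-homo : (h : ℝ → A) → (∀ x y → h (x Defs.* y) ≈ h x * h y) → h 1ℝ ≈ 1# → (∀ x → ⟦ x ⟧ ≤ₘ h x) →
                ∀ x n → ⟦ x ⟧ ^ n ≤ₘ h x ^ n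
  ^-mono-homo h h-* h-1 ⟦⟧≤h x n = ≤-trans (≤-reflexive (sym (⟦⟧-^ x n)))
    (≤-trans (⟦⟧≤h (x Defs.^ n)) (≤-reflexive (homo-^ h h-* h-1 x n)))

  ^-≤-∣∣^ : ∀ x n → ⟦ x ⟧ ^ n ≤ₘ ⟦ Defs.∣ x ∣ ⟧ ^ n
  ^-≤-∣∣^ = ^-mono-homo (λ x → ⟦ Defs.∣ x ∣ ⟧) ⟦∣∣⟧-* ⟦∣∣⟧-1 ⟦⟧≤⟦∣∣⟧

  ∣∣^-even : ∀ x {n} → 2 ∣ n → ⟦ Defs.∣ x ∣ ⟧ ^ n ≈ ⟦ x ⟧ ^ n
  ∣∣^-even x (divides q ≡.refl) = even q
    where
    even : ∀ q → ⟦ Defs.∣ x ∣ ⟧ ^ (q ℕ.* 2) ≈ ⟦ x ⟧ ^ (q ℕ.* 2)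
    even zero    = refl
    even (suc q) = trans (sym (*-assoc _ _ _)) (trans (*-cong (⟦∣∣⟧-square x) (even q)) (*-assoc _ _ _))

  ⟦⟧-/ : ∀ n d .{{_ : NonZero d}} → ⟦ fromℚ (+ n ℚ./ d) ⟧ ≈ n · ⟦ fromℚ (+ 1 ℚ./ d) ⟧
  ⟦⟧-/ zero    d = trans (reflexive (≡.cong (λ a → ⟦ fromℚ a ⟧) (0/d≡0 d))) ⟦⟧-0
  ⟦⟧-/ (suc n) d = trans (reflexive (≡.cong (λ a → ⟦ fromℚ a ⟧) (/-suc n d)))
    (trans (⟦⟧-fromℚ-+ (+ 1 ℚ./ d) (+ n ℚ./ d)) (+-congˡ (⟦⟧-/ n d)))

  ⟦⟧-fromℕ : ∀ n → ⟦ fromℕ n ⟧ ≈ n · 1#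
  ⟦⟧-fromℕ n = trans (⟦⟧-/ n 1) (×-congʳ n ⟦⟧-1)

  d·1/d≈1 : ∀ d .{{_ : NonZero d}} → d · ⟦ fromℚ (+ 1 ℚ./ d) ⟧ ≈ 1#
  d·1/d≈1 d = trans (sym (⟦⟧-/ d d)) (trans (reflexive (≡.cong (λ a → ⟦ fromℚ a ⟧) (d/d≡1 d))) ⟦⟧-1)

  0≤1/d : ∀ d .{{_ : NonZero d}} → 0# ≤ₘ ⟦ fromℚ (+ 1 ℚ./ d) ⟧
  0≤1/d d = ≤-trans (≤-reflexive (sym ⟦⟧-0))
    (⟦⟧-fromℚ-mono 0ℚ (+ 1 ℚ./ d) (ℚ.nonNegative⁻¹ (+ 1 ℚ./ d) {{ℚ.normalize-nonNeg 1 d}}))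

  1^n≈1 : ∀ n → 1# ^ n ≈ 1#
  1^n≈1 zero    = refl
  1^n≈1 (suc n) = trans (*-identityˡ _) (1^n≈1 n)

  -- Multilinear products of tensors and of vector systems

  M : ∀ {p d} → (Fin p → Vector A d) → A
  M u = sum (λ j → product (λ i → u i j))

  sum-sum-* : ∀ {m n} (f : Vector A m) (g : Vector A n) → sum (λ a → sum (λ b → f a * g b)) ≈ sum f * sum g
  sum-sum-* f g = trans (sum-cong-≋ λ a → sym (*-distribˡ-sum (f a) g)) (sym (*-distribʳ-sum (sum g) f))

  -- The i-th factor is the sum over x of the tensors of `X i x` and `Y i x`. Multiplying out
  -- chooses x = f i in factor i, and a multilinear product of tensors is the product of the two
  -- multilinear products.
  M-expand : ∀ p {r d e} (X : Fin p → Fin r → Vector A d) (Y : Fin p → Fin r → Vector A e) →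
    sum (λ a → sum (λ b → product (λ i → sum (λ x → X i x a * Y i x b)))) ≈
    sumᶠ p (λ f → M (λ i → X i (f i)) * M (λ i → Y i (f i)))
  M-expand p {r} X Y = begin-equality
    sum (λ a → sum (λ b → product (λ i → sum (λ x → X i x a * Y i x b))))
      ≈⟨ sum-cong-≋ (λ a → sum-cong-≋ λ b → product-sum p (λ i x → X i x a * Y i x b)) ⟩
    sum (λ a → sum (λ b → sumᶠ p (λ f → product (λ i → X i (f i) a * Y i (f i) b))))
      ≈⟨ sum-cong-≋ (λ a → sum-cong-≋ λ b → sumᶠ-cong p λ f → product-distrib-* (λ i → X i (f i) a) (λ i → Y i (f i) b)) ⟩
    sum (λ a → sum (λ b → sumᶠ p (λ f → ΠX f a * ΠY f b)))
      ≈⟨ sum-cong-≋ (λ a → sum-sumᶠ-comm p (λ b f → ΠX f a * ΠY f b)) ⟩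
    sum (λ a → sumᶠ p (λ f → sum (λ b → ΠX f a * ΠY f b)))
      ≈⟨ sum-sumᶠ-comm p (λ a f → sum (λ b → ΠX f a * ΠY f b)) ⟩
    sumᶠ p (λ f → sum (λ a → sum (λ b → ΠX f a * ΠY f b)))
      ≈⟨ sumᶠ-cong p (λ f → sum-sum-* (ΠX f) (ΠY f)) ⟩
    sumᶠ p (λ f → M (λ i → X i (f i)) * M (λ i → Y i (f i))) ∎
    where
    ΠX : Vector (Fin r) p → Vector A _
    ΠX f a = product (λ i → X i (f i) a)
    ΠY : Vector (Fin r) p → Vector A _
    ΠY f b = product (λ i → Y i (f i) b)

  module _ {P r q d₀ : ℕ} .{{r≢0 : NonZero r}} (S : VectorSystem r q P d₀) where
    open VectorSystem S

    ρ : A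
    ρ = ⟦ fromℚ (+ 1 ℚ./ r) ⟧

    vecM : Vector (Fin r × Fin q) P → A
    vecM u = M (λ i a → ⟦ vec (u i) a ⟧)

    sharesColor? : ∀ u → Dec (SharesColor u)
    sharesColor? u = Fin.any? λ a → Fin.any? λ b → ¬? (×-≡-dec Fin._≟_ Fin._≟_ (u a) (u b)) ×-dec (color (u a) Fin.≟ color (u b))

    ⟦multilinear⟧ : ∀ u → ⟦ multilinear (λ i → vec (u i)) ⟧ ≈ vecM u
    ⟦multilinear⟧ u = trans (⟦⟧-sum (λ j → Defs.product (λ i → vec (u i) j)))
      (sum-cong-≋ λ j → ⟦⟧-product (λ i → vec (u i) j))

    vecM-shared : ∀ u → SharesColor u → vecM u ≈ 0#
    vecM-shared u sh = trans (sym (⟦multilinear⟧ u)) (trans (⟦⟧-cong (multilinear (λ i → vec (u i))) 0ℝ (shared u sh)) ⟦⟧-0)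

    vecM-otherwise : ∀ u → ¬ SharesColor u → vecM u ≈ ρ ^ #distinct u
    vecM-otherwise u ¬sh = trans (sym (⟦multilinear⟧ u))
      (trans (⟦⟧-cong (multilinear (λ i → vec (u i)))
          (fromℚ (+ 1 ℚ./ r) Defs.^ #distinct u) (otherwise u ¬sh))
        (⟦⟧-^ (fromℚ (+ 1 ℚ./ r)) (#distinct u)))

    -- Coordinates may be negative, but deciding whether a color is shared leaves only the values 0
    -- and a power of 1/r.
    vecM-nonNeg : ∀ u → 0# ≤ₘ vecM u
    vecM-nonNeg u with sharesColor? u
    ... | yes sh  = ≤-reflexive (sym (vecM-shared u sh))
    ... | no  ¬sh = ≤-trans (^-nonNeg (#distinct u) (0≤1/d r)) (≤-reflexive (sym (vecM-otherwise u ¬sh)))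

  -- Trees and the recursion for M_k

  module _ {p r d₀ : ℕ} .{{r≢0 : NonZero r}} (H : LabelCover r) (S : VectorSystem r (LabelCover.∣C∣ H) (suc p) d₀) where
    open LabelCover H
    open VectorSystem S

    -- An s-t path of the k-th tensor power: at every vertex a label, and an s-t
    -- path of the previous power through the edge so chosen.
    Tree : ℕ → Set
    Tree zero    = Unit.⊤
    Tree (suc k) = Fin ∣V∣ → Fin ∣L∣ × Tree k

    weight : Fin ∣V∣ × Fin ∣L∣ → Vector A (∣E∣ ℕ.* d₀)
    weight e = Vector.concat (λ h a → ⟦ edgeCost H S h e a ⟧)

    -- Laid out by `concat` as in `_⊗ᵛ_`, so that coordinates match those of the path cost index by
    -- index.
    treeCost : ∀ k → Tree k → Vector A ((∣E∣ ℕ.* d₀) ℕ.^ k)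
    treeCost zero    _ _ = 1#
    treeCost (suc k) τ   = Vector.concat (λ q j → sum (λ u → weight (u , proj₁ (τ u)) q * treeCost k (proj₂ (τ u)) j))

    treeM : ∀ k → (Fin (suc p) → Tree k) → A
    treeM k τ = M (λ i → treeCost k (τ i))

    branch : ∀ {k} → (Fin (suc p) → Tree (suc k)) → Fin ∣E∣ → Vector (Fin r) (suc p) → Fin (suc p) → Tree k
    branch τ h f i = proj₂ (τ i (vertex h (f i)))

    vectors : ∀ {k} → (Fin (suc p) → Tree (suc k)) → Fin ∣E∣ → Vector (Fin r) (suc p) → Vector (Fin r × Fin ∣C∣) (suc p)
    vectors τ h f i = f i , π h (f i) (proj₁ (τ i (vertex h (f i))))

    ⟦edgeCost⟧ : ∀ h u l a → ⟦ edgeCost H S h (u , l) a ⟧ ≈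
                 when (vertex h (part u) Fin.≟ u) ⟦ vec (part u , π h (part u) l) a ⟧
    ⟦edgeCost⟧ h u l a with vertex h (part u) Fin.≟ u
    ... | yes _ = refl
    ... | no  _ = ⟦⟧-0

    -- A vertex lies in h exactly when it is `vertex h x` for some x, and then x is its part. This
    -- turns the sum over V into one over the r parts, which is why the expansion runs over maps
    -- into [r].
    sum-vertex : ∀ h (g : Fin ∣V∣ → A) → sum (λ u → when (vertex h (part u) Fin.≟ u) (g u)) ≈ sum (λ x → g (vertex h x))
    sum-vertex h g = begin-equality
      sum (λ u → when (vertex h (part u) Fin.≟ u) (g u))
        ≈⟨ sum-cong-≋ (λ u → trans (when-⇔ (vertex h (part u) Fin.≟ u) (u Fin.≟ vertex h (part u)) ≡.sym ≡.sym)
             (sym (sum-single (part u) λ x x≢ → when-no (u Fin.≟ vertex h x) λ { ≡.refl → x≢ (≡.sym (vertex-part h x)) }))) ⟩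
      sum (λ u → sum (λ x → when (u Fin.≟ vertex h x) (g u)))
        ≈⟨ ∑-comm (λ u x → when (u Fin.≟ vertex h x) (g u)) ⟩
      sum (λ x → sum (λ u → when (u Fin.≟ vertex h x) (g u)))
        ≈⟨ sum-cong-≋ (λ x → sum-δ g (vertex h x)) ⟩
      sum (λ x → g (vertex h x)) ∎

    sum-edgeCost : ∀ h (l : Fin ∣V∣ → Fin ∣L∣) (y : Fin ∣V∣ → A) a →
      sum (λ u → ⟦ edgeCost H S h (u , l u) a ⟧ * y u) ≈
      sum (λ x → ⟦ vec (x , π h x (l (vertex h x))) a ⟧ * y (vertex h x))
    sum-edgeCost h l y a = begin-equality
      sum (λ u → ⟦ edgeCost H S h (u , l u) a ⟧ * y u)
        ≈⟨ sum-cong-≋ (λ u → trans (*-congʳ (⟦edgeCost⟧ h u (l u) a)) (sym (when-*ʳ (vertex h (part u) Fin.≟ u) _ (y u)))) ⟩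
      sum (λ u → when (vertex h (part u) Fin.≟ u) (⟦ vec (part u , π h (part u) (l u)) a ⟧ * y u))
        ≈⟨ sum-vertex h (λ u → ⟦ vec (part u , π h (part u) (l u)) a ⟧ * y u) ⟩
      sum (λ x → ⟦ vec (part (vertex h x) , π h (part (vertex h x)) (l (vertex h x))) a ⟧ * y (vertex h x))
        ≈⟨ sum-cong-≋ (λ x → *-congʳ (reflexive (≡.cong (λ z → ⟦ vec (z , π h z (l (vertex h x))) a ⟧) (vertex-part h x)))) ⟩
      sum (λ x → ⟦ vec (x , π h x (l (vertex h x))) a ⟧ * y (vertex h x)) ∎

    treeM-suc : ∀ k τ → treeM (suc k) τ ≈
      sum (λ h → sumᶠ (suc p) (λ f → vecM S (vectors τ h f) * treeM k (branch τ h f)))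
    treeM-suc k τ = begin-equality
      treeM (suc k) τ
        ≈⟨ sum-concat (∣E∣ ℕ.* d₀) (λ q j → product (λ i → sum (λ u → weight (u , proj₁ (τ i u)) q * treeCost k (proj₂ (τ i u)) j))) ⟩
      sum (λ q → sum (λ j → product (λ i → sum (λ u → weight (u , proj₁ (τ i u)) q * treeCost k (proj₂ (τ i u)) j))))
        ≈⟨ sum-concat ∣E∣ (λ h a → sum (λ j → product (λ i → sum (λ u → ⟦ edgeCost H S h (u , proj₁ (τ i u)) a ⟧ * treeCost k (proj₂ (τ i u)) j)))) ⟩
      sum (λ h → sum (λ a → sum (λ j → product (λ i → sum (λ u → ⟦ edgeCost H S h (u , proj₁ (τ i u)) a ⟧ * treeCost k (proj₂ (τ i u)) j)))))
        ≈⟨ sum-cong-≋ (λ h → sum-cong-≋ λ a → sum-cong-≋ λ j → product-cong λ i →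
             sum-edgeCost h (λ u → proj₁ (τ i u)) (λ u → treeCost k (proj₂ (τ i u)) j) a) ⟩
      sum (λ h → sum (λ a → sum (λ j → product (λ i → sum (λ x →
        ⟦ vec (x , π h x (proj₁ (τ i (vertex h x)))) a ⟧ * treeCost k (proj₂ (τ i (vertex h x))) j)))))
        ≈⟨ sum-cong-≋ (λ h → M-expand (suc p)
             (λ i x a → ⟦ vec (x , π h x (proj₁ (τ i (vertex h x)))) a ⟧) (λ i x → treeCost k (proj₂ (τ i (vertex h x))))) ⟩
      sum (λ h → sumᶠ (suc p) (λ f → vecM S (vectors τ h f) * treeM k (branch τ h f))) ∎

    treeM-zero : ∀ τ → treeM 0 τ ≈ 1#
    treeM-zero τ = trans (+-identityʳ _) (trans (product-replicate (suc p)) (1^n≈1 (suc p)))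

    treeM-nonNeg : ∀ k τ → 0# ≤ₘ treeM k τ
    treeM-nonNeg zero    τ = ≤-trans 0≤1 (≤-reflexive (sym (treeM-zero τ)))
    treeM-nonNeg (suc k) τ = ≤-trans
      (sum-nonNeg λ h → sumᶠ-nonNeg (suc p) λ f → *-nonNeg (vecM-nonNeg S (vectors τ h f)) (treeM-nonNeg k (branch τ h f)))
      (≤-reflexive (sym (treeM-suc k τ)))

    constTree : Assignment → ∀ k → Tree k
    constTree σ zero    = tt
    constTree σ (suc k) = λ u → σ u , constTree σ k

    module _ (σ : Assignment) (satisfies : ∀ h → Satisfies σ h) where

      treeM-constTree : ∀ k → treeM k (λ _ → constTree σ k) ≈ (∣E∣ · 1#) ^ k
      treeM-constTree zero    = treeM-zero (λ _ → tt)
      treeM-constTree (suc k) = begin-equality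
        treeM (suc k) (λ _ → constTree σ (suc k))
          ≈⟨ treeM-suc k (λ _ → constTree σ (suc k)) ⟩
        sum (λ h → sumᶠ (suc p) (λ f → vecM S (u h f) * Y))
          ≈⟨ sum-cong-≋ (λ h → sumᶠ-constant p (constant h) (nonconstant h)) ⟩
        sum (Vector.replicate ∣E∣ (r · ((ρ S) * Y)))
          ≈⟨ sum-replicate ∣E∣ ⟩
        ∣E∣ · (r · ((ρ S) * Y))
          ≈⟨ ×-congʳ ∣E∣ (trans (sym (×-assoc-* r (ρ S) Y)) (*-congʳ (d·1/d≈1 r))) ⟩
        ∣E∣ · (1# * Y)
          ≈⟨ ×-assoc-* ∣E∣ 1# Y ⟨
        (∣E∣ · 1#) * Y
          ≈⟨ *-congˡ (treeM-constTree k) ⟩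
        (∣E∣ · 1#) ^ suc k ∎
        where
        Y : A
        Y = treeM k (λ _ → constTree σ k)
        u : ∀ h → Vector (Fin r) (suc p) → Vector (Fin r × Fin ∣C∣) (suc p)
        u h = vectors (λ _ → constTree σ (suc k)) h
        constant : ∀ h f → (∀ i → f i ≡ f zero) → vecM S (u h f) * Y ≈ (ρ S) * Y
        constant h f f≡ = *-congʳ (trans (vecM-otherwise S (u h f) λ (a , b , ua≢ub , _) → ua≢ub (≡.trans (u≡ a) (≡.sym (u≡ b))))
          (trans (reflexive (≡.cong ((ρ S) ^_) (deduplicate-replicate (×-≡-dec Fin._≟_ Fin._≟_) (u h f) u≡))) (*-identityʳ (ρ S))))
          where
          u≡ : ∀ i → u h f i ≡ u h f zero
          u≡ i = ≡.cong (λ x → x , colorIn σ h x) (f≡ i)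
        nonconstant : ∀ h f → (∃ λ i → f i ≢ f zero) → vecM S (u h f) * Y ≈ 0#
        nonconstant h f (i , fi≢) = trans
          -- Different parts give different vectors, and satisfaction of h gives them the same
          -- color.
          (*-congʳ (vecM-shared S (u h f) (i , zero , (λ eq → fi≢ (≡.cong proj₁ eq)) , satisfies h (f i) (f zero))))
          (zeroˡ Y)

    -- Serves the second alternative in (a): with nonnegative coordinates the absolute values in the
    -- norm disappear for every p.
    treeCost-nonNeg : (∀ a i → 0# ≤ₘ ⟦ vec a i ⟧) → ∀ k τ i → 0# ≤ₘ treeCost k τ i
    treeCost-nonNeg 0≤vec zero    τ i = 0≤1
    treeCost-nonNeg 0≤vec (suc k) τ i = sum-nonNeg λ u → *-nonNeg (0≤edge _ (u , proj₁ (τ u)) _) (treeCost-nonNeg 0≤vec k (proj₂ (τ u)) _)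
      where
      0≤edge : ∀ h e a → 0# ≤ₘ ⟦ edgeCost H S h e a ⟧
      0≤edge h (u , l) a = ≤-trans (when-nonNeg (vertex h (part u) Fin.≟ u) (0≤vec _ a)) (≤-reflexive (sym (⟦edgeCost⟧ h u l a)))

  count-filter-tabulate : ∀ {X : Set} {Q : X → Set} (Q? : ∀ x → Dec (Q x)) {n} (f : Fin n → X) →
    length (filter Q? (List.tabulate f)) · 1# ≈ sum (λ i → when (Q? (f i)) 1#)
  count-filter-tabulate Q? {zero}  f = refl
  count-filter-tabulate Q? {suc n} f with Q? (f zero)
  ... | yes _ = +-congˡ (count-filter-tabulate Q? (f ∘ suc))
  ... | no  _ = trans (count-filter-tabulate Q? (f ∘ suc)) (sym (+-identityˡ _))

  -- The lower bound by induction on k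

  module _ {p r d₀ : ℕ} .{{r≢0 : NonZero r}} (H : LabelCover r) (S : VectorSystem r (LabelCover.∣C∣ H) (suc p) d₀) where
    open LabelCover H
    open VectorSystem S

    -- The trees τ i carry different assignments, but those used with the same
    -- part agree, so they merge into one that is the i-th on part f i.  This is
    -- what lets the hypothesis on single assignments control p trees at once.
    mixedAssignment : ∀ {k} → (Fin (suc p) → Tree H S (suc k)) → Vector (Fin r) (suc p) → Assignment
    mixedAssignment τ f u with Fin.any? (λ i → f i Fin.≟ part u)
    ... | yes (i , _) = proj₁ (τ i u)
    ... | no  _       = proj₁ (τ zero u)

    module _ {k} {τ : Fin (suc p) → Tree H S (suc k)} {f : Vector (Fin r) (suc p)} (τ≡ : ∀ {i j} → f i ≡ f j → τ i ≡ τ j) where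

      mixedAssignment-vertex : ∀ h i → mixedAssignment τ f (vertex h (f i)) ≡ proj₁ (τ i (vertex h (f i)))
      mixedAssignment-vertex h i with Fin.any? (λ j → f j Fin.≟ part (vertex h (f i)))
      -- The index `j` found need not be `i`, but it has the same part, so its tree is the same.
      ... | yes (j , fj≡) = ≡.cong (λ τ → proj₁ (τ (vertex h (f i)))) (τ≡ (≡.trans fj≡ (vertex-part h (f i))))
      ... | no  ∄j        = contradiction (i , ≡.sym (vertex-part h (f i))) ∄j

      -- Weak satisfaction asks for distinct vertices. Were the two vertices equal, their parts
      -- would agree, hence also the trees used there, and the two vectors would be the same.
      sharesColor⇒weaklySatisfies : ∀ h → SharesColor (vectors H S τ h f) → WeaklySatisfies (mixedAssignment τ f) h
      sharesColor⇒weaklySatisfies h (a , b , ua≢ub , same) = f a , f b , va≢vb , colors≡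
        where
        va≢vb : vertex h (f a) ≢ vertex h (f b)
        va≢vb va≡vb = ua≢ub (≡.cong₂ (λ x τ → x , π h x (proj₁ (τ (vertex h x)))) fa≡fb (τ≡ fa≡fb))
          where
          fa≡fb : f a ≡ f b
          fa≡fb = ≡.trans (≡.sym (vertex-part h (f a))) (≡.trans (≡.cong part va≡vb) (vertex-part h (f b)))
        colors≡ : colorIn (mixedAssignment τ f) h (f a) ≡ colorIn (mixedAssignment τ f) h (f b)
        colors≡ = ≡.trans (≡.cong (π h (f a)) (mixedAssignment-vertex h a))
          (≡.trans same (≡.sym (≡.cong (π h (f b)) (mixedAssignment-vertex h b))))

    module LowerBound (η D : A) (η≈ : suc p · ρ S ≈ η) (η≤1 : η ≤ₘ 1#) (ρ≤1 : ρ S ≤ₘ 1#) (0≤D : 0# ≤ₘ D)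
      (few : ∀ σ → (∣E∣ · 1#) * D ≤ₘ sum (λ h → when (¬? (weaklySatisfies? σ h)) 1#)) where

      -- With η = p/r and D = 1-p²ε this is α_1. The factor m in `mβ` is the number of hyperedges
      -- summed over at each level; the scaling of the norm cancels it in the end.
      β : A
      β = (1# - η) ^ suc p * D

      mβ : A
      mβ = (∣E∣ · 1#) * β

      0≤ρ : 0# ≤ₘ ρ S
      0≤ρ = 0≤1/d r

      0≤m : 0# ≤ₘ ∣E∣ · 1#
      0≤m = ×-nonNeg ∣E∣ 0≤1

      0≤mβ : 0# ≤ₘ mβ
      0≤mβ = *-nonNeg 0≤m (*-nonNeg (^-nonNeg (suc p) (x≤y⇒0≤y-x η≤1)) 0≤D)

      bound : ℕ → Vec (Subset (suc p)) (suc p) → A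
      bound k T = mβ ^ k * (#chains k T · 1#)

      0≤bound : ∀ k T → 0# ≤ₘ bound k T
      0≤bound k T = *-nonNeg (^-nonNeg k 0≤mβ) (×-nonNeg (#chains k T) 0≤1)

      treeM-bound : ∀ k T (τ : Fin (suc p) → Tree H S k) → (∀ i j → j ∈ lookup T i → τ i ≡ τ j) → bound k T ≤ₘ treeM H S k τ
      treeM-bound zero T τ τ≡ = ≤-reflexive (trans (*-identityˡ _) (trans (+-identityʳ 1#) (sym (treeM-zero H S τ))))
      treeM-bound (suc k) T τ τ≡ = begin
        (mβ * mβ ^ k) * (#chains (suc k) T · 1#)
          ≈⟨ *-congˡ (#chains-suc k T) ⟩
        (mβ * mβ ^ k) * sum (λ i → when (refinedBy? T (part′ i)) (#chains k (part′ i) · 1#))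
          ≈⟨ *-distribˡ-sum (mβ * mβ ^ k) (λ i → when (refinedBy? T (part′ i)) (#chains k (part′ i) · 1#)) ⟩
        sum (λ i → (mβ * mβ ^ k) * when (refinedBy? T (part′ i)) (#chains k (part′ i) · 1#))
          -- Each refinement T′ of T is paid for by the maps with kernel T′ alone; a partition that
          -- does not refine T has zero on the left and a nonnegative sum on the right.
          ≲⟨ sum-mono (λ i → refined (part′ i) (All.lookup (All-allPartitions (suc p)) (List.∈-lookup i)) (refinedBy? T (part′ i))) ⟩
        sum (λ i → sumᶠ (suc p) (λ f → when (kernel? (samePart? (part′ i)) f) (Z f)))
          ≈⟨ sum-sumᶠ-comm (suc p) (λ i f → when (kernel? (samePart? (part′ i)) f) (Z f)) ⟩
        sumᶠ (suc p) (λ f → sum (λ i → when (kernel? (samePart? (part′ i)) f) (Z f)))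
          ≲⟨ sumᶠ-mono (suc p) (λ f → sum-atMostOne (λ i → kernel? (samePart? (part′ i)) f)
               (λ {i} {j} ker ker′ → lookup-injective (Unique-allPartitions (suc p))
                 (kernel-unique {f = f} {part′ i} {part′ j} ker ker′))
               (0≤Z f)) ⟩
        sumᶠ (suc p) Z
          ≈⟨ sum-sumᶠ-comm (suc p) (λ h f → vecM S (vectors H S τ h f) * treeM H S k (branch H S τ h f)) ⟨
        sum (λ h → sumᶠ (suc p) (λ f → vecM S (vectors H S τ h f) * treeM H S k (branch H S τ h f)))
          ≈⟨ treeM-suc H S k τ ⟨
        treeM H S (suc k) τ ∎
        where
        part′ : Fin (length (allPartitions (suc p))) → Vec (Subset (suc p)) (suc p)
        part′ = List.lookup (allPartitions (suc p))

        -- The sum over h is placed inside the sum over f: the mixed assignment depends on f but not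
        -- on h, so the hyperedges it does not weakly satisfy can be counted only with f fixed.
        Z : Vector (Fin r) (suc p) → A
        Z f = sum (λ h → vecM S (vectors H S τ h f) * treeM H S k (branch H S τ h f))

        0≤Z : ∀ f → 0# ≤ₘ Z f
        0≤Z f = sum-nonNeg λ h → *-nonNeg (vecM-nonNeg S (vectors H S τ h f)) (treeM-nonNeg H S k (branch H S τ h f))

        module _ {T′ : Vec (Subset (suc p)) (suc p)} (T⊒T′ : RefinedBy T T′) {f : Vector (Fin r) (suc p)} (ker : Kernel (SamePart T′) f) where
          -- The point at which refinement is used: positions with the same value of f lie in one
          -- part of T′, hence in one part of T, and so carry the same tree.
          τ≡′ : ∀ {i j} → f i ≡ f j → τ i ≡ τ j
          τ≡′ {i} {j} fi≡fj = τ≡ i j (T⊒T′ i (proj₂ (ker i j) fi≡fj))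

          branch≡ : ∀ h i j → j ∈ lookup T′ i → branch H S τ h f i ≡ branch H S τ h f j
          branch≡ h i j j∈ = ≡.cong₂ (λ x τ → proj₂ (τ (vertex h x))) fi≡fj (τ≡′ fi≡fj)
            where fi≡fj = proj₁ (ker i j) j∈

          vectors≡ : ∀ h {i j} → j ∈ lookup T′ i → vectors H S τ h f i ≡ vectors H S τ h f j
          vectors≡ h {i} {j} j∈ = ≡.cong₂ (λ x τ → x , π h x (proj₁ (τ (vertex h x)))) fi≡fj (τ≡′ fi≡fj)
            where fi≡fj = proj₁ (ker i j) j∈

          -- When no color is shared, the product is 1/r to the number of distinct vectors.
          -- Positions in one class give one vector, so this number is at most the number of
          -- classes, and 1/r ≤ 1 turns that into a lower bound.
          vecM-bound : ∀ h → when (¬? (weaklySatisfies? (mixedAssignment τ f) h)) (ρ S ^ #classes (samePart? T′)) ≤ₘ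
                             vecM S (vectors H S τ h f)
          vecM-bound h with weaklySatisfies? (mixedAssignment τ f) h
          ... | yes _  = vecM-nonNeg S (vectors H S τ h f)
          ... | no ¬ws = ≤-trans
            (^-anti-≤ 0≤ρ ρ≤1 (#deduplicate≤#classes (×-≡-dec Fin._≟_ Fin._≟_) (samePart? T′) (vectors H S τ h f) (vectors≡ h)))
            (≤-reflexive (sym (vecM-otherwise S (vectors H S τ h f) (¬ws ∘ sharesColor⇒weaklySatisfies τ≡′ h))))

          Z-bound : ((∣E∣ · 1#) * D * bound k T′) * ρ S ^ #classes (samePart? T′) ≤ₘ Z f
          Z-bound = begin
            ((∣E∣ · 1#) * D * bound k T′) * w
              ≲⟨ *-monoˡ-≤ 0≤w (*-monoˡ-≤ (0≤bound k T′) (few (mixedAssignment τ f))) ⟩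
            (sum (λ h → when (good? h) 1#) * bound k T′) * w
              ≈⟨ solve 3 (λ x y z → (x :* y) :* z := x :* (z :* y)) refl (sum (λ h → when (good? h) 1#)) (bound k T′) w ⟩
            sum (λ h → when (good? h) 1#) * (w * bound k T′)
              ≈⟨ *-distribʳ-sum (w * bound k T′) (λ h → when (good? h) 1#) ⟩
            sum (λ h → when (good? h) 1# * (w * bound k T′))
              ≈⟨ sum-cong-≋ (λ h → trans (sym (*-assoc _ w (bound k T′)))
                   (*-congʳ (trans (sym (when-*ʳ (good? h) 1# w)) (when-cong (good? h) λ _ → *-identityˡ w)))) ⟩
            sum (λ h → when (good? h) w * bound k T′)
              ≲⟨ sum-mono (λ h → *-mono-≤ (when-nonNeg (good? h) 0≤w) (treeM-nonNeg H S k (branch H S τ h f))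
                   (vecM-bound h) (treeM-bound k T′ (branch H S τ h f) (branch≡ h))) ⟩
            Z f ∎
            where
            w : A
            w = ρ S ^ #classes (samePart? T′)
            0≤w : 0# ≤ₘ w
            0≤w = ^-nonNeg (#classes (samePart? T′)) 0≤ρ
            good? : ∀ h → Dec (¬ WeaklySatisfies (mixedAssignment τ f) h)
            good? h = ¬? (weaklySatisfies? (mixedAssignment τ f) h)

        refined : ∀ T′ → IsPartition T′ → (T⊒T′? : Dec (RefinedBy T T′)) →
          (mβ * mβ ^ k) * when T⊒T′? (#chains k T′ · 1#) ≤ₘ sumᶠ (suc p) (λ f → when (kernel? (samePart? T′) f) (Z f))
        refined T′ isP (no _) = ≤-trans (≤-reflexive (zeroʳ _)) (sumᶠ-nonNeg (suc p) λ f → when-nonNeg (kernel? (samePart? T′) f) (0≤Z f))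
        refined T′ isP (yes T⊒T′) = begin
          (mβ * mβ ^ k) * (#chains k T′ · 1#)
            ≈⟨ solve 5 (λ m x D y z → ((m :* (x :* D)) :* y) :* z := ((m :* D) :* (y :* z)) :* x) refl
                 (∣E∣ · 1#) ((1# - η) ^ suc p) D (mβ ^ k) (#chains k T′ · 1#) ⟩
          W * (1# - η) ^ suc p
            -- The `q` of the counting lemma is taken to be the number of positions itself, which
            -- makes η equal to p/r.
            ≲⟨ *-monoʳ-≤ 0≤W (sum-kernel (d·1/d≈1 r) η≈ 0≤ρ η≤1 (suc p) (samePart-isDecEquivalence {T = T′} isP) ℕ.≤-refl) ⟩
          W * sumᶠ {r} (suc p) (λ f → when (kernel? (samePart? T′) f) w)
            ≈⟨ *-distribˡ-sumᶠ (suc p) W (λ f → when (kernel? (samePart? T′) f) w) ⟩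
          sumᶠ {r} (suc p) (λ f → W * when (kernel? (samePart? T′) f) w)
            ≲⟨ sumᶠ-mono (suc p) (λ f → at f (kernel? (samePart? T′) f)) ⟩
          sumᶠ (suc p) (λ f → when (kernel? (samePart? T′) f) (Z f)) ∎
          where
          w W : A
          w = ρ S ^ #classes (samePart? T′)
          W = (∣E∣ · 1#) * D * bound k T′
          0≤W : 0# ≤ₘ W
          0≤W = *-nonNeg (*-nonNeg 0≤m 0≤D) (0≤bound k T′)
          at : ∀ f (ker? : Dec (Kernel (SamePart T′) f)) → W * when ker? w ≤ₘ when ker? (Z f)
          at f (yes ker) = Z-bound T⊒T′ ker
          at f (no _)    = ≤-reflexive (zeroʳ W)

  -- Correspondence between s-t walks and trees

  starSum-cong : ∀ {X : Set} {T : X → X → Set} {g g′ : ∀ {x y} → T x y → A} →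
    (∀ {x y} (a : T x y) → g a ≈ g′ a) → ∀ {x y} (as : Star T x y) → starSum {T = T} g as ≈ starSum {T = T} g′ as
  starSum-cong g≈ ε        = refl
  starSum-cong g≈ (a ◅ as) = +-cong (g≈ a) (starSum-cong g≈ as)

  ⟦walkCost⟧ : ∀ {d} (G : Graph d) {x y} (w : Graph.Walk G x y) i →
               ⟦ Graph.walkCost G w i ⟧ ≈ walkSum G (λ e → ⟦ Graph.cost G e i ⟧) w
  ⟦walkCost⟧ G ε             i = ⟦⟧-0
  ⟦walkCost⟧ G ((e , _) ◅ w) i = trans (⟦⟧-+ (Graph.cost G e i) (Graph.walkCost G w i)) (+-congˡ (⟦walkCost⟧ G w i))

  concat-natural : ∀ {X Y : Set} (g : X → Y) {m n} (f : Vector (Vector X n) m) i →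
                   g (Vector.concat f i) ≡ Vector.concat (λ a b → g (f a b)) i
  concat-natural g f i = ≡.refl

  singleEdge-ranking : Ranking singleEdge
  singleEdge-ranking = record { rank = rank ; rank-s = ≡.refl ; rank-increasing = λ _ → ℕ.≤-refl }
    where
    rank : Node (Graph.Inner singleEdge) → ℕ
    rank s = 0
    rank t = 1

  module _ {p r d₀ : ℕ} .{{r≢0 : NonZero r}} (H : LabelCover r) .{{V≢0 : NonZero (LabelCover.∣V∣ H)}}
           (S : VectorSystem r (LabelCover.∣C∣ H) (suc p) d₀) where
    open LabelCover H

    private
      G : Graph (∣E∣ ℕ.* d₀)
      G = basicReduction H S
      module G = Graph G
      J : Fin (suc ∣V∣) → Node (Fin (∣V∣ ℕ.∸ 1))
      J = junction ∣V∣

    reduction-ranking : Ranking G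
    reduction-ranking = record
      { rank = junctionRank ∣V∣
      ; rank-s = ≡.refl
      ; rank-increasing = λ (u , l) → ≡.subst₂ ℕ._<_
          (≡.sym (≡.trans (junctionRank-junction ∣V∣ (inject₁ u)) (Fin.toℕ-inject₁ u)))
          (≡.sym (junctionRank-junction ∣V∣ (suc u))) ℕ.≤-refl
      }

    power-ranking : ∀ k → Ranking (G ^⊗ k)
    power-ranking zero    = singleEdge-ranking
    power-ranking (suc k) = ⊗-ranking {G₁ = G} {G ^⊗ k} reduction-ranking (power-ranking k) λ (u , l) →
      ≡.trans (junctionRank-junction ∣V∣ (suc u))
        (≡.cong suc (≡.sym (≡.trans (junctionRank-junction ∣V∣ (inject₁ u)) (Fin.toℕ-inject₁ u))))

    power-head≢s : ∀ k e → Graph.head (G ^⊗ k) e ≢ s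
    power-head≢s zero    e = λ ()
    power-head≢s (suc k) = head-⊗≢s G (G ^⊗ k)
      (λ (u , l) eq → contradiction (junction-injective ∣V∣ {suc u} {zero} (≡.trans eq (≡.sym (junction-zero ∣V∣)))) λ ())
      (power-head≢s k)

    power-tail≢t : ∀ k e → Graph.tail (G ^⊗ k) e ≢ t
    power-tail≢t zero    e = λ ()
    power-tail≢t (suc k) = tail-⊗≢t G (G ^⊗ k)
      (λ (u , l) eq → Fin.fromℕ≢inject₁ (junction-injective ∣V∣ {Fin.fromℕ ∣V∣} {inject₁ u}
        (≡.trans (junction-fromℕ ∣V∣) (≡.sym eq))))
      (power-tail≢t k)

    WalkWithCost : ∀ k → Tree H S k → Node (Graph.Inner (G ^⊗ k)) → Node (Graph.Inner (G ^⊗ k)) → Set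
    WalkWithCost k τ x y = Σ (Graph.Walk (G ^⊗ k) x y) λ w →
      ∀ i → walkSum (G ^⊗ k) (λ e → ⟦ Graph.cost (G ^⊗ k) e i ⟧) w ≈ treeCost H S k τ i

    edge-weight : ∀ e q → ⟦ G.cost e q ⟧ ≈ weight H S e q
    edge-weight e q = reflexive (concat-natural ⟦_⟧ (λ h → edgeCost H S h e) q)

    walkSum-suc : ∀ k i {x y} (w : Graph.Walk (G ^⊗ suc k) x y) →
      walkSum (G ^⊗ suc k) (λ e → ⟦ Graph.cost (G ^⊗ suc k) e i ⟧) w ≈
      walkSum (G ^⊗ suc k) (λ (e₁ , e₂) → weight H S e₁ (proj₂ (quotRem {∣E∣ ℕ.* d₀} ((∣E∣ ℕ.* d₀) ℕ.^ k) i))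
        * ⟦ Graph.cost (G ^⊗ k) e₂ (proj₁ (quotRem {∣E∣ ℕ.* d₀} ((∣E∣ ℕ.* d₀) ℕ.^ k) i)) ⟧) w
    walkSum-suc k i = starSum-cong λ ((e₁ , e₂) , _) →
      trans (⟦⟧-⊗ᵛ (G.cost e₁) (Graph.cost (G ^⊗ k) e₂) i) (*-congʳ (edge-weight e₁ _))

    treeWalk : ∀ k τ → WalkWithCost k τ s t
    treeWalk zero τ = ((tt , ≡.refl , ≡.refl) ◅ ε) , λ i → trans (+-identityʳ _) ⟦⟧-1
    -- The outer junctions equal s and t only propositionally; the walk and its cost equation are
    -- transported together.
    treeWalk (suc k) τ = ≡.subst₂ (WalkWithCost (suc k) τ)
      (≡.cong (old G (G ^⊗ k)) (junction-zero ∣V∣)) (≡.cong (old G (G ^⊗ k)) (junction-fromℕ ∣V∣))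
      ( chain ∣V∣ (old G (G ^⊗ k) ∘ J) blocks
      , λ i → trans (walkSum-suc k i (chain ∣V∣ (old G (G ^⊗ k) ∘ J) blocks))
          (trans (starSum-chain _ ∣V∣ (old G (G ^⊗ k) ∘ J) blocks)
            (sum-cong-≋ λ u → trans (walkSum-glueWalk G (G ^⊗ k) _ _ (u , proj₁ (τ u)) (proj₁ (rec u))) (*-congˡ (proj₂ (rec u) _)))))
      where
      rec : ∀ u → WalkWithCost k (proj₂ (τ u)) s t
      rec u = treeWalk k (proj₂ (τ u))
      blocks : ∀ u → Graph.Walk (G ^⊗ suc k) (old G (G ^⊗ k) (J (inject₁ u))) (old G (G ^⊗ k) (J (suc u)))
      blocks u = glueWalk G (G ^⊗ k) (u , proj₁ (τ u)) (proj₁ (rec u))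

    -- At a fixed coordinate the cost of an edge of the product is a product of two weights, so
    -- ungluing into passages and then unchaining into blocks reads off a label and a subwalk for
    -- each vertex. The tree is fixed before the coordinate `i` is given.
    walkTree : ∀ k (w : Graph.Walk (G ^⊗ k) s t) → Σ (Tree H S k) λ τ →
      ∀ i → walkSum (G ^⊗ k) (λ e → ⟦ Graph.cost (G ^⊗ k) e i ⟧) w ≈ treeCost H S k τ i
    walkTree zero    ((_ , ≡.refl , ≡.refl) ◅ ε) = tt , λ i → trans (+-identityʳ _) ⟦⟧-1
    walkTree zero    ((_ , ≡.refl , ≡.refl) ◅ ((_ , () , _) ◅ _))
    walkTree (suc k) w = (λ u → label u , proj₁ (rec u)) , λ i → begin-equality
      walkSum (G ^⊗ suc k) (λ e → ⟦ Graph.cost (G ^⊗ suc k) e i ⟧) w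
        ≈⟨ walkSum-suc k i w ⟩
      walkSum (G ^⊗ suc k) (λ (e₁ , e₂) → w₁ i e₁ * w₂ i e₂) w
        ≈⟨ proj₂ ungluing (w₁ i) (w₂ i) ⟩
      superSum G (G ^⊗ k) (w₁ i) (w₂ i) (proj₁ ungluing)
        ≈⟨ proj₂ unchaining (λ ((e , _) , ws) → w₁ i e * walkSum (G ^⊗ k) (w₂ i) ws) ⟩
      sum (λ u → w₁ i (edge u) * walkSum (G ^⊗ k) (w₂ i) (subwalk u))
        ≈⟨ sum-cong-≋ (λ u → *-cong (reflexive (≡.cong (w₁ i) (edge≡ u))) (proj₂ (rec u) (proj₁ (quotRem {∣E∣ ℕ.* d₀} ((∣E∣ ℕ.* d₀) ℕ.^ k) i)))) ⟩
      treeCost H S (suc k) (λ u → label u , proj₁ (rec u)) i ∎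
      where
      w₁ : Fin ((∣E∣ ℕ.* d₀) ℕ.^ suc k) → G.Edge → A
      w₁ i e = weight H S e (proj₂ (quotRem {∣E∣ ℕ.* d₀} ((∣E∣ ℕ.* d₀) ℕ.^ k) i))
      w₂ : Fin ((∣E∣ ℕ.* d₀) ℕ.^ suc k) → Graph.Edge (G ^⊗ k) → A
      w₂ i e = ⟦ Graph.cost (G ^⊗ k) e (proj₁ (quotRem {∣E∣ ℕ.* d₀} ((∣E∣ ℕ.* d₀) ℕ.^ k) i)) ⟧
      ungluing : Σ (Star (SuperArc G (G ^⊗ k)) s t) λ as → ∀ w₁ w₂ →
        walkSum (G ^⊗ suc k) (λ (e₁ , e₂) → w₁ e₁ * w₂ e₂) w ≈ superSum G (G ^⊗ k) w₁ w₂ as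
      ungluing = unglue G (G ^⊗ k) (power-head≢s k) (power-tail≢t k) w {s} {t} ≡.refl ≡.refl
      inject₁≡ : ∀ {u u′} → J (inject₁ u′) ≡ J (inject₁ u) → u′ ≡ u
      inject₁≡ eq = Fin.inject₁-injective (junction-injective ∣V∣ eq)
      inject₁≢fromℕ : ∀ u → J (inject₁ u) ≢ J (Fin.fromℕ ∣V∣)
      inject₁≢fromℕ u eq = Fin.fromℕ≢inject₁ (≡.sym (junction-injective ∣V∣ {inject₁ u} {Fin.fromℕ ∣V∣} eq))
      unchaining : Σ (∀ u → SuperArc G (G ^⊗ k) (J (inject₁ u)) (J (suc u))) λ arcs →
        ∀ (g : ∀ {x y} → SuperArc G (G ^⊗ k) x y → A) → starSum {T = SuperArc G (G ^⊗ k)} g (proj₁ ungluing) ≈ sum (λ u → g (arcs u))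
      unchaining = unchain {T = SuperArc G (G ^⊗ k)} ∣V∣ J
        (λ { u (((u′ , l) , tail≡ , head≡) , _) → ≡.trans (≡.sym head≡) (≡.cong (J ∘ suc) (inject₁≡ tail≡)) })
        (λ { (((u′ , l) , tail≡ , head≡) , _) → inject₁≢fromℕ u′ tail≡ })
        inject₁≢fromℕ (≡.sym (junction-zero ∣V∣)) (≡.sym (junction-fromℕ ∣V∣)) (proj₁ ungluing)
      edge : Fin ∣V∣ → G.Edge
      edge u = proj₁ (proj₁ (proj₁ unchaining u))
      subwalk : Fin ∣V∣ → Graph.Walk (G ^⊗ k) s t
      subwalk u = proj₂ (proj₁ unchaining u)
      label : Fin ∣V∣ → Fin ∣L∣
      label u = proj₂ (edge u)
      edge≡ : ∀ u → edge u ≡ (u , label u)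
      edge≡ u = ≡.cong (_, label u) (inject₁≡ (proj₁ (proj₂ (proj₁ (proj₁ unchaining u)))))
      rec : ∀ u → Σ (Tree H S k) λ τ →
        ∀ i → walkSum (G ^⊗ k) (λ e → ⟦ Graph.cost (G ^⊗ k) e i ⟧) (subwalk u) ≈ treeCost H S k τ i
      rec u = walkTree k (subwalk u)

  -- The norm and α_k in the opaque ring

  ⟦pow⟧ : ∀ x n → ⟦ pow x n ⟧ ≈ ⟦ x ⟧ ^ n
  ⟦pow⟧ x n = ⟦⟧-^ x n

  ⟦sumOfPowers⟧ : ∀ {d} (x : Vector ℝ d) p → ⟦ sumOfPowers x p ⟧ ≈ sum (λ i → ⟦ Defs.∣ x i ∣ ⟧ ^ p)
  ⟦sumOfPowers⟧ {d} x p = trans (⟦⟧-sum {d} (λ i → Defs.∣ x i ∣ Defs.^ p)) (sum-cong-≋ λ i → ⟦⟧-^ Defs.∣ x i ∣ p)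

  ⟦norm⟧ : ∀ {d} (x : Vector ℝ d) p m k .{{_ : NonZero m}} →
           ⟦ ∥ x ∥^ p m k ⟧ ≈ ⟦ fromℚ (+ 1 ℚ./ m) ⟧ ^ k * sum (λ i → ⟦ Defs.∣ x i ∣ ⟧ ^ p)
  ⟦norm⟧ x p m k {{m≢0}} = trans (⟦⟧-cong _ _ (norm-factor x p m k {{m≢0}}))
    (trans (⟦⟧-* (pow (fromℚ (ℚ._/_ (+ 1) m {{m≢0}})) k) (sumOfPowers x p))
      (*-cong (⟦pow⟧ (fromℚ (ℚ._/_ (+ 1) m {{m≢0}})) k) (⟦sumOfPowers⟧ x p)))

  -- Regroups α_k as the k-th power of α_1, one factor for each level of the induction.
  ⟦α⟧ : ∀ k p r .{{_ : NonZero r}} x → ⟦ α k p r x ⟧ ≈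
        ((1# - ⟦ fromℚ (+ p ℚ./ r) ⟧) ^ p * (1# - ⟦ fromℕ (p ℕ.^ 2) ⟧ * ⟦ x ⟧)) ^ k
  ⟦α⟧ k p r {{r≢0}} x = begin-equality
    ⟦ α k p r {{r≢0}} x ⟧
      ≈⟨ ⟦⟧-cong _ _ (α-factor k p r {{r≢0}} x) ⟩
    ⟦ pow (1ℝ Defs.- fromℚ (ℚ._/_ (+ p) r {{r≢0}})) (p ℕ.* k) Defs.* pow (1ℝ Defs.- fromℕ (p ℕ.^ 2) Defs.* x) k ⟧
      ≈⟨ ⟦⟧-* (pow (1ℝ Defs.- fromℚ (ℚ._/_ (+ p) r {{r≢0}})) (p ℕ.* k)) (pow (1ℝ Defs.- fromℕ (p ℕ.^ 2) Defs.* x) k) ⟩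
    ⟦ pow (1ℝ Defs.- fromℚ (ℚ._/_ (+ p) r {{r≢0}})) (p ℕ.* k) ⟧ * ⟦ pow (1ℝ Defs.- fromℕ (p ℕ.^ 2) Defs.* x) k ⟧
      ≈⟨ *-cong (trans (⟦pow⟧ (1ℝ Defs.- fromℚ (ℚ._/_ (+ p) r {{r≢0}})) (p ℕ.* k)) (^-congˡ (p ℕ.* k) (⟦⟧-1- (fromℚ (ℚ._/_ (+ p) r {{r≢0}})))))
                (trans (⟦pow⟧ (1ℝ Defs.- fromℕ (p ℕ.^ 2) Defs.* x) k) (^-congˡ k (trans (⟦⟧-1- (fromℕ (p ℕ.^ 2) Defs.* x))
                  (+-congˡ (-‿cong (⟦⟧-* (fromℕ (p ℕ.^ 2)) x)))))) ⟩
    y ^ (p ℕ.* k) * z ^ k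
      ≈⟨ *-congʳ (^-assocʳ y p k) ⟨
    (y ^ p) ^ k * z ^ k
      ≈⟨ ^-distrib-* (y ^ p) z k ⟨
    (y ^ p * z) ^ k ∎
    where
    y z : A
    y = 1# - ⟦ fromℚ (ℚ._/_ (+ p) r {{r≢0}}) ⟧
    z = 1# - ⟦ fromℕ (p ℕ.^ 2) ⟧ * ⟦ x ⟧

  module _ {d} (x : Vector ℝ d) (c : Vector A d) (x≈c : ∀ i → ⟦ x i ⟧ ≈ c i) (p m k : ℕ) .{{m≢0 : NonZero m}} where

    norm≈1 : (2 ∣ p) ⊎ (∀ i → 0# ≤ₘ c i) →
             ⟦ fromℚ (ℚ._/_ (+ 1) m {{m≢0}}) ⟧ ^ k * sum (λ i → c i ^ p) ≈ 1# →
             ∥_∥^ x p m k {{m≢0}} Defs.≈ 1ℝ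
    norm≈1 evenOrNonNeg eq = ⟦⟧-injective (∥_∥^ x p m k {{m≢0}}) 1ℝ
      (trans (⟦norm⟧ x p m k {{m≢0}})
        (trans (*-congˡ (sum-cong-≋ λ i → trans (∣x∣^p≈x^p evenOrNonNeg i) (^-congˡ p (x≈c i)))) (trans eq (sym ⟦⟧-1))))
      where
      ∣x∣^p≈x^p : (2 ∣ p) ⊎ (∀ i → 0# ≤ₘ c i) → ∀ i → ⟦ Defs.∣ x i ∣ ⟧ ^ p ≈ ⟦ x i ⟧ ^ p
      ∣x∣^p≈x^p (inj₁ 2∣p) i = ∣∣^-even (x i) 2∣p
      ∣x∣^p≈x^p (inj₂ 0≤c) i = ^-congˡ p (⟦∣∣⟧-nonNeg (x i) (≤-trans (0≤c i) (≤-reflexive (sym (x≈c i)))))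

    α*n≤norm : ∀ r .{{r≢0 : NonZero r}} y n →
      ((1# - ⟦ fromℚ (ℚ._/_ (+ p) r {{r≢0}}) ⟧) ^ p * (1# - ⟦ fromℕ (p ℕ.^ 2) ⟧ * ⟦ y ⟧)) ^ k * (n · 1#) ≤ₘ
        ⟦ fromℚ (ℚ._/_ (+ 1) m {{m≢0}}) ⟧ ^ k * sum (λ i → c i ^ p) →
      α k p r {{r≢0}} y Defs.* fromℕ n Defs.≤ ∥_∥^ x p m k {{m≢0}}
    α*n≤norm r {{r≢0}} y n le = ⟦⟧-cancel (α k p r {{r≢0}} y Defs.* fromℕ n) (∥_∥^ x p m k {{m≢0}})
      (≤-trans (≤-reflexive (trans (⟦⟧-* (α k p r {{r≢0}} y) (fromℕ n)) (*-cong (⟦α⟧ k p r {{r≢0}} y) (⟦⟧-fromℕ n))))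
        (≤-trans le
          (≤-trans (*-monoʳ-≤ (^-nonNeg k (0≤1/d m {{m≢0}})) (sum-mono λ i →
              ≤-trans (≤-reflexive (^-congˡ p (sym (x≈c i)))) (^-≤-∣∣^ (x i) p)))
            (≤-reflexive (sym (⟦norm⟧ x p m k {{m≢0}}))))))

  1/m*m≈1 : ∀ m .{{_ : NonZero m}} → ⟦ fromℚ (+ 1 ℚ./ m) ⟧ * (m · 1#) ≈ 1#
  1/m*m≈1 m = trans (×-comm-* m _ 1#) (trans (×-congʳ m (*-identityʳ _)) (d·1/d≈1 m))

  someFin : ∀ n .{{_ : NonZero n}} → Fin n
  someFin (suc n) = zero

  -- Statements (a) and (b) for a positive exponent

  module _ {p r d₀ : ℕ} .{{r≢0 : NonZero r}} (H : LabelCover r) .{{E≢0 : NonZero (LabelCover.∣E∣ H)}}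
           (S : VectorSystem r (LabelCover.∣C∣ H) (suc p) d₀) (k : ℕ) where
    open LabelCover H
    open VectorSystem S

    private
      instance
        V≢0 : NonZero ∣V∣
        -- Some hyperedge and some part exist, and the hyperedge has a vertex in that part.
        V≢0 = Fin.nonZeroIndex (vertex (someFin ∣E∣) (someFin r))

      μ : A
      μ = ⟦ fromℚ (ℚ._/_ (+ 1) ∣E∣ {{E≢0}}) ⟧


    sum-treeCost^ : ∀ τ → sum (λ i → treeCost H S k τ i ^ suc p) ≈ treeM H S k (λ _ → τ)
    sum-treeCost^ τ = sum-cong-≋ λ i → sym (product-replicate (suc p) {treeCost H S k τ i})

    completeness-suc : (2 ∣ suc p) ⊎ (∀ a i → 0ℝ Defs.≤ vec a i) → (∃ λ σ → ∀ h → Satisfies σ h) →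
                   Σ (Graph.STPath (basicReduction H S ^⊗ k)) λ P → ∥ Graph.pathCost (basicReduction H S ^⊗ k) P ∥^ (suc p) ∣E∣ k Defs.≈ 1ℝ
    completeness-suc evenOrNonNeg (σ , satisfies) = path ,
      norm≈1 (Graph.pathCost (basicReduction H S ^⊗ k) path) (treeCost H S k τ) cost≈ (suc p) ∣E∣ k {{E≢0}} (nonNeg evenOrNonNeg) (begin-equality
        μ ^ k * sum (λ i → treeCost H S k τ i ^ suc p)
          ≈⟨ *-congˡ (sum-treeCost^ τ) ⟩
        μ ^ k * treeM H S k (λ _ → τ)
          ≈⟨ *-congˡ (treeM-constTree H S σ satisfies k) ⟩
        μ ^ k * (∣E∣ · 1#) ^ k
          ≈⟨ ^-distrib-* μ (∣E∣ · 1#) k ⟨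
        (μ * (∣E∣ · 1#)) ^ k
          ≈⟨ trans (^-congˡ k (1/m*m≈1 ∣E∣)) (1^n≈1 k) ⟩
        1# ∎)
      where
      τ : Tree H S k
      τ = constTree H S σ k
      w : Graph.Walk (basicReduction H S ^⊗ k) s t
      w = proj₁ (treeWalk H S k τ)
      path : Graph.STPath (basicReduction H S ^⊗ k)
      path = w , Ranking.visited-unique (power-ranking H S k) w
      cost≈ : ∀ i → ⟦ Graph.pathCost (basicReduction H S ^⊗ k) path i ⟧ ≈ treeCost H S k τ i
      cost≈ i = trans (⟦walkCost⟧ (basicReduction H S ^⊗ k) w i) (proj₂ (treeWalk H S k τ) i)
      nonNeg : (2 ∣ suc p) ⊎ (∀ a i → 0ℝ Defs.≤ vec a i) → (2 ∣ suc p) ⊎ (∀ i → 0# ≤ₘ treeCost H S k τ i)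
      nonNeg (inj₁ 2∣p)   = inj₁ 2∣p
      nonNeg (inj₂ 0≤vec) = inj₂ (treeCost-nonNeg H S
        (λ a i → ≤-trans (≤-reflexive (sym ⟦⟧-0)) (⟦⟧-mono 0ℝ (vec a i) (0≤vec a i))) k τ)

    module _ (x : ℝ) (p≤r : suc p ℕ.≤ r) (p²x≤1 : fromℕ (suc p ℕ.^ 2) Defs.* x Defs.≤ 1ℝ)
             (weak≤x : ∀ σ → fromℚ (+ #weaklySatisfied σ ℚ./ ∣E∣) Defs.≤ x) where
      private
        m̂ η c D : A
        m̂ = ∣E∣ · 1#
        η = ⟦ fromℚ (+ suc p ℚ./ r) ⟧
        c = ⟦ fromℕ (suc p ℕ.^ 2) ⟧ * ⟦ x ⟧
        D = 1# - c

        0≤m̂ : 0# ≤ₘ m̂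
        0≤m̂ = ×-nonNeg ∣E∣ 0≤1

        c≤1 : c ≤ₘ 1#
        c≤1 = ≤-trans (≤-reflexive (sym (⟦⟧-* (fromℕ (suc p ℕ.^ 2)) x)))
          (≤-trans (⟦⟧-mono (fromℕ (suc p ℕ.^ 2) Defs.* x) 1ℝ p²x≤1) (≤-reflexive ⟦⟧-1))

        n·ρ≤1 : ∀ {n} → n ℕ.≤ r → n · ρ S ≤ₘ 1#
        n·ρ≤1 n≤r = ≤-trans (×-mono-≤ (0≤1/d r) n≤r) (≤-reflexive (d·1/d≈1 r))

        weak·μ≤x : ∀ σ → #weaklySatisfied σ · μ ≤ₘ ⟦ x ⟧
        weak·μ≤x σ = ≤-trans (≤-reflexive (sym (⟦⟧-/ (#weaklySatisfied σ) ∣E∣)))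
          (⟦⟧-mono (fromℚ (+ #weaklySatisfied σ ℚ./ ∣E∣)) x (weak≤x σ))

        -- Passing from x to p²x requires 0 ≤ x. This comes from the fraction of hyperedges weakly
        -- satisfied by σ, which is nonnegative and at most x; hence the argument σ.
        x≤c : ∀ σ → ⟦ x ⟧ ≤ₘ c
        x≤c σ = begin
          ⟦ x ⟧
            ≈⟨ trans (*-congʳ (+-identityʳ 1#)) (*-identityˡ ⟦ x ⟧) ⟨
          (1 · 1#) * ⟦ x ⟧
            ≲⟨ *-monoˡ-≤ (≤-trans (×-nonNeg (#weaklySatisfied σ) (0≤1/d ∣E∣)) (weak·μ≤x σ)) (×-mono-≤ {n = suc p ℕ.^ 2} 0≤1 (s≤s z≤n)) ⟩
          ((suc p ℕ.^ 2) · 1#) * ⟦ x ⟧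
            ≈⟨ *-congʳ (⟦⟧-fromℕ (suc p ℕ.^ 2)) ⟨
          c ∎

        weak≤m̂c : ∀ σ → #weaklySatisfied σ · 1# ≤ₘ m̂ * c
        weak≤m̂c σ = begin
          #weaklySatisfied σ · 1#
            ≈⟨ ×-congʳ (#weaklySatisfied σ) (trans (*-comm m̂ μ) (1/m*m≈1 ∣E∣)) ⟨
          #weaklySatisfied σ · (m̂ * μ)
            ≈⟨ ×-comm-* (#weaklySatisfied σ) m̂ μ ⟨
          m̂ * (#weaklySatisfied σ · μ)
            ≲⟨ *-monoʳ-≤ 0≤m̂ (≤-trans (weak·μ≤x σ) (x≤c σ)) ⟩
          m̂ * c ∎

        few : ∀ σ → m̂ * D ≤ₘ sum (λ h → when (¬? (weaklySatisfies? σ h)) 1#)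
        few σ = ≤-trans
          (≤-reflexive (trans (distribˡ m̂ 1# (- c)) (+-cong (*-identityʳ m̂) (sym (-‿distribʳ-* m̂ c)))))
          (x≤y+z⇒x-z≤y (begin
            m̂
              ≈⟨ sum-replicate ∣E∣ ⟨
            sum (Vector.replicate ∣E∣ 1#)
              ≈⟨ sum-cong-≋ (λ h → split (weaklySatisfies? σ h)) ⟩
            sum (λ h → when (¬? (weaklySatisfies? σ h)) 1# + when (weaklySatisfies? σ h) 1#)
              ≈⟨ ∑-distrib-+ (λ h → when (¬? (weaklySatisfies? σ h)) 1#) (λ h → when (weaklySatisfies? σ h) 1#) ⟩
            sum (λ h → when (¬? (weaklySatisfies? σ h)) 1#) + sum (λ h → when (weaklySatisfies? σ h) 1#)
              ≈⟨ +-congˡ (count-filter-tabulate (weaklySatisfies? σ) (λ h → h)) ⟨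
            sum (λ h → when (¬? (weaklySatisfies? σ h)) 1#) + #weaklySatisfied σ · 1#
              ≲⟨ +-monoʳ-≤ _ (weak≤m̂c σ) ⟩
            sum (λ h → when (¬? (weaklySatisfies? σ h)) 1#) + m̂ * c ∎))
          where
          split : ∀ {P : Set} (P? : Dec P) → 1# ≈ when (¬? P?) 1# + when P? 1#
          split (yes _) = sym (+-identityˡ 1#)
          split (no _)  = sym (+-identityʳ 1#)

        open LowerBound H S η D (sym (⟦⟧-/ (suc p) r)) (≤-trans (≤-reflexive (⟦⟧-/ (suc p) r)) (n·ρ≤1 p≤r))
          (≤-trans (≤-reflexive (sym (+-identityʳ (ρ S)))) (n·ρ≤1 (ℕ.≤-trans (s≤s z≤n) p≤r)))
          (x≤y⇒0≤y-x c≤1) few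

      soundness-suc : (P : Graph.STPath (basicReduction H S ^⊗ k)) → α k (suc p) r x Defs.* fromℕ (b k (suc p)) Defs.≤ ∥ Graph.pathCost (basicReduction H S ^⊗ k) P ∥^ (suc p) ∣E∣ k
      soundness-suc P = α*n≤norm (Graph.pathCost (basicReduction H S ^⊗ k) P) (treeCost H S k τ) cost≈ (suc p) ∣E∣ k {{E≢0}} r {{r≢0}} x (b k (suc p)) (begin
        β ^ k * (b k (suc p) · 1#)
          ≈⟨ *-congʳ (^-congˡ k (trans (sym (*-assoc μ m̂ β)) (trans (*-congʳ (1/m*m≈1 ∣E∣)) (*-identityˡ β)))) ⟨
        (μ * mβ) ^ k * (b k (suc p) · 1#)
          ≈⟨ trans (*-congʳ (^-distrib-* μ mβ k)) (*-assoc (μ ^ k) (mβ ^ k) _) ⟩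
        μ ^ k * (mβ ^ k * (b k (suc p) · 1#))
          ≡⟨ ≡.cong (λ n → μ ^ k * (mβ ^ k * (n · 1#))) (b≡#chains k) ⟩
        μ ^ k * bound k trivialPartition
          -- All p trees are the tree of `P`, so they are constant on the single part of the trivial
          -- partition.
          ≲⟨ *-monoʳ-≤ (^-nonNeg k (0≤1/d ∣E∣)) (treeM-bound k trivialPartition (λ _ → τ) (λ _ _ _ → ≡.refl)) ⟩
        μ ^ k * treeM H S k (λ _ → τ)
          ≈⟨ *-congˡ (sum-treeCost^ τ) ⟨
        μ ^ k * sum (λ i → treeCost H S k τ i ^ suc p) ∎)
        where
        τ : Tree H S k
        τ = proj₁ (walkTree H S k (proj₁ P))
        cost≈ : ∀ i → ⟦ Graph.pathCost (basicReduction H S ^⊗ k) P i ⟧ ≈ treeCost H S k τ i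
        cost≈ i = trans (⟦walkCost⟧ (basicReduction H S ^⊗ k) (proj₁ P) i) (proj₂ (walkTree H S k (proj₁ P)) i)

  completeness : ∀ {p r d₀} → 1 ℕ.≤ p → .{{r≢0 : NonZero r}} (H : LabelCover r) (let open LabelCover H) .{{E≢0 : NonZero ∣E∣}}
    (S : VectorSystem r ∣C∣ p d₀) (let open VectorSystem S) (k : ℕ) →
    (2 ∣ p) ⊎ (∀ a i → 0ℝ Defs.≤ vec a i) → (∃ λ σ → ∀ h → Satisfies σ h) →
    Σ (Graph.STPath (basicReduction H S ^⊗ k)) λ P → ∥ Graph.pathCost (basicReduction H S ^⊗ k) P ∥^ p ∣E∣ k Defs.≈ 1ℝ
  completeness {suc p} {r} {d₀} _ {{r≢0}} H {{E≢0}} S k = completeness-suc {p} {r} {d₀} {{r≢0}} H {{E≢0}} S k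

  soundness : ∀ {p r d₀} → 1 ℕ.≤ p → .{{r≢0 : NonZero r}} (H : LabelCover r) (let open LabelCover H) .{{E≢0 : NonZero ∣E∣}}
    (S : VectorSystem r ∣C∣ p d₀) (k : ℕ) (x : ℝ) → p ℕ.≤ r → fromℕ (p ℕ.^ 2) Defs.* x Defs.≤ 1ℝ →
    (∀ σ → fromℚ (+ #weaklySatisfied σ ℚ./ ∣E∣) Defs.≤ x) →
    (P : Graph.STPath (basicReduction H S ^⊗ k)) →
    α k p r x Defs.* fromℕ (b k p) Defs.≤ ∥ Graph.pathCost (basicReduction H S ^⊗ k) P ∥^ p ∣E∣ k
  soundness {suc p} {r} {d₀} _ {{r≢0}} H {{E≢0}} S k = soundness-suc {p} {r} {d₀} {{r≢0}} H {{E≢0}} S k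

open Proof using (completeness; soundness)
open Defs using (_*_; _≤_; _≈_)

-- The number of edges

power-edges : ∀ {n d} (G : Graph d) → Fin n ↔ Graph.Edge G → ∀ k → Fin (n ℕ.^ k) ↔ Graph.Edge (G ^⊗ k)
power-edges     G n↔E zero    = Fin.1↔⊤
power-edges {n} G n↔E (suc k) = (n↔E ×-↔ power-edges G n↔E k) ↔-∘ Fin.*↔×

module _ {r} (H : LabelCover r) where
  open LabelCover H

  edges≤size : ∀ k → (∣V∣ ℕ.* ∣L∣) ℕ.^ k ℕ.≤ size ℕ.^ (2 ℕ.* k)
  edges≤size k = begin
    (∣V∣ ℕ.* ∣L∣) ℕ.^ k
      ≤⟨ ℕ.^-monoˡ-≤ k (ℕ.*-mono-≤ V≤size L≤size) ⟩
    (size ℕ.* size) ℕ.^ k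
      ≡⟨ ≡.cong (λ n → (size ℕ.* n) ℕ.^ k) (ℕ.*-identityʳ size) ⟨
    (size ℕ.^ 2) ℕ.^ k
      ≡⟨ ℕ.^-*-assoc size 2 k ⟩
    size ℕ.^ (2 ℕ.* k) ∎
    where
    open ℕ.≤-Reasoning
    VL≤size : ∣V∣ ℕ.⊔ ∣L∣ ℕ.≤ size
    VL≤size = ℕ.≤-trans (ℕ.m≤m⊔n (∣V∣ ℕ.⊔ ∣L∣) ∣C∣) (ℕ.m≤m⊔n (∣V∣ ℕ.⊔ ∣L∣ ℕ.⊔ ∣C∣) ∣E∣)
    V≤size : ∣V∣ ℕ.≤ size
    V≤size = ℕ.≤-trans (ℕ.m≤m⊔n ∣V∣ ∣L∣) VL≤size
    L≤size : ∣L∣ ℕ.≤ size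
    L≤size = ℕ.≤-trans (ℕ.m≤n⊔m ∣V∣ ∣L∣) VL≤size

theorem6p1 :
    (p : ℕ) → 2 ℕ.≤ p →
    (r : ℕ) .{{_ : NonZero r}} → 2 ℕ.≤ r →
    (H : LabelCover r) → let open LabelCover H in .{{_ : NonZero ∣E∣}} →
    (d₀ : ℕ) (S : VectorSystem r ∣C∣ p d₀) → let open VectorSystem S in
    (k : ℕ) → 1 ℕ.≤ k →
    let Gᵏ = basicReduction H S ^⊗ k
        open Graph Gᵏ
    in
      ((2 ∣ p) ⊎ (∀ a i → 0ℝ ≤ vec a i) →
        (∃ λ σ → ∀ h → Satisfies σ h) →
        Σ STPath λ P → ∥ pathCost P ∥^ p ∣E∣ k ≈ 1ℝ)
      ×
      ((ε : ℝ) → p ℕ.≤ r → fromℕ (p ℕ.^ 2) * ε ≤ 1ℝ →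
        (∀ σ → fromℚ (+ #weaklySatisfied σ ℚ./ ∣E∣) ≤ ε) →
        (P : STPath) → α k p r ε * fromℕ (b k p) ≤ ∥ pathCost P ∥^ p ∣E∣ k)
      ×
      (∃ λ N → (Fin N ↔ Edge) × N ℕ.≤ size ℕ.^ (2 ℕ.* k))
theorem6p1 p 2≤p r {{r≢0}} _ H {{E≢0}} d₀ S k _ =
    completeness {p} {r} {d₀} (ℕ.<⇒≤ 2≤p) {{r≢0}} H {{E≢0}} S k
  , soundness {p} {r} {d₀} (ℕ.<⇒≤ 2≤p) {{r≢0}} H {{E≢0}} S k
  , (LabelCover.∣V∣ H ℕ.* LabelCover.∣L∣ H) ℕ.^ k
  , power-edges (basicReduction H S) Fin.*↔× k
  , edges≤size H k
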